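{- Let $\Gamma$ be a planar network of order $n$ whose edges carry indeterminate weights, and let $W=(w_{i,j})$ be its $n\times n$ weight matrix. Let $k\geq 1$ and let $A=\{a_1<\cdots<a_k\}$ and $B=\{b_1<\cdots<b_k\}$ be subsets of $\{0,1,\ldots,n-1\}$, each of cardinality $k$. Let $T=(t_{i,j})$ be the $(A,B)$-minor matrix of $W$, i.e. $t_{i,j}=\det W[i+A,\,j+B]$ for $1\le i\le n-a_k$, $1\le j\le n-b_k$. Then every $2\times 2$ minor of $T$ is a polynomial in the edge weights of $\Gamma$ having no negative coefficients (i.e. it is a subtraction-free expression in the weights).
   Context: A planar network of order $n$ is a finite directed acyclic planar graph with exactly $n$ sources $s_1,\ldots,s_n$ and $n$ sinks $t_1,\ldots,t_n$, all lying on the boundary, arranged so that in counterclockwise order around the boundary they read $s_1,\ldots,s_n,t_n,\ldots,t_1$ (drawn with sources on the left, sinks on the right, all edges directed left to right). Each edge is assigned an indeterminate weight. A path is a directed path from some source $s_i$ to some sink $t_j$; its weight $\omega(\pi)$ is the product of the weights of its edges. The weight matrix $W=(w_{i,j})$ has $w_{i,j}=\sum_{\pi}\omega(\pi)$, the sum over all paths from $s_i$ to $t_j$ (empty sum $=0$). For index sets $I=\{i_1<\cdots<i_k\}$, $J=\{j_1<\cdots<j_k\}$, $W[I,J]$ denotes the $k\times k$ submatrix with rows in $I$ and columns in $J$. For a set $A$ and integer $i$, $i+A=\{i+a: a\in A\}$. -}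

module Defs where

open import Data.Nat as ℕ using (ℕ; zero; suc; _<_; _≤_; _<?_)
open import Data.Integer as ℤ using (ℤ; +_; -_)
open import Data.Fin as Fin using (Fin; zero; suc; toℕ; fromℕ; inject₁; punchIn; splitAt; join; _↑ˡ_; _↑ʳ_; opposite; fromℕ<)
open import Data.Vec as Vec using (Vec)
open import Data.Vec.Properties as VecP using ()
open import Data.List as List using (List; []; _∷_; _++_; map; concatMap; foldr; allFin; filterᵇ; length)
open import Data.List.Membership.Propositional using (_∈_)
open import Data.List.Relation.Unary.Unique.Propositional using (Unique)
open import Data.Product using (Σ; ∃; _×_; _,_; proj₁; proj₂; map₁)
open import Data.Sum using (_⊎_; inj₁; inj₂; [_,_]′; swap)
open import Data.Bool using (Bool; true; false; _∨_; _∧_; not; if_then_else_)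
open import Relation.Binary.PropositionalEquality using (_≡_; _≢_)
open import Relation.Nullary using (¬_; yes; no)
open import Relation.Nullary.Decidable using (⌊_⌋)
open import Function using (_∘_)
open import Data.Bool.ListAction using (any; all)

-- Multivariate polynomials over ℤ in the indeterminates x_0,…,x_{m-1}.
-- A polynomial is a finite formal sum of terms c·x^μ (a list of terms);
-- two lists denote the same polynomial iff all coefficients agree.

Monomial : ℕ → Set
Monomial m = Vec ℕ m

Poly : ℕ → Set
Poly m = List (ℤ × Monomial m)

coeff : ∀ {m} → Poly m → Monomial m → ℤ
coeff [] μ = + 0
coeff ((c , ν) ∷ p) μ with VecP.≡-dec ℕ._≟_ ν μ
... | yes _ = c ℤ.+ coeff p μ
... | no  _ = coeff p μ

0P : ∀ {m} → Poly m
0P = []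

1P : ∀ {m} → Poly m
1P {m} = (+ 1 , Vec.replicate m 0) ∷ []

_+P_ : ∀ {m} → Poly m → Poly m → Poly m
p +P q = p ++ q

-P_ : ∀ {m} → Poly m → Poly m
-P p = map (map₁ -_) p

_-P_ : ∀ {m} → Poly m → Poly m → Poly m
p -P q = p +P (-P q)

_*P_ : ∀ {m} → Poly m → Poly m → Poly m
p *P q = concatMap (λ t → map (λ u → (proj₁ t ℤ.* proj₁ u , Vec.zipWith ℕ._+_ (proj₂ t) (proj₂ u))) q) p

var : ∀ {m} → Fin m → Poly m
var e = (+ 1 , Vec.tabulate (λ i → if ⌊ i Fin.≟ e ⌋ then 1 else 0)) ∷ []

sumP : ∀ {m} → List (Poly m) → Poly m
sumP = foldr _+P_ 0P

NonNegCoeffs : ∀ {m} → Poly m → Set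
NonNegCoeffs p = ∀ μ → + 0 ℤ.≤ coeff p μ

alt : ∀ {m} → ℕ → Poly m → Poly m
alt zero p = p
alt (suc i) p = -P (alt i p)

det : ∀ {m} k → (Fin k → Fin k → Poly m) → Poly m
det zero M = 1P
det (suc k) M =
  sumP (map (λ j → alt (toℕ j) (M zero j *P det k (λ r c → M (suc r) (punchIn j c))))
            (allFin (suc k)))

-- Networks: a finite directed multigraph with vertices Fin v, edges Fin m,
-- designated sources src i = s_{i+1} and sinks snk j = t_{j+1}.

record Network (n : ℕ) : Set where
  field
    v m  : ℕ
    tail head : Fin m → Fin v
    src snk   : Fin n → Fin v

IsPath : ∀ {v m} (tl hd : Fin m → Fin v) → Fin v → Fin v → List (Fin m) → Set
IsPath tl hd x y [] = x ≡ y
IsPath tl hd x y (e ∷ es) = tl e ≡ x × IsPath tl hd (hd e) y es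

module _ {n : ℕ} (Γ : Network n) where
  open Network Γ

  Acyclic : Set
  Acyclic = ∀ x es → IsPath tail head x x es → es ≡ []

  SourcesSinks : Set
  SourcesSinks =
      (∀ i i′ → src i ≡ src i′ → i ≡ i′)
    × (∀ j j′ → snk j ≡ snk j′ → j ≡ j′)
    × (∀ i j → src i ≢ snk j)
    × (∀ i e → head e ≢ src i)
    × (∀ j e → tail e ≢ snk j)
    × (∀ x → (∀ e → head e ≢ x) → ∃ λ i → src i ≡ x)
    × (∀ x → (∀ e → tail e ≢ x) → ∃ λ j → snk j ≡ x)

  -- Planarity with boundary, via combinatorial maps (rotation systems).
  -- Augment Γ by a new vertex ∞ (= zero; old vertex u is suc u) joined to
  -- the 2n boundary vertices b_0,…,b_{2n-1} = s_1,…,s_n,t_n,…,t_1.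
  -- Edges of the augmented graph: Fin M, M = m + (n + n).
  -- Darts: Fin (M + M); dart e ↑ˡ M is the first end of edge e, M ↑ʳ e the
  -- second end (for Γ-edges: tail / head; for apex edges: ∞ / b_r).

  M : ℕ
  M = m ℕ.+ (n ℕ.+ n)

  boundary : Fin (n ℕ.+ n) → Fin v
  boundary r = [ src , snk ∘ opposite ]′ (splitAt n r)

  end₁ end₂ : Fin M → Fin (suc v)
  end₁ e = [ (λ e′ → suc (tail e′)) , (λ _ → zero) ]′ (splitAt m e)
  end₂ e = [ (λ e′ → suc (head e′)) , (λ r → suc (boundary r)) ]′ (splitAt m e)

  Dart : Set
  Dart = Fin (M ℕ.+ M)

  dartVertex : Dart → Fin (suc v)
  dartVertex d = [ end₁ , end₂ ]′ (splitAt M d)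

  α : Dart → Dart
  α d = join M M (swap (splitAt M d))

  apexDart : Fin (n ℕ.+ n) → Dart
  apexDart r = (m ↑ʳ r) ↑ˡ M

cpred : ∀ {p} → Fin p → Fin p
cpred {suc p} zero = fromℕ p
cpred {suc p} (suc r) = inject₁ r

iter : ∀ {A : Set} → (A → A) → ℕ → A → A
iter f zero x = x
iter f (suc i) x = f (iter f i x)

-- number of orbits of the group generated by a list of permutations of Fin N
-- (forward closure; N rounds suffice), counted via orbit minima.
reachB : ∀ {N} → List (Fin N → Fin N) → ℕ → Fin N → Fin N → Bool
reachB gs zero x y = ⌊ x Fin.≟ y ⌋
reachB {N} gs (suc k) x y =
  reachB gs k x y ∨
  any (λ z → reachB gs k x z ∧ any (λ g → ⌊ g z Fin.≟ y ⌋) gs) (allFin N)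

countOrbits : ∀ {N} → List (Fin N → Fin N) → ℕ
countOrbits {N} gs =
  length (filterᵇ (λ x → all (λ y → not (reachB gs N x y) ∨ ⌊ x Fin.≤? y ⌋) (allFin N))
                  (allFin N))

module _ {n : ℕ} (Γ : Network n) where
  open Network Γ

  -- σ is a rotation system of the augmented graph (σ⁻¹ its inverse), with the
  -- counterclockwise rotation at ∞ being b_r ↦ b_{r-1}: this says that
  -- s_1,…,s_n,t_n,…,t_1 appear counterclockwise on the outer boundary.
  -- Genus zero: V − E + F = 2·(number of connected components).
  PlanarRotation : (Dart Γ → Dart Γ) → (Dart Γ → Dart Γ) → Set
  PlanarRotation σ σ⁻¹ =
      (∀ d → σ (σ⁻¹ d) ≡ d)
    × (∀ d → σ⁻¹ (σ d) ≡ d)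
    × (∀ d → dartVertex Γ (σ d) ≡ dartVertex Γ d)
    × (∀ d d′ → dartVertex Γ d ≡ dartVertex Γ d′ → ∃ λ i → iter σ i d ≡ d′)
    × (∀ r → σ (apexDart Γ r) ≡ apexDart Γ (cpred r))
    × (countOrbits (σ ∷ []) ℕ.+ countOrbits ((σ ∘ α Γ) ∷ [])
         ≡ M Γ ℕ.+ 2 ℕ.* countOrbits (σ ∷ α Γ ∷ []))

  IsPlanarNetwork : Set
  IsPlanarNetwork =
    Acyclic Γ × SourcesSinks Γ × ∃ λ σ → ∃ λ σ⁻¹ → PlanarRotation σ σ⁻¹

  IsPathEnumeration : (Fin n → Fin n → List (List (Fin m))) → Set
  IsPathEnumeration enum = ∀ i j →
      Unique (enum i j)
    × (∀ es → (es ∈ enum i j → IsPath tail head (src i) (snk j) es)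
            × (IsPath tail head (src i) (snk j) es → es ∈ enum i j))

  pathWeight : List (Fin m) → Poly m
  pathWeight es = foldr (λ e p → var e *P p) 1P es

  weightMatrix : (Fin n → Fin n → List (List (Fin m))) → Fin n → Fin n → Poly m
  weightMatrix enum i j = sumP (map pathWeight (enum i j))

  -- W with indices in ℕ (zero polynomial outside 0..n-1; never used out of range)
  Wℕ : (Fin n → Fin n → List (List (Fin m))) → ℕ → ℕ → Poly m
  Wℕ enum i j with i <? n | j <? n
  ... | yes p | yes q = weightMatrix enum (fromℕ< p) (fromℕ< q)
  ... | _     | _     = 0P

  minorMatrix : (Fin n → Fin n → List (List (Fin m))) → (k : ℕ) →
                (A B : Fin k → Fin n) → ℕ → ℕ → Poly m
  minorMatrix enum k A B i j = det k (λ r c → Wℕ enum (i ℕ.+ toℕ (A r)) (j ℕ.+ toℕ (B c)))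

StrictlyIncreasing : ∀ {k n} → (Fin k → Fin n) → Set
StrictlyIncreasing A = ∀ r s → r Fin.< s → A r Fin.< A s

minor2 : ∀ {m} → (ℕ → ℕ → Poly m) → ℕ → ℕ → ℕ → ℕ → Poly m
minor2 T i₁ i₂ j₁ j₂ = (T i₁ j₁ *P T i₂ j₂) -P (T i₁ j₂ *P T i₂ j₁)

{-# OPTIONS --safe #-}

-- Join all sources and sinks to a point at infinity. Euler's formula makes every circulation on the
-- resulting planar map the coboundary of an integer height function on the faces: adding the edges
-- one at a time, each of them is either a bridge or cuts a face in two. Heights replace all uses of
-- the Jordan curve theorem. They show that incoming and outgoing edges do not alternate around a
-- vertex, and that disjoint paths connect sources and sinks in order. By the latter and the
-- Lindström–Gessel–Viennot expansion, the coefficient of x^μ in det W[I,J] is 1 if μ is the edge set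
-- of a family of vertex-disjoint paths from I to J, and 0 otherwise.
--
-- Let (P , Q) be a pair of such families from i₁+A to j₂+B and from i₂+A to j₁+B with P + Q = μ, and let
-- h be the height function of the flow P − Q. Edges of exactly one of P and Q form curves along each
-- of which the two adjacent heights stay the same, and exchanging P and Q on any set of these curves
-- again gives two families of disjoint paths. Along the boundary h is at most its value X₀ between
-- the first source and the first sink on the source side, because i₁+A lies before i₂+A, and at least
-- X₀ on the sink side. Hence the curves with heights at least X₀ contain all those that end in a sink
-- and none that ends in a source; exchanging on them yields families from i₁+A to j₁+B and from i₂+A
-- to j₂+B. The curves depend only on μ, so one such choice, made for a single pair, serves for all pairs
-- with P + Q = μ and gives an injection.
module Submission where

open import Defs
open import Algebra.Bundles using (CommutativeMonoid; CommutativeRing)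
import Algebra.Properties.CommutativeMonoid.Sum as CMSum
import Algebra.Properties.Ring as RingP
import Algebra.Properties.Semiring.Sum as SRSum
open import Data.Bool using (Bool; true; false; if_then_else_; T; _∨_; not)
import Data.Bool.Properties as BoolP
open import Data.Bool.ListAction using (all)
open import Data.Empty using (⊥; ⊥-elim)
open import Data.Fin as Fin using (Fin; zero; suc; toℕ; fromℕ; fromℕ<; inject₁; punchIn; splitAt; join; _↑ˡ_; _↑ʳ_; opposite)
open import Data.Fin.Permutation using (permutation)
import Data.Fin.Properties as FinP
open import Data.Integer as ℤ using (ℤ; +_; -_; 0ℤ; 1ℤ)
import Data.Integer.Properties as ℤP
open import Data.Integer.Tactic.RingSolver using (solve-∀)
open import Data.List using (List; []; _∷_; _++_; length; map; concat; filterᵇ; tabulate; allFin)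
open import Data.List.Membership.Propositional using (_∈_; find; lose)
import Data.List.Membership.Propositional.Properties as MemP
open import Data.List.Membership.Propositional.Properties.WithK using (unique∧set⇒bag)
import Data.List.Properties as ListP
open import Data.List.Relation.Binary.BagAndSetEquality using (∼bag⇒↭)
import Data.List.Relation.Binary.Permutation.Propositional as Perm
open import Data.List.Relation.Unary.All as All using (All; []; _∷_)
import Data.List.Relation.Unary.All.Properties as AllP
open import Data.List.Relation.Unary.AllPairs using ([]; _∷_)
import Data.List.Relation.Unary.AllPairs.Properties as AllPairsP
open import Data.List.Relation.Unary.Any using (here)
import Data.List.Relation.Unary.Any.Properties as AnyP
open import Data.List.Relation.Unary.Unique.Propositional using (Unique)
import Data.List.Relation.Unary.Unique.Propositional.Properties as UniqueP
open import Data.Nat as ℕ using (ℕ; zero; suc; _+_; _*_; _∸_; _≤_; _<_; z≤n; s≤s; _≤?_; _<?_)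
import Data.Nat.Properties as ℕP
open import Data.Product using (Σ; ∃; _×_; _,_; proj₁; proj₂)
open import Data.Sum using (_⊎_; inj₁; inj₂; [_,_]′)
open import Data.Unit using (tt)
open import Data.Vec as Vec using ([]; _∷_)
import Data.Vec.Properties as VecP
open import Function using (_∘_; Equivalence; mk⇔)
open import Level using (0ℓ)
open import Relation.Binary using (tri<; tri≈; tri>)
open import Relation.Binary.PropositionalEquality using (_≡_; _≢_; refl; sym; trans; cong; cong₂; subst; subst₂)
open import Relation.Nullary using (¬_; Dec; yes; no; does)
open import Relation.Nullary.Decidable using (map′; _→-dec_; _⊎-dec_; _×-dec_; ¬?; toWitness; fromWitness; ⌊_⌋)
open import Algebra.Properties.Semiring.Sum ℕP.+-*-semiring using () renaming (sum to sumℕ; sum-cong-≗ to sumℕ-cong; ∑-distrib-+ to sumℕ-+; ∑-comm to sumℕ-comm; *-distribˡ-sum to *-sumℕ; sum-permute to sumℕ-permute)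
open import Algebra.Properties.Semiring.Sum ℤP.+-*-semiring using () renaming (sum to sumℤ; sum-cong-≗ to sumℤ-cong; ∑-distrib-+ to sumℤ-+; ∑-comm to sumℤ-comm; *-distribˡ-sum to *-sumℤ; sum-permute to sumℤ-permute)

-- Indicators and finite sums

-- Injectivity of the exchange costs nothing: exchanging P and Q on a fixed edge set S is the
-- reflection x ↦ μ_e - x of the coordinates in S, an involution of the box of all ν ≤ μ. The work
-- is to show that an S made from one pair serves all of them. Only edges with P + Q = 1 matter. At
-- a vertex the exchange must treat alike two such edges that both enter or both leave; where only
-- one family passes, it must treat the entering and the leaving edge alike. These rules see only P
-- + Q. Joining entering edges to entering ones, instead of following the flow, is why
-- non-alternation is needed: in the cyclic order in, out, in, out the two entering edges could lie
-- at different heights. The determinants are expanded without a sign-reversing involution on path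
-- families. Each row collects the paths from one vertex; in topological order it is expanded over
-- the first edge, and when two paths stand at one vertex the determinant has two equal rows.

ind : ∀ {a} {A : Set a} → Dec A → ℕ
ind d = if does d then 1 else 0

module _ {a} {A : Set a} where

  ind-yes : (d : Dec A) → A → ind d ≡ 1
  ind-yes (yes _) _ = refl
  ind-yes (no ¬a) a = ⊥-elim (¬a a)

  ind-no : (d : Dec A) → ¬ A → ind d ≡ 0
  ind-no (yes a) ¬a = ⊥-elim (¬a a)
  ind-no (no _)  _  = refl

  ind-≤1 : (d : Dec A) → ind d ≤ 1
  ind-≤1 (yes _) = s≤s z≤n
  ind-≤1 (no _)  = z≤n

  ind-pos : (d : Dec A) → 1 ≤ ind d → A
  ind-pos (yes a) _ = a
  ind-pos (no _)  ()

ind-⇔ : ∀ {a b} {A : Set a} {B : Set b} (d : Dec A) (d′ : Dec B) → (A → B) → (B → A) → ind d ≡ ind d′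
ind-⇔ (yes a) d′ f g = sym (ind-yes d′ (f a))
ind-⇔ (no ¬a) d′ f g = sym (ind-no d′ (λ b → ¬a (g b)))

module FinSum {c ℓ} (CM : CommutativeMonoid c ℓ) where
  open CommutativeMonoid CM using (Carrier; _≈_; _∙_; ε; ∙-congˡ; ∙-congʳ; identityˡ; identityʳ; assoc; comm) renaming (refl to ≈-refl; sym to ≈-sym; trans to ≈-trans)
  open CMSum CM using (sum; sum-cong-≋; sum-replicate-zero)

  sum-zero : ∀ {n} {f : Fin n → Carrier} → (∀ i → f i ≈ ε) → sum f ≈ ε
  sum-zero {n} eq = ≈-trans (sum-cong-≋ eq) (sum-replicate-zero n)

  sum-single : ∀ {n} {f : Fin n → Carrier} j → (∀ i → i ≢ j → f i ≈ ε) → sum f ≈ f j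
  sum-single zero eq = ≈-trans (∙-congˡ (sum-zero (λ i → eq (suc i) (λ ())))) (identityʳ _)
  sum-single (suc j) eq =
    ≈-trans (∙-congʳ (eq zero (λ ())))
      (≈-trans (identityˡ _) (sum-single j (λ i i≢j → eq (suc i) (i≢j ∘ FinP.suc-injective))))

  sum-double : ∀ {n} {f : Fin n → Carrier} j k → j ≢ k → (∀ i → i ≢ j → i ≢ k → f i ≈ ε) → sum f ≈ f j ∙ f k
  sum-double zero zero j≢k eq = ⊥-elim (j≢k refl)
  sum-double zero (suc k) j≢k eq = ∙-congˡ (sum-single k (λ i i≢k → eq (suc i) (λ ()) (i≢k ∘ FinP.suc-injective)))
  sum-double (suc j) zero j≢k eq = ≈-trans (∙-congˡ (sum-single j (λ i i≢j → eq (suc i) (i≢j ∘ FinP.suc-injective) (λ ())))) (comm _ _)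
  sum-double (suc j) (suc k) j≢k eq =
    ≈-trans (∙-congʳ (eq zero (λ ()) (λ ()))) (≈-trans (identityˡ _)
      (sum-double j k (j≢k ∘ cong suc) (λ i i≢j i≢k → eq (suc i) (i≢j ∘ FinP.suc-injective) (i≢k ∘ FinP.suc-injective))))

  sum-↑ : ∀ m {n} (f : Fin (m + n) → Carrier) → sum f ≈ sum (λ i → f (i ↑ˡ n)) ∙ sum (λ j → f (m ↑ʳ j))
  sum-↑ zero f = ≈-sym (identityˡ _)
  sum-↑ (suc m) f = ≈-trans (∙-congˡ (sum-↑ m (f ∘ suc))) (≈-sym (assoc _ _ _))

open FinSum ℕP.+-0-commutativeMonoid using () renaming (sum-zero to sumℕ-zero; sum-single to sumℕ-single; sum-↑ to sumℕ-↑)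
open FinSum ℤP.+-0-commutativeMonoid using () renaming (sum-zero to sumℤ-zero; sum-single to sumℤ-single; sum-double to sumℤ-double; sum-↑ to sumℤ-↑)

sumℕ-mono : ∀ {n} {f g : Fin n → ℕ} → (∀ i → f i ≤ g i) → sumℕ f ≤ sumℕ g
sumℕ-mono {zero}  le = z≤n
sumℕ-mono {suc n} le = ℕP.+-mono-≤ (le zero) (sumℕ-mono (le ∘ suc))

term≤sumℕ : ∀ {n} (f : Fin n → ℕ) i → f i ≤ sumℕ f
term≤sumℕ f zero    = ℕP.m≤m+n _ _
term≤sumℕ f (suc i) = ℕP.≤-trans (term≤sumℕ (f ∘ suc) i) (ℕP.m≤n+m _ _)

two-terms≤sumℕ : ∀ {n} (f : Fin n → ℕ) {i j} → i ≢ j → f i + f j ≤ sumℕ f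
two-terms≤sumℕ f {zero}  {zero}  i≢j = ⊥-elim (i≢j refl)
two-terms≤sumℕ f {zero}  {suc j} i≢j = ℕP.+-monoʳ-≤ (f zero) (term≤sumℕ (f ∘ suc) j)
two-terms≤sumℕ f {suc i} {zero}  i≢j rewrite ℕP.+-comm (f (suc i)) (f zero) = ℕP.+-monoʳ-≤ (f zero) (term≤sumℕ (f ∘ suc) i)
two-terms≤sumℕ f {suc i} {suc j} i≢j = ℕP.≤-trans (two-terms≤sumℕ (f ∘ suc) (i≢j ∘ cong suc)) (ℕP.m≤n+m _ _)

sumℕ-pos : ∀ {n} (f : Fin n → ℕ) → 1 ≤ sumℕ f → ∃ λ i → 1 ≤ f i
sumℕ-pos {suc n} f p with f zero in eq
... | suc x = zero , subst (1 ≤_) (sym eq) (s≤s z≤n)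
... | zero  = let i , q = sumℕ-pos (f ∘ suc) p in suc i , q

pos-sum : ∀ {n} (f : Fin n → ℕ) → + sumℕ f ≡ sumℤ (λ i → + f i)
pos-sum {zero}  f = refl
pos-sum {suc n} f = trans (ℤP.pos-+ (f zero) _) (cong (ℤ._+_ (+ f zero)) (pos-sum (f ∘ suc)))

-- Sign arguments end in x = - x, and the integers have no 2-torsion. Used for antisymmetric sums
-- and for determinants with two equal rows.
self-negative : ∀ x → x ≡ - x → x ≡ 0ℤ
self-negative (+ zero) _ = refl
self-negative (+ suc n) ()
self-negative ℤ.-[1+ n ] ()

+-2*-suc : ∀ l c → l + 2 * suc c ≡ suc (suc l + 2 * c)
+-2*-suc l c rewrite ℕP.+-suc c (c + 0) | ℕP.+-suc l (suc (c + (c + 0))) | ℕP.+-suc l (c + (c + 0)) = refl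

-- Polynomials as functionals on functions of the exponent

_⊕_ : ∀ {m} → Monomial m → Monomial m → Monomial m
_⊕_ = Vec.zipWith ℕ._+_

_⊖_ : ∀ {m} → Monomial m → Monomial m → Monomial m
_⊖_ = Vec.zipWith _∸_

_≟ᵐ_ : ∀ {m} (ν μ : Monomial m) → Dec (ν ≡ μ)
_≟ᵐ_ = VecP.≡-dec ℕ._≟_

module _ {m : ℕ} where

  -- The linear extension of `F` to formal sums. Coefficients are its values at indicators of
  -- monomials; testing equality against every `F` turns a product into a nested `ev`, so the ring
  -- laws follow from exchanging sums, without normal forms.
  ev : Poly m → (Monomial m → ℤ) → ℤ
  ev [] F = 0ℤ
  ev ((c , ν) ∷ p) F = c ℤ.* F ν ℤ.+ ev p F

  infix 4 _≋_
  record _≋_ (p q : Poly m) : Set where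
    constructor mk≋
    field ev≡ : ∀ F → ev p F ≡ ev q F
  open _≋_ public

  coeff-ev : ∀ p μ → coeff p μ ≡ ev p (λ ν → + ind (ν ≟ᵐ μ))
  coeff-ev [] μ = refl
  coeff-ev ((c , ν) ∷ p) μ with VecP.≡-dec ℕ._≟_ ν μ
  ... | yes _ = cong₂ ℤ._+_ (sym (ℤP.*-identityʳ c)) (coeff-ev p μ)
  ... | no _  = trans (coeff-ev p μ) (sym (trans (cong (ℤ._+ ev p _) (ℤP.*-zeroʳ c)) (ℤP.+-identityˡ _)))

  coeff-cong : ∀ {p q} → p ≋ q → ∀ μ → coeff p μ ≡ coeff q μ
  coeff-cong {p} {q} eq μ = trans (coeff-ev p μ) (trans (ev≡ eq _) (sym (coeff-ev q μ)))

  ev-cong : ∀ p {F G : Monomial m → ℤ} → (∀ ν → F ν ≡ G ν) → ev p F ≡ ev p G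
  ev-cong [] eq = refl
  ev-cong ((c , ν) ∷ p) eq = cong₂ (λ s t → c ℤ.* s ℤ.+ t) (eq ν) (ev-cong p eq)

  ev-++ : ∀ p q F → ev (p ++ q) F ≡ ev p F ℤ.+ ev q F
  ev-++ [] q F = sym (ℤP.+-identityˡ _)
  ev-++ ((c , ν) ∷ p) q F = trans (cong (ℤ._+_ (c ℤ.* F ν)) (ev-++ p q F)) (sym (ℤP.+-assoc (c ℤ.* F ν) (ev p F) (ev q F)))

  ev-neg : ∀ p F → ev (-P p) F ≡ - ev p F
  ev-neg [] F = refl
  ev-neg ((c , ν) ∷ p) F = trans (cong (ℤ._+_ (- c ℤ.* F ν)) (ev-neg p F)) (distrib c (F ν) (ev p F))
    where
    distrib : ∀ a b c → - a ℤ.* b ℤ.+ - c ≡ - (a ℤ.* b ℤ.+ c)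
    distrib = solve-∀

  ev-+ : ∀ p F G → ev p (λ ν → F ν ℤ.+ G ν) ≡ ev p F ℤ.+ ev p G
  ev-+ [] F G = refl
  ev-+ ((c , ν) ∷ p) F G = trans (cong (ℤ._+_ (c ℤ.* (F ν ℤ.+ G ν))) (ev-+ p F G)) (distrib c (F ν) (G ν) (ev p F) (ev p G))
    where
    distrib : ∀ c a b s t → c ℤ.* (a ℤ.+ b) ℤ.+ (s ℤ.+ t) ≡ c ℤ.* a ℤ.+ s ℤ.+ (c ℤ.* b ℤ.+ t)
    distrib = solve-∀

  ev-* : ∀ p (k : ℤ) F → ev p (λ ν → k ℤ.* F ν) ≡ k ℤ.* ev p F
  ev-* [] k F = sym (ℤP.*-zeroʳ k)
  ev-* ((c , ν) ∷ p) k F = trans (cong (ℤ._+_ (c ℤ.* (k ℤ.* F ν))) (ev-* p k F)) (distrib c k (F ν) (ev p F))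
    where
    distrib : ∀ c k a s → c ℤ.* (k ℤ.* a) ℤ.+ k ℤ.* s ≡ k ℤ.* (c ℤ.* a ℤ.+ s)
    distrib = solve-∀

  ev-zero : ∀ p → ev p (λ _ → 0ℤ) ≡ 0ℤ
  ev-zero [] = refl
  ev-zero ((c , _) ∷ p) = cong₂ ℤ._+_ (ℤP.*-zeroʳ c) (ev-zero p)

  ev-swap : ∀ p q (G : Monomial m → Monomial m → ℤ) → ev p (λ ν → ev q (G ν)) ≡ ev q (λ ν′ → ev p (λ ν → G ν ν′))
  ev-swap [] q G = sym (ev-zero q)
  ev-swap ((c , ν) ∷ p) q G = trans (cong₂ ℤ._+_ (sym (ev-* q c (G ν))) (ev-swap p q G))
    (sym (ev-+ q (λ ν′ → c ℤ.* G ν ν′) (λ ν′ → ev p (λ ν → G ν ν′))))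

  ev-product : ∀ p q F → ev (p *P q) F ≡ ev p (λ ν → ev q (λ ν′ → F (ν ⊕ ν′)))
  ev-product [] q F = refl
  ev-product ((c , ν) ∷ p) q F = trans (ev-++ (map _ q) (p *P q) F) (cong₂ ℤ._+_ (row q) (ev-product p q F))
    where
    assoc-distrib : ∀ c d a s → c ℤ.* d ℤ.* a ℤ.+ c ℤ.* s ≡ c ℤ.* (d ℤ.* a ℤ.+ s)
    assoc-distrib = solve-∀
    row : ∀ q → ev (map (λ u → (c ℤ.* proj₁ u , ν ⊕ proj₂ u)) q) F ≡ c ℤ.* ev q (λ ν′ → F (ν ⊕ ν′))
    row [] = sym (ℤP.*-zeroʳ c)
    row ((d , ν′) ∷ q) = trans (cong (ℤ._+_ (c ℤ.* d ℤ.* F (ν ⊕ ν′))) (row q)) (assoc-distrib c d (F (ν ⊕ ν′)) (ev q (λ ν′ → F (ν ⊕ ν′))))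

  private
    one-term : ∀ a → 1ℤ ℤ.* a ℤ.+ 0ℤ ≡ a
    one-term = solve-∀

  ev-one : ∀ F → ev (1P {m}) F ≡ F (Vec.replicate m 0)
  ev-one F = one-term (F (Vec.replicate m 0))

  ⊕-identityˡ : ∀ (ν : Monomial m) → Vec.replicate m 0 ⊕ ν ≡ ν
  ⊕-identityˡ = VecP.zipWith-identityˡ ℕP.+-identityˡ

  *P-comm : ∀ p q → p *P q ≋ q *P p
  *P-comm p q = mk≋ λ F → trans (ev-product p q F) (trans (ev-swap p q (λ ν ν′ → F (ν ⊕ ν′)))
    (trans (ev-cong q (λ ν′ → ev-cong p (λ ν → cong F (VecP.zipWith-comm ℕP.+-comm ν ν′)))) (sym (ev-product q p F))))

  *P-cong : ∀ {p p′ q q′} → p ≋ p′ → q ≋ q′ → p *P q ≋ p′ *P q′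
  *P-cong {p} {p′} {q} {q′} pp qq = mk≋ λ F → trans (ev-product p q F) (trans (ev≡ pp _)
    (trans (ev-cong p′ (λ ν → ev≡ qq _)) (sym (ev-product p′ q′ F))))

  *P-assoc : ∀ p q r → (p *P q) *P r ≋ p *P (q *P r)
  *P-assoc p q r = mk≋ λ F → trans (ev-product (p *P q) r F) (trans (ev-product p q _)
    (sym (trans (ev-product p (q *P r) F) (ev-cong p (λ ν → trans (ev-product q r _)
      (ev-cong q (λ ν′ → ev-cong r (λ ν″ → cong F (sym (VecP.zipWith-assoc ℕP.+-assoc ν ν′ ν″))))))))))

  *P-identityˡ : ∀ p → 1P *P p ≋ p
  *P-identityˡ p = mk≋ λ F → trans (ev-product 1P p F) (trans (ev-one (λ ν → ev p (λ ν′ → F (ν ⊕ ν′)))) (ev-cong p (λ ν → cong F (⊕-identityˡ ν))))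

  *P-distribˡ : ∀ p q r → p *P (q +P r) ≋ (p *P q) +P (p *P r)
  *P-distribˡ p q r = mk≋ λ F → trans (ev-product p (q +P r) F) (trans (ev-cong p (λ ν → ev-++ q r _)) (trans (ev-+ p _ _)
    (sym (trans (ev-++ (p *P q) (p *P r) F) (cong₂ ℤ._+_ (ev-product p q F) (ev-product p r F))))))

  polyRing : CommutativeRing 0ℓ 0ℓ
  polyRing = record
    { Carrier = Poly m ; _≈_ = _≋_ ; _+_ = _+P_ ; _*_ = _*P_ ; -_ = -P_ ; 0# = 0P ; 1# = 1P
    ; isCommutativeRing = record
      { isRing = record
        { +-isAbelianGroup = record
          { isGroup = record
            { isMonoid = record
              { isSemigroup = record
                { isMagma = record
                  { isEquivalence = record
                    { refl = mk≋ λ _ → refl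
                    ; sym = λ eq → mk≋ λ F → sym (ev≡ eq F)
                    ; trans = λ eq eq′ → mk≋ λ F → trans (ev≡ eq F) (ev≡ eq′ F) }
                  ; ∙-cong = λ {p} {p′} {q} {q′} pp qq → mk≋ λ F → trans (ev-++ p q F) (trans (cong₂ ℤ._+_ (ev≡ pp F) (ev≡ qq F)) (sym (ev-++ p′ q′ F))) }
                ; assoc = λ p q r → mk≋ λ F → cong (λ t → ev t F) (ListP.++-assoc p q r) }
              ; identity = (λ p → mk≋ λ _ → refl) , λ p → mk≋ λ F → cong (λ t → ev t F) (ListP.++-identityʳ p) }
            ; inverse = (λ p → mk≋ λ F → trans (ev-++ (-P p) p F) (trans (cong (ℤ._+ ev p F) (ev-neg p F)) (ℤP.+-inverseˡ (ev p F))))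
                      , (λ p → mk≋ λ F → trans (ev-++ p (-P p) F) (trans (cong (ℤ._+_ (ev p F)) (ev-neg p F)) (ℤP.+-inverseʳ (ev p F))))
            ; ⁻¹-cong = λ {p} {q} eq → mk≋ λ F → trans (ev-neg p F) (trans (cong -_ (ev≡ eq F)) (sym (ev-neg q F))) }
          ; comm = λ p q → mk≋ λ F → trans (ev-++ p q F) (trans (ℤP.+-comm (ev p F) (ev q F)) (sym (ev-++ q p F))) }
        ; *-cong = *P-cong
        ; *-assoc = *P-assoc
        ; *-identity = *P-identityˡ , λ p → mk≋ λ F → trans (ev≡ (*P-comm p 1P) F) (ev≡ (*P-identityˡ p) F)
        ; distrib = *P-distribˡ , λ p q r → mk≋ λ F → trans (ev≡ (*P-comm (q +P r) p) F) (trans (ev≡ (*P-distribˡ p q r) F)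
                      (trans (ev-++ (p *P q) (p *P r) F) (trans (cong₂ ℤ._+_ (ev≡ (*P-comm p q) F) (ev≡ (*P-comm p r) F)) (sym (ev-++ (q *P p) (r *P p) F))))) }
      ; *-comm = *P-comm } }

  coeff-+ : ∀ p q μ → coeff (p +P q) μ ≡ coeff p μ ℤ.+ coeff q μ
  coeff-+ p q μ = trans (coeff-ev (p +P q) μ) (trans (ev-++ p q _) (sym (cong₂ ℤ._+_ (coeff-ev p μ) (coeff-ev q μ))))

  coeff-neg : ∀ p μ → coeff (-P p) μ ≡ - coeff p μ
  coeff-neg p μ = trans (coeff-ev (-P p) μ) (trans (ev-neg p _) (cong -_ (sym (coeff-ev p μ))))

  coeff-one : ∀ μ → coeff (1P {m}) μ ≡ + ind (Vec.replicate m 0 ≟ᵐ μ)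
  coeff-one μ = trans (coeff-ev 1P μ) (ev-one (λ ν → + ind (ν ≟ᵐ μ)))

  lookup-ext : ∀ {ν μ : Monomial m} → (∀ e → Vec.lookup ν e ≡ Vec.lookup μ e) → ν ≡ μ
  lookup-ext {ν} {μ} eq = trans (sym (VecP.tabulate∘lookup ν)) (trans (VecP.tabulate-cong eq) (VecP.tabulate∘lookup μ))

  lookup-⊕ : ∀ (ν μ : Monomial m) e → Vec.lookup (ν ⊕ μ) e ≡ Vec.lookup ν e + Vec.lookup μ e
  lookup-⊕ ν μ e = VecP.lookup-zipWith _+_ e ν μ

  lookup-⊖ : ∀ (ν μ : Monomial m) e → Vec.lookup (ν ⊖ μ) e ≡ Vec.lookup ν e ∸ Vec.lookup μ e
  lookup-⊖ ν μ e = VecP.lookup-zipWith _∸_ e ν μ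

  monomial : Fin m → Monomial m
  monomial e = Vec.tabulate (λ i → if ⌊ i Fin.≟ e ⌋ then 1 else 0)

  lookup-monomial : ∀ e i → Vec.lookup (monomial e) i ≡ ind (i Fin.≟ e)
  lookup-monomial e i = trans (VecP.lookup∘tabulate (λ i → if ⌊ i Fin.≟ e ⌋ then 1 else 0) i) (same (i Fin.≟ e))
    where
    same : ∀ {A : Set} (d : Dec A) → (if ⌊ d ⌋ then 1 else 0) ≡ ind d
    same (yes _) = refl
    same (no _)  = refl

  private
    ev-var : ∀ e p F → ev (var e *P p) F ≡ ev p (λ ν → F (monomial e ⊕ ν))
    ev-var e p F = trans (ev-product (var e) p F) (one-term (ev p (λ ν → F (monomial e ⊕ ν))))

  coeff-var-pos : ∀ e p μ → 1 ≤ Vec.lookup μ e → coeff (var e *P p) μ ≡ coeff p (μ ⊖ monomial e)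
  coeff-var-pos e p μ pos = trans (coeff-ev (var e *P p) μ) (trans (ev-var e p _)
    (trans (ev-cong p (λ ν → cong +_ (ind-⇔ ((monomial e ⊕ ν) ≟ᵐ μ) (ν ≟ᵐ (μ ⊖ monomial e)) (to ν) (from ν)))) (sym (coeff-ev p _))))
    where
    to : ∀ ν → monomial e ⊕ ν ≡ μ → ν ≡ μ ⊖ monomial e
    to ν refl = lookup-ext (λ i → sym (trans (lookup-⊖ (monomial e ⊕ ν) (monomial e) i)
      (trans (cong (_∸ Vec.lookup (monomial e) i) (lookup-⊕ (monomial e) ν i)) (ℕP.m+n∸m≡n (Vec.lookup (monomial e) i) _))))
    below : ∀ i → Vec.lookup (monomial e) i ≤ Vec.lookup μ i
    below i = subst (_≤ Vec.lookup μ i) (sym (lookup-monomial e i)) (case i (i Fin.≟ e))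
      where
      case : ∀ i (d : Dec (i ≡ e)) → ind d ≤ Vec.lookup μ i
      case i (yes refl) = pos
      case i (no _)     = z≤n
    from : ∀ ν → ν ≡ μ ⊖ monomial e → monomial e ⊕ ν ≡ μ
    from ν refl = lookup-ext (λ i → trans (lookup-⊕ (monomial e) ν i)
      (trans (cong (_+_ (Vec.lookup (monomial e) i)) (lookup-⊖ μ (monomial e) i)) (ℕP.m+[n∸m]≡n (below i))))

  coeff-var-zero : ∀ e p μ → Vec.lookup μ e ≡ 0 → coeff (var e *P p) μ ≡ 0ℤ
  coeff-var-zero e p μ zero≡ = trans (coeff-ev (var e *P p) μ) (trans (ev-var e p _)
    (trans (ev-cong p (λ ν → cong +_ (ind-no ((monomial e ⊕ ν) ≟ᵐ μ) (absurd ν)))) (ev-zero p)))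
    where
    absurd : ∀ ν → monomial e ⊕ ν ≢ μ
    absurd ν refl = ℕP.1+n≢0 (trans (cong (_+ Vec.lookup ν e) (sym (trans (lookup-monomial e e) (ind-yes (e Fin.≟ e) refl))))
      (trans (sym (lookup-⊕ (monomial e) ν e)) zero≡))

-- Sums over the divisors of a monomial

sumBox : ∀ {m} → Monomial m → (Monomial m → ℤ) → ℤ
sumBox [] F = F []
sumBox (k ∷ μ) F = sumℤ {suc k} (λ i → sumBox μ (λ ν → F (toℕ i ∷ ν)))

sumBox-cong : ∀ {m} (μ : Monomial m) {F G : Monomial m → ℤ} → (∀ ν → F ν ≡ G ν) → sumBox μ F ≡ sumBox μ G
sumBox-cong [] eq = eq []
sumBox-cong (k ∷ μ) eq = sumℤ-cong {suc k} (λ i → sumBox-cong μ (λ ν → eq (toℕ i ∷ ν)))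

sumBox-+ : ∀ {m} (μ : Monomial m) F G → sumBox μ (λ ν → F ν ℤ.+ G ν) ≡ sumBox μ F ℤ.+ sumBox μ G
sumBox-+ [] F G = refl
sumBox-+ (k ∷ μ) F G = trans (sumℤ-cong {suc k} (λ i → sumBox-+ μ (λ ν → F (toℕ i ∷ ν)) (λ ν → G (toℕ i ∷ ν))))
  (sumℤ-+ {suc k} (λ i → sumBox μ (λ ν → F (toℕ i ∷ ν))) (λ i → sumBox μ (λ ν → G (toℕ i ∷ ν))))

sumBox-* : ∀ {m} (μ : Monomial m) c F → sumBox μ (λ ν → c ℤ.* F ν) ≡ c ℤ.* sumBox μ F
sumBox-* [] c F = refl
sumBox-* (k ∷ μ) c F = trans (sumℤ-cong {suc k} (λ i → sumBox-* μ c (λ ν → F (toℕ i ∷ ν)))) (sym (*-sumℤ {suc k} c (λ i → sumBox μ (λ ν → F (toℕ i ∷ ν)))))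

sumBox-zero : ∀ {m} (μ : Monomial m) → sumBox μ (λ _ → 0ℤ) ≡ 0ℤ
sumBox-zero [] = refl
sumBox-zero (k ∷ μ) = sumℤ-zero {suc k} (λ i → sumBox-zero μ)

sumBox-ev : ∀ {m} (μ : Monomial m) (p : Poly m) (G : Monomial m → Monomial m → ℤ) →
            sumBox μ (λ ν → ev p (G ν)) ≡ ev p (λ ρ → sumBox μ (λ ν → G ν ρ))
sumBox-ev μ [] G = sumBox-zero μ
sumBox-ev μ ((c , ρ) ∷ p) G = trans (sumBox-+ μ (λ ν → c ℤ.* G ν ρ) (λ ν → ev p (G ν))) (cong₂ ℤ._+_ (sumBox-* μ c (λ ν → G ν ρ)) (sumBox-ev μ p G))

sum-antidiagonal : ∀ k r r′ → sumℤ {suc k} (λ i → + ind (r ℕ.≟ toℕ i) ℤ.* + ind (r′ ℕ.≟ k ∸ toℕ i)) ≡ + ind (r + r′ ℕ.≟ k)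
sum-antidiagonal k r r′ with r ≤? k
... | no r≰k = trans (sumℤ-zero {suc k} (λ i → cong (ℤ._* (+ ind (r′ ℕ.≟ k ∸ toℕ i))) (cong +_ (ind-no (r ℕ.≟ toℕ i) (λ { refl → r≰k (ℕP.≤-pred (FinP.toℕ<n i)) })))))
                 (cong +_ (sym (ind-no (r + r′ ℕ.≟ k) (λ { refl → r≰k (ℕP.m≤m+n r r′) }))))
... | yes r≤k = trans (sumℤ-single i₀ (λ i i≢ → cong (ℤ._* (+ ind (r′ ℕ.≟ k ∸ toℕ i))) (cong +_ (ind-no (r ℕ.≟ toℕ i) (λ eq → i≢ (FinP.toℕ-injective (trans (sym eq) (sym toi))))))))
                  (trans (cong₂ (λ s t → + s ℤ.* + t) (ind-yes (r ℕ.≟ toℕ i₀) (sym toi)) (ind-⇔ (r′ ℕ.≟ k ∸ toℕ i₀) (r + r′ ℕ.≟ k) there-to there-from)) (ℤP.*-identityˡ _))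
  where
  i₀ : Fin (suc k)
  i₀ = fromℕ< (s≤s r≤k)
  toi : toℕ i₀ ≡ r
  toi = FinP.toℕ-fromℕ< (s≤s r≤k)
  there-to : r′ ≡ k ∸ toℕ i₀ → r + r′ ≡ k
  there-to eq = trans (cong (_+_ r) (trans eq (cong (k ∸_) toi))) (ℕP.m+[n∸m]≡n r≤k)
  there-from : r + r′ ≡ k → r′ ≡ k ∸ toℕ i₀
  there-from refl = sym (trans (cong ((r + r′) ∸_) toi) (ℕP.m+n∸m≡n r r′))

private
  ind-cons : ∀ {m} x y (ν μ : Monomial m) → + ind ((x ∷ ν) ≟ᵐ (y ∷ μ)) ≡ + ind (x ℕ.≟ y) ℤ.* + ind (ν ≟ᵐ μ)
  ind-cons x y ν μ = go (x ℕ.≟ y) (ν ≟ᵐ μ) ((x ∷ ν) ≟ᵐ (y ∷ μ))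
    where
    go : (d : Dec (x ≡ y)) (d′ : Dec (ν ≡ μ)) (d″ : Dec (x ∷ ν ≡ y ∷ μ)) → + ind d″ ≡ + ind d ℤ.* + ind d′
    go (yes refl) (yes refl) d″ = cong +_ (ind-yes d″ refl)
    go (yes _)    (no ne)    d″ = cong +_ (ind-no d″ (ne ∘ VecP.∷-injectiveʳ))
    go (no ne)    d′         d″ = cong +_ (ind-no d″ (ne ∘ VecP.∷-injectiveˡ))

-- Both sides factor over the coordinates, where `sum-antidiagonal` picks the only splitting of `k`
-- whose first part is `r`.
sumBox-antidiagonal : ∀ {m} (μ ρ ρ′ : Monomial m) → sumBox μ (λ ν → + ind (ρ ≟ᵐ ν) ℤ.* + ind (ρ′ ≟ᵐ (μ ⊖ ν))) ≡ + ind ((ρ ⊕ ρ′) ≟ᵐ μ)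
sumBox-antidiagonal [] [] [] = refl
sumBox-antidiagonal (k ∷ μ) (r ∷ ρ) (r′ ∷ ρ′) =
  trans (sumℤ-cong {suc k} (λ i → trans (sumBox-cong μ (λ ν → trans (cong₂ ℤ._*_ (ind-cons r (toℕ i) ρ ν) (ind-cons r′ (k ∸ toℕ i) ρ′ (μ ⊖ ν)))
           (regroup (+ ind (r ℕ.≟ toℕ i)) (+ ind (ρ ≟ᵐ ν)) (+ ind (r′ ℕ.≟ k ∸ toℕ i)) (+ ind (ρ′ ≟ᵐ (μ ⊖ ν))))))
         (trans (sumBox-* μ (+ ind (r ℕ.≟ toℕ i) ℤ.* + ind (r′ ℕ.≟ k ∸ toℕ i)) (λ ν → + ind (ρ ≟ᵐ ν) ℤ.* + ind (ρ′ ≟ᵐ (μ ⊖ ν))))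
           (trans (cong (ℤ._*_ (+ ind (r ℕ.≟ toℕ i) ℤ.* + ind (r′ ℕ.≟ k ∸ toℕ i))) (sumBox-antidiagonal μ ρ ρ′))
             (ℤP.*-comm (+ ind (r ℕ.≟ toℕ i) ℤ.* + ind (r′ ℕ.≟ k ∸ toℕ i)) (+ ind ((ρ ⊕ ρ′) ≟ᵐ μ)))))))
    (trans (sym (*-sumℤ {suc k} (+ ind ((ρ ⊕ ρ′) ≟ᵐ μ)) (λ i → + ind (r ℕ.≟ toℕ i) ℤ.* + ind (r′ ℕ.≟ k ∸ toℕ i))))
      (trans (cong (ℤ._*_ (+ ind ((ρ ⊕ ρ′) ≟ᵐ μ))) (sum-antidiagonal k r r′))
        (trans (ℤP.*-comm (+ ind ((ρ ⊕ ρ′) ≟ᵐ μ)) (+ ind (r + r′ ℕ.≟ k))) (sym (ind-cons (r + r′) k (ρ ⊕ ρ′) μ)))))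
  where
  regroup : ∀ a b c d → a ℤ.* b ℤ.* (c ℤ.* d) ≡ a ℤ.* c ℤ.* (b ℤ.* d)
  regroup = solve-∀

coeff-product : ∀ {m} (p q : Poly m) μ → coeff (p *P q) μ ≡ sumBox μ (λ ν → coeff p ν ℤ.* coeff q (μ ⊖ ν))
coeff-product p q μ =
  trans (coeff-ev (p *P q) μ) (trans (ev-product p q _)
    (sym (trans (sumBox-cong μ (λ ν → trans (ℤP.*-comm (coeff p ν) (coeff q (μ ⊖ ν))) (trans (cong (ℤ._*_ (coeff q (μ ⊖ ν))) (coeff-ev p ν)) (sym (ev-* p (coeff q (μ ⊖ ν)) (δ ν))))))
      (trans (sumBox-ev μ p (λ ν ρ → coeff q (μ ⊖ ν) ℤ.* δ ν ρ))
        (ev-cong p (λ ρ → trans (sumBox-cong μ (λ ν → trans (ℤP.*-comm (coeff q (μ ⊖ ν)) (δ ν ρ)) (trans (cong (ℤ._*_ (δ ν ρ)) (coeff-ev q (μ ⊖ ν))) (sym (ev-* q (δ ν ρ) (δ (μ ⊖ ν)))))))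
          (trans (sumBox-ev μ q (λ ν ρ′ → δ ν ρ ℤ.* δ (μ ⊖ ν) ρ′))
            (ev-cong q (λ ρ′ → sumBox-antidiagonal μ ρ ρ′)))))))))
  where
  δ : Monomial _ → Monomial _ → ℤ
  δ μ ν = + ind (ν ≟ᵐ μ)

_≤ᵐ_ : ∀ {m} → Monomial m → Monomial m → Set
ν ≤ᵐ μ = ∀ e → Vec.lookup ν e ≤ Vec.lookup μ e

private
  ≤ᵐ-cons : ∀ {m k} {ν μ : Monomial m} (i : Fin (suc k)) → ν ≤ᵐ μ → (toℕ i ∷ ν) ≤ᵐ (k ∷ μ)
  ≤ᵐ-cons i le zero    = ℕP.≤-pred (FinP.toℕ<n i)
  ≤ᵐ-cons i le (suc e) = le e

sumBox-mono : ∀ {m} (μ : Monomial m) {F G : Monomial m → ℤ} → (∀ ν → ν ≤ᵐ μ → F ν ℤ.≤ G ν) → sumBox μ F ℤ.≤ sumBox μ G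
sumBox-mono [] le = le [] (λ ())
sumBox-mono (k ∷ μ) le = mono {suc k} (λ i → sumBox-mono μ (λ ν ν≤μ → le (toℕ i ∷ ν) (≤ᵐ-cons i ν≤μ)))
  where
  mono : ∀ {n} {f g : Fin n → ℤ} → (∀ i → f i ℤ.≤ g i) → sumℤ f ℤ.≤ sumℤ g
  mono {zero}  _  = ℤP.≤-refl
  mono {suc n} le = ℤP.+-mono-≤ (le zero) (mono (le ∘ suc))

-- Finds the pair of path families from which the exchange set is built, or shows that there is
-- nothing to compare.
search : ∀ {m} (μ : Monomial m) {P : Monomial m → Set} → (∀ ν → Dec (P ν)) → (∃ λ ν → ν ≤ᵐ μ × P ν) ⊎ (∀ ν → ν ≤ᵐ μ → ¬ P ν)
search [] P? with P? []
... | yes p = inj₁ ([] , (λ ()) , p)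
... | no ¬p = inj₂ (λ { [] _ → ¬p })
search (k ∷ μ) {P} P? with FinP.any? {suc k} (λ i → inner i)
  where
  inner : ∀ (i : Fin (suc k)) → Dec (∃ λ ν → ν ≤ᵐ μ × P (toℕ i ∷ ν))
  inner i with search μ (λ ν → P? (toℕ i ∷ ν))
  ... | inj₁ w = yes w
  ... | inj₂ none = no (λ { (ν , le , p) → none ν le p })
... | yes (i , ν , le , p) = inj₁ (toℕ i ∷ ν , ≤ᵐ-cons i le , p)
... | no none = inj₂ λ { (x ∷ ν) le p → none (fromℕ< (s≤s (le zero)) , ν , le ∘ suc ,
                           subst (λ t → P (t ∷ ν)) (sym (FinP.toℕ-fromℕ< (s≤s (le zero)))) p) }

-- If `ν` and `μ ⊖ ν` are the exponents of two factors, this is the exponent of the first factor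
-- after the two are exchanged on `S`.
reflect : ∀ {m} → (Fin m → Bool) → Monomial m → Monomial m → Monomial m
reflect S [] [] = []
reflect S (k ∷ μ) (x ∷ ν) = (if S zero then k ∸ x else x) ∷ reflect (S ∘ suc) μ ν

lookup-reflect : ∀ {m} (S : Fin m → Bool) (μ ν : Monomial m) e →
  Vec.lookup (reflect S μ ν) e ≡ (if S e then Vec.lookup μ e ∸ Vec.lookup ν e else Vec.lookup ν e)
lookup-reflect S (k ∷ μ) (x ∷ ν) zero    = refl
lookup-reflect S (k ∷ μ) (x ∷ ν) (suc e) = lookup-reflect (S ∘ suc) μ ν e

-- For fixed `S` this is an involution of the box, `opposite` in each coordinate of `S`, and so it
-- permutes the summands. This is where the exchange set has to be the same for all summands.
sumBox-reflect : ∀ {m} (S : Fin m → Bool) (μ : Monomial m) F → sumBox μ (F ∘ reflect S μ) ≡ sumBox μ F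
sumBox-reflect S [] F = refl
sumBox-reflect S (k ∷ μ) F with S zero
... | false = sumℤ-cong {suc k} (λ i → sumBox-reflect (S ∘ suc) μ (λ ν → F (toℕ i ∷ ν)))
... | true  = trans (sumℤ-cong {suc k} (λ i → trans (sumBox-reflect (S ∘ suc) μ (λ ν → F (k ∸ toℕ i ∷ ν)))
                      (cong (λ t → sumBox μ (λ ν → F (t ∷ ν))) (sym (FinP.opposite-prop i)))))
                (sym (sumℤ-permute {suc k} {suc k} (λ i → sumBox μ (λ ν → F (toℕ i ∷ ν)))
                       (permutation opposite opposite FinP.opposite-involutive FinP.opposite-involutive)))

-- Determinants over a commutative ring

module Determinant {c ℓ} (R : CommutativeRing c ℓ) where
  open CommutativeRing R using (Carrier; _≈_; 0#; 1#; ring; semiring; +-cong; +-congˡ; +-congʳ; *-cong; *-congˡ; *-congʳ; +-commutativeMonoid; setoid)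
    renaming (_+_ to _⊞_; _*_ to _⊠_; -_ to ⊟_; refl to ≈-refl; sym to ≈-sym; trans to ≈-trans; reflexive to ≈-reflexive; *-assoc to ⊠-assoc; *-comm to ⊠-comm; +-assoc to ⊞-assoc; +-comm to ⊞-comm; +-identityʳ to ⊞-identityʳ; +-identityˡ to ⊞-identityˡ; *-identityˡ to ⊠-identityˡ; distribˡ to ⊠-distribˡ; zeroˡ to ⊠-zeroˡ; zeroʳ to ⊠-zeroʳ; -‿inverseˡ to ⊟-inverseˡ; -‿inverseʳ to ⊟-inverseʳ; -‿cong to ⊟-cong)
  open RingP ring using (-‿distribˡ-*; -‿distribʳ-*; -‿+-comm; -‿involutive; -0#≈0#)
  open SRSum semiring using (sum; sum-cong-≋; ∑-distrib-+; ∑-comm; *-distribˡ-sum; *-distribʳ-sum)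
  open FinSum +-commutativeMonoid using (sum-zero; sum-single)
  open import Relation.Binary.Reasoning.Setoid setoid

  -- Kept abstract so that summands can be recovered by unification.
  abstract
    ∑ : ∀ {n} → (Fin n → Carrier) → Carrier
    ∑ = sum

    ∑-suc : ∀ {n} (f : Fin (suc n) → Carrier) → ∑ f ≈ f zero ⊞ ∑ (f ∘ suc)
    ∑-suc f = ≈-refl

    ∑-cong : ∀ {n} {f g : Fin n → Carrier} → (∀ i → f i ≈ g i) → ∑ f ≈ ∑ g
    ∑-cong = sum-cong-≋

    ∑-zero : ∀ {n} {f : Fin n → Carrier} → (∀ i → f i ≈ 0#) → ∑ f ≈ 0#
    ∑-zero {n} {f} = sum-zero {n} {f}

    ∑-single : ∀ {n} (f : Fin n → Carrier) j → (∀ i → i ≢ j → f i ≈ 0#) → ∑ f ≈ f j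
    ∑-single f = sum-single {f = f}

    ∑-+ : ∀ {n} (f g : Fin n → Carrier) → ∑ (λ i → f i ⊞ g i) ≈ ∑ f ⊞ ∑ g
    ∑-+ = ∑-distrib-+

    ∑-swap : ∀ {m n} (f : Fin m → Fin n → Carrier) → ∑ (λ i → ∑ (λ j → f i j)) ≈ ∑ (λ j → ∑ (λ i → f i j))
    ∑-swap = ∑-comm

    *-∑ : ∀ {n} x (f : Fin n → Carrier) → x ⊠ ∑ f ≈ ∑ (λ i → x ⊠ f i)
    *-∑ = *-distribˡ-sum

    ∑-* : ∀ {n} x (f : Fin n → Carrier) → ∑ f ⊠ x ≈ ∑ (λ i → f i ⊠ x)
    ∑-* = *-distribʳ-sum

  Matrix : ℕ → Set c
  Matrix k = Fin k → Fin k → Carrier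

  ε : ℕ → Carrier
  ε zero    = 1#
  ε (suc i) = ⊟ ε i

  minor : ∀ {k} → Matrix (suc k) → Fin (suc k) → Matrix k
  minor M j r c = M (suc r) (punchIn j c)

  Det : ∀ k → Matrix k → Carrier
  Det zero    M = 1#
  Det (suc k) M = ∑ (λ j → ε (toℕ j) ⊠ (M zero j ⊠ Det k (minor M j)))

  Det-cong : ∀ k {M M′ : Matrix k} → (∀ r c → M r c ≈ M′ r c) → Det k M ≈ Det k M′
  Det-cong zero    eq = ≈-refl
  Det-cong (suc k) eq = ∑-cong (λ j → *-congˡ (*-cong (eq zero j) (Det-cong k (λ r c → eq (suc r) (punchIn j c)))))

  exchange : ∀ x y z → x ⊠ (y ⊠ z) ≈ y ⊠ (x ⊠ z)
  exchange x y z = ≈-trans (≈-sym (⊠-assoc x y z)) (≈-trans (*-congʳ (⊠-comm x y)) (⊠-assoc y x z))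

  -- The expansion defining `Det` singles out the first row: there the sum is distributed, while a
  -- sum in a lower row is handed on to every minor. It serves to expand a row of the path matrix
  -- over the edges leaving a vertex.
  Det-linear : ∀ k {m} r (M : Matrix k) (N : Fin m → Matrix k) (a : Fin m → Carrier) →
    (∀ j → M r j ≈ ∑ (λ e → a e ⊠ N e r j)) → (∀ e s j → s ≢ r → N e s j ≈ M s j) →
    Det k M ≈ ∑ (λ e → a e ⊠ Det k (N e))
  Det-linear (suc k) {m} r M N a row rest = begin
    ∑ (λ j → ε (toℕ j) ⊠ (M zero j ⊠ Det k (minor M j)))
      ≈⟨ ∑-cong (λ j → ≈-trans (*-congˡ (term r row rest j)) (≈-trans (*-∑ (ε (toℕ j)) _) (∑-cong (λ e → exchange (ε (toℕ j)) (a e) _)))) ⟩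
    ∑ (λ j → ∑ (λ e → a e ⊠ (ε (toℕ j) ⊠ (N e zero j ⊠ Det k (minor (N e) j)))))
      ≈⟨ ∑-swap (λ j e → a e ⊠ (ε (toℕ j) ⊠ (N e zero j ⊠ Det k (minor (N e) j)))) ⟩
    ∑ (λ e → ∑ (λ j → a e ⊠ (ε (toℕ j) ⊠ (N e zero j ⊠ Det k (minor (N e) j)))))
      ≈⟨ ∑-cong (λ e → ≈-sym (*-∑ (a e) (λ j → ε (toℕ j) ⊠ (N e zero j ⊠ Det k (minor (N e) j))))) ⟩
    ∑ (λ e → a e ⊠ Det (suc k) (N e)) ∎
    where
    term : ∀ r → (∀ j → M r j ≈ ∑ (λ e → a e ⊠ N e r j)) → (∀ e s j → s ≢ r → N e s j ≈ M s j) →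
           ∀ j → M zero j ⊠ Det k (minor M j) ≈ ∑ (λ e → a e ⊠ (N e zero j ⊠ Det k (minor (N e) j)))
    term zero row rest j = begin
      M zero j ⊠ Det k (minor M j) ≈⟨ *-congʳ (row j) ⟩
      ∑ (λ e → a e ⊠ N e zero j) ⊠ Det k (minor M j) ≈⟨ ∑-* (Det k (minor M j)) (λ e → a e ⊠ N e zero j) ⟩
      ∑ (λ e → a e ⊠ N e zero j ⊠ Det k (minor M j))
        ≈⟨ ∑-cong (λ e → ≈-trans (⊠-assoc (a e) (N e zero j) _) (*-congˡ (*-congˡ (Det-cong k (λ s c → ≈-sym (rest e (suc s) (punchIn j c) (λ ()))))))) ⟩
      ∑ (λ e → a e ⊠ (N e zero j ⊠ Det k (minor (N e) j))) ∎
    term (suc r) row rest j = begin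
      M zero j ⊠ Det k (minor M j)
        ≈⟨ *-congˡ (Det-linear k r (minor M j) (λ e → minor (N e) j) a (λ c → row (punchIn j c)) (λ e s c s≢r → rest e (suc s) (punchIn j c) (s≢r ∘ FinP.suc-injective))) ⟩
      M zero j ⊠ ∑ (λ e → a e ⊠ Det k (minor (N e) j)) ≈⟨ *-∑ (M zero j) (λ e → a e ⊠ Det k (minor (N e) j)) ⟩
      ∑ (λ e → M zero j ⊠ (a e ⊠ Det k (minor (N e) j)))
        ≈⟨ ∑-cong (λ e → ≈-trans (exchange (M zero j) (a e) _) (*-congˡ (*-congʳ (≈-sym (rest e zero j (λ ())))))) ⟩
      ∑ (λ e → a e ⊠ (N e zero j ⊠ Det k (minor (N e) j))) ∎

  ∑-neg : ∀ {n} (f : Fin n → Carrier) → ∑ (λ i → ⊟ f i) ≈ ⊟ ∑ f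
  ∑-neg {zero}  f = ≈-trans (∑-zero (λ ())) (≈-trans (≈-sym -0#≈0#) (⊟-cong (≈-sym (∑-zero (λ ())))))
  ∑-neg {suc n} f = ≈-trans (∑-suc (λ i → ⊟ f i)) (≈-trans (+-congˡ (∑-neg (f ∘ suc))) (≈-trans (-‿+-comm (f zero) (∑ (f ∘ suc))) (⊟-cong (≈-sym (∑-suc f)))))

  -- Pairs (j , l) stand for the ordered pairs of distinct columns j and punchIn j l; the hypothesis is symmetry.
  alternating-sum : ∀ n (F : Fin (suc n) → Fin n → Carrier) → (∀ i l → i Fin.≤ l → F (inject₁ i) l ≈ F (suc l) i) →
    ∑ (λ j → ε (toℕ j) ⊠ ∑ (λ l → ε (toℕ l) ⊠ F j l)) ≈ 0#
  alternating-sum zero F symm = ∑-zero (λ j → ≈-trans (*-congˡ (∑-zero (λ ()))) (⊠-zeroʳ (ε (toℕ j))))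
  alternating-sum (suc n) F symm = begin
    -- The terms with `j` or `l` equal to zero are split off and cancel by symmetry. In the others
    -- both indices shift, the sign changes twice, and the same sum of smaller size remains.
    ∑ (λ j → ε (toℕ j) ⊠ ∑ (λ l → ε (toℕ l) ⊠ F j l))
      ≈⟨ ≈-trans (∑-suc (λ j → ε (toℕ j) ⊠ ∑ (λ l → ε (toℕ l) ⊠ F j l))) (+-congˡ (∑-cong (λ j → *-congˡ (∑-suc (λ l → ε (toℕ l) ⊠ F (suc j) l))))) ⟩
    1# ⊠ A ⊞ ∑ (λ j → ⊟ ε (toℕ j) ⊠ (1# ⊠ F (suc j) zero ⊞ ∑ (λ l → ⊟ ε (toℕ l) ⊠ F (suc j) (suc l))))
      ≈⟨ +-cong (⊠-identityˡ A) (∑-cong (λ j → ≈-trans (⊠-distribˡ _ _ _) (+-cong (≈-trans (*-congˡ (⊠-identityˡ _)) (≈-sym (-‿distribˡ-* _ _))) (sign j)))) ⟩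
    A ⊞ ∑ (λ j → ⊟ (ε (toℕ j) ⊠ F (suc j) zero) ⊞ ε (toℕ j) ⊠ ∑ (λ l → ε (toℕ l) ⊠ F (suc j) (suc l)))
      ≈⟨ +-congˡ (∑-+ (λ j → ⊟ (ε (toℕ j) ⊠ F (suc j) zero)) (λ j → ε (toℕ j) ⊠ ∑ (λ l → ε (toℕ l) ⊠ F (suc j) (suc l)))) ⟩
    A ⊞ (∑ (λ j → ⊟ (ε (toℕ j) ⊠ F (suc j) zero)) ⊞ ∑ (λ j → ε (toℕ j) ⊠ ∑ (λ l → ε (toℕ l) ⊠ F (suc j) (suc l))))
      ≈⟨ +-congˡ (+-cong (∑-neg (λ j → ε (toℕ j) ⊠ F (suc j) zero)) (alternating-sum n (λ j l → F (suc j) (suc l)) (λ i l i≤l → symm (suc i) (suc l) (s≤s i≤l)))) ⟩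
    A ⊞ (⊟ ∑ (λ j → ε (toℕ j) ⊠ F (suc j) zero) ⊞ 0#)
      ≈⟨ +-congˡ (≈-trans (⊞-identityʳ _) (⊟-cong (∑-cong (λ j → *-congˡ (≈-sym (symm zero j z≤n)))))) ⟩
    A ⊞ ⊟ A ≈⟨ ⊟-inverseʳ A ⟩
    0# ∎
    where
    A : Carrier
    A = ∑ (λ l → ε (toℕ l) ⊠ F zero l)
    sign : ∀ j → ⊟ ε (toℕ j) ⊠ ∑ (λ l → ⊟ ε (toℕ l) ⊠ F (suc j) (suc l)) ≈ ε (toℕ j) ⊠ ∑ (λ l → ε (toℕ l) ⊠ F (suc j) (suc l))
    sign j = begin
      ⊟ ε (toℕ j) ⊠ ∑ (λ l → ⊟ ε (toℕ l) ⊠ F (suc j) (suc l))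
        ≈⟨ *-congˡ (≈-trans (∑-cong (λ l → ≈-sym (-‿distribˡ-* _ _))) (∑-neg (λ l → ε (toℕ l) ⊠ F (suc j) (suc l)))) ⟩
      ⊟ ε (toℕ j) ⊠ ⊟ ∑ (λ l → ε (toℕ l) ⊠ F (suc j) (suc l)) ≈⟨ ≈-sym (-‿distribˡ-* _ _) ⟩
      ⊟ (ε (toℕ j) ⊠ ⊟ ∑ (λ l → ε (toℕ l) ⊠ F (suc j) (suc l))) ≈⟨ ⊟-cong (≈-sym (-‿distribʳ-* _ _)) ⟩
      ⊟ ⊟ (ε (toℕ j) ⊠ ∑ (λ l → ε (toℕ l) ⊠ F (suc j) (suc l))) ≈⟨ -‿involutive _ ⟩
      ε (toℕ j) ⊠ ∑ (λ l → ε (toℕ l) ⊠ F (suc j) (suc l)) ∎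

  punchIn-inject₁ : ∀ {n} (i l : Fin n) → i Fin.≤ l → punchIn (inject₁ i) l ≡ suc l
  punchIn-inject₁ zero    l       _         = refl
  punchIn-inject₁ (suc i) (suc l) (s≤s i≤l) = cong suc (punchIn-inject₁ i l i≤l)

  punchIn-suc : ∀ {n} (i l : Fin n) → i Fin.≤ l → punchIn (suc l) i ≡ inject₁ i
  punchIn-suc zero    l       _         = refl
  punchIn-suc (suc i) (suc l) (s≤s i≤l) = cong suc (punchIn-suc i l i≤l)

  -- The cosimplicial identity: two columns may be left out in either order.
  punchIn-punchIn : ∀ {n} (i l : Fin (suc n)) → i Fin.≤ l → ∀ c → punchIn (inject₁ i) (punchIn l c) ≡ punchIn (suc l) (punchIn i c)
  punchIn-punchIn zero    l       _         c       = refl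
  punchIn-punchIn (suc i) (suc l) (s≤s i≤l) zero    = refl
  punchIn-punchIn {suc n} (suc i) (suc l) (s≤s i≤l) (suc c) = cong suc (punchIn-punchIn i l i≤l c)

  record RowsSwapped {k} (r s : Fin k) (M M′ : Matrix k) : Set ℓ where
    constructor rowsSwapped
    field
      first  : ∀ j → M′ r j ≈ M s j
      second : ∀ j → M′ s j ≈ M r j
      others : ∀ t j → t ≢ r → t ≢ s → M′ t j ≈ M t j

  -- Expansion along both top rows indexes the terms by ordered pairs of distinct columns. The term
  -- of `M` at one pair is the term of `M′` at the reversed pair, so in the sum of the two
  -- determinants the terms are symmetric and `alternating-sum` applies.
  Det-swap₀₁ : ∀ k (M M′ : Matrix (suc (suc k))) → RowsSwapped zero (suc zero) M M′ → Det (suc (suc k)) M ⊞ Det (suc (suc k)) M′ ≈ 0#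
  Det-swap₀₁ k M M′ (rowsSwapped first second others) = begin
    Det (suc (suc k)) M ⊞ Det (suc (suc k)) M′ ≈⟨ +-cong (expand M) (expand M′) ⟩
    ∑ (λ j → ε (toℕ j) ⊠ inner M j) ⊞ ∑ (λ j → ε (toℕ j) ⊠ inner M′ j) ≈⟨ ≈-sym (∑-+ _ _) ⟩
    ∑ (λ j → ε (toℕ j) ⊠ inner M j ⊞ ε (toℕ j) ⊠ inner M′ j) ≈⟨ ∑-cong (λ j → ≈-sym (⊠-distribˡ _ _ _)) ⟩
    ∑ (λ j → ε (toℕ j) ⊠ (inner M j ⊞ inner M′ j))
      ≈⟨ ∑-cong (λ j → *-congˡ (≈-trans (≈-sym (∑-+ _ _)) (∑-cong (λ l → ≈-sym (⊠-distribˡ _ _ _))))) ⟩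
    ∑ (λ j → ε (toℕ j) ⊠ ∑ (λ l → ε (toℕ l) ⊠ (G M j l ⊞ G M′ j l))) ≈⟨ alternating-sum (suc k) (λ j l → G M j l ⊞ G M′ j l) symm ⟩
    0# ∎
    where
    G : Matrix (suc (suc k)) → Fin (suc (suc k)) → Fin (suc k) → Carrier
    G N j l = N zero j ⊠ (N (suc zero) (punchIn j l) ⊠ Det k (λ r c → N (suc (suc r)) (punchIn j (punchIn l c))))
    inner : Matrix (suc (suc k)) → Fin (suc (suc k)) → Carrier
    inner N j = ∑ (λ l → ε (toℕ l) ⊠ G N j l)
    expand : ∀ N → Det (suc (suc k)) N ≈ ∑ (λ j → ε (toℕ j) ⊠ inner N j)
    expand N = ∑-cong (λ j → *-congˡ (≈-trans (*-∑ (N zero j) (λ l → ε (toℕ l) ⊠ (minor N j zero l ⊠ Det k (minor (minor N j) l))))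
                 (∑-cong (λ l → exchange (N zero j) (ε (toℕ l)) _))))
    half : ∀ N N′ → RowsSwapped zero (suc zero) N N′ → ∀ i l → i Fin.≤ l → G N (inject₁ i) l ≈ G N′ (suc l) i
    half N N′ (rowsSwapped first second others) i l i≤l = begin
      N zero (inject₁ i) ⊠ (N (suc zero) (punchIn (inject₁ i) l) ⊠ Det k (λ r c → N (suc (suc r)) (punchIn (inject₁ i) (punchIn l c))))
        ≈⟨ exchange _ _ _ ⟩
      N (suc zero) (punchIn (inject₁ i) l) ⊠ (N zero (inject₁ i) ⊠ Det k (λ r c → N (suc (suc r)) (punchIn (inject₁ i) (punchIn l c))))
        ≈⟨ *-cong (≈-trans (≈-reflexive (cong (N (suc zero)) (punchIn-inject₁ i l i≤l))) (≈-sym (first (suc l))))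
             (*-cong (≈-trans (≈-reflexive (cong (N zero) (sym (punchIn-suc i l i≤l)))) (≈-sym (second (punchIn (suc l) i))))
               (Det-cong k (λ r c → ≈-trans (≈-reflexive (cong (N (suc (suc r))) (punchIn-punchIn i l i≤l c))) (≈-sym (others (suc (suc r)) _ (λ ()) (λ ())))))) ⟩
      N′ zero (suc l) ⊠ (N′ (suc zero) (punchIn (suc l) i) ⊠ Det k (λ r c → N′ (suc (suc r)) (punchIn (suc l) (punchIn i c)))) ∎
    back : RowsSwapped zero (suc zero) M′ M
    back = rowsSwapped (λ j → ≈-sym (second j)) (λ j → ≈-sym (first j)) (λ t j p q → ≈-sym (others t j p q))
    symm : ∀ i l → i Fin.≤ l → G M (inject₁ i) l ⊞ G M′ (inject₁ i) l ≈ G M (suc l) i ⊞ G M′ (suc l) i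
    symm i l i≤l = ≈-trans (⊞-comm _ _) (+-cong (half M′ M back i l i≤l) (half M M′ (rowsSwapped first second others) i l i≤l))

  neg-unique : ∀ {x y} → x ⊞ y ≈ 0# → y ≈ ⊟ x
  neg-unique {x} {y} eq = begin
    y ≈⟨ ≈-sym (⊞-identityˡ y) ⟩
    0# ⊞ y ≈⟨ +-congʳ (≈-sym (⊟-inverseˡ x)) ⟩
    (⊟ x ⊞ x) ⊞ y ≈⟨ ⊞-assoc _ _ _ ⟩
    ⊟ x ⊞ (x ⊞ y) ≈⟨ +-congˡ eq ⟩
    ⊟ x ⊞ 0# ≈⟨ ⊞-identityʳ _ ⟩
    ⊟ x ∎

  SwapLaw : ℕ → Set _
  SwapLaw k = ∀ r s (M M′ : Matrix k) → r Fin.< s → RowsSwapped r s M M′ → Det k M′ ≈ ⊟ Det k M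

  swap-lower : ∀ k → SwapLaw k → ∀ r s (M M′ : Matrix (suc k)) → r Fin.< s → RowsSwapped (suc r) (suc s) M M′ → Det (suc k) M′ ≈ ⊟ Det (suc k) M
  swap-lower k law r s M M′ r<s (rowsSwapped first second others) = begin
    ∑ (λ j → ε (toℕ j) ⊠ (M′ zero j ⊠ Det k (minor M′ j)))
      ≈⟨ ∑-cong (λ j → ≈-trans (*-congˡ (≈-trans (*-cong (others zero j (λ ()) (λ ())) (law r s (minor M j) (minor M′ j) r<s (rows j))) (≈-sym (-‿distribʳ-* _ _)))) (≈-sym (-‿distribʳ-* _ _))) ⟩
    ∑ (λ j → ⊟ (ε (toℕ j) ⊠ (M zero j ⊠ Det k (minor M j)))) ≈⟨ ∑-neg (λ j → ε (toℕ j) ⊠ (M zero j ⊠ Det k (minor M j))) ⟩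
    ⊟ Det (suc k) M ∎
    where
    rows : ∀ j → RowsSwapped r s (minor M j) (minor M′ j)
    rows j = rowsSwapped (λ c → first (punchIn j c)) (λ c → second (punchIn j c))
      (λ t c t≢r t≢s → others (suc t) (punchIn j c) (t≢r ∘ FinP.suc-injective) (t≢s ∘ FinP.suc-injective))

  Det-swap : ∀ k → SwapLaw k
  Det-swap (suc k) (suc r) (suc s) M M′ (s≤s r<s) sw = swap-lower k (Det-swap k) r s M M′ r<s sw
  Det-swap (suc (suc k)) zero (suc zero) M M′ _ sw = neg-unique (Det-swap₀₁ k M M′ sw)
  -- (0 s) = (1 s)(0 1)(1 s)
  Det-swap (suc (suc k)) zero (suc (suc t)) M M′ _ (rowsSwapped first second others) = begin
    Det (suc (suc k)) M′ ≈⟨ swap-lower (suc k) (Det-swap (suc k)) zero (suc t) M₂ M′ (s≤s z≤n) (rowsSwapped last₁ last₂ last₃) ⟩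
    ⊟ Det (suc (suc k)) M₂ ≈⟨ ⊟-cong (neg-unique (Det-swap₀₁ k M₁ M₂ (rowsSwapped (λ _ → ≈-refl) (λ _ → ≈-refl) middle))) ⟩
    ⊟ ⊟ Det (suc (suc k)) M₁ ≈⟨ -‿involutive _ ⟩
    Det (suc (suc k)) M₁ ≈⟨ swap-lower (suc k) (Det-swap (suc k)) zero (suc t) M M₁ (s≤s z≤n) (rowsSwapped (λ _ → ≈-refl) at-t off-t) ⟩
    ⊟ Det (suc (suc k)) M ∎
    where
    M₁ M₂ : Matrix (suc (suc k))
    M₁ zero          = M zero
    M₁ (suc zero)    = M (suc (suc t))
    M₁ (suc (suc x)) = if does (x Fin.≟ t) then M (suc zero) else M (suc (suc x))
    M₂ zero          = M (suc (suc t))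
    M₂ (suc zero)    = M zero
    M₂ (suc (suc x)) = M₁ (suc (suc x))
    row-t : M₁ (suc (suc t)) ≡ M (suc zero)
    row-t with t Fin.≟ t
    ... | yes _ = refl
    ... | no ne = ⊥-elim (ne refl)
    row-other : ∀ x → x ≢ t → M₁ (suc (suc x)) ≡ M (suc (suc x))
    row-other x ne with x Fin.≟ t
    ... | yes eq = ⊥-elim (ne eq)
    ... | no _   = refl
    at-t : ∀ j → M₁ (suc (suc t)) j ≈ M (suc zero) j
    at-t j = ≈-reflexive (cong (λ row → row j) row-t)
    off-t : ∀ x j → x ≢ suc zero → x ≢ suc (suc t) → M₁ x j ≈ M x j
    off-t zero          j _  _  = ≈-refl
    off-t (suc zero)    j ne _  = ⊥-elim (ne refl)
    off-t (suc (suc x)) j _  ne = ≈-reflexive (cong (λ row → row j) (row-other x (ne ∘ cong (λ y → suc (suc y)))))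
    middle : ∀ x j → x ≢ zero → x ≢ suc zero → M₂ x j ≈ M₁ x j
    middle zero          j ne _  = ⊥-elim (ne refl)
    middle (suc zero)    j _  ne = ⊥-elim (ne refl)
    middle (suc (suc x)) j _  _  = ≈-refl
    last₁ : ∀ j → M′ (suc zero) j ≈ M₂ (suc (suc t)) j
    last₁ j = ≈-trans (others (suc zero) j (λ ()) (λ ())) (≈-sym (at-t j))
    last₂ : ∀ j → M′ (suc (suc t)) j ≈ M₂ (suc zero) j
    last₂ j = second j
    last₃ : ∀ x j → x ≢ suc zero → x ≢ suc (suc t) → M′ x j ≈ M₂ x j
    last₃ zero          j _  _  = first j
    last₃ (suc zero)    j ne _  = ⊥-elim (ne refl)
    last₃ (suc (suc x)) j _  ne = ≈-trans (others (suc (suc x)) j (λ ()) ne) (≈-reflexive (cong (λ row → row j) (sym (row-other x (ne ∘ cong (λ y → suc (suc y)))))))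

  Det-zero-row : ∀ k (M : Matrix (suc k)) → (∀ j → M zero j ≈ 0#) → Det (suc k) M ≈ 0#
  Det-zero-row k M zeros = ∑-zero (λ j → ≈-trans (*-congˡ (≈-trans (*-congʳ (zeros j)) (⊠-zeroˡ _))) (⊠-zeroʳ _))

  -- The expansion runs along rows: the term at column zero has a zero entry, and in each other
  -- minor the first column is still the zero column.
  Det-zero-column : ∀ k (M : Matrix (suc k)) → (∀ r → M r zero ≈ 0#) → Det (suc k) M ≈ 0#
  Det-zero-column k M zeros = ∑-zero (term k M zeros)
    where
    term : ∀ k (M : Matrix (suc k)) → (∀ r → M r zero ≈ 0#) → ∀ j → ε (toℕ j) ⊠ (M zero j ⊠ Det k (minor M j)) ≈ 0#
    term k M zeros zero = ≈-trans (*-congˡ (≈-trans (*-congʳ (zeros zero)) (⊠-zeroˡ _))) (⊠-zeroʳ _)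
    term (suc k) M zeros (suc j) = ≈-trans (*-congˡ (≈-trans (*-congˡ (∑-zero (term k (minor M (suc j)) (zeros ∘ suc)))) (⊠-zeroʳ _))) (⊠-zeroʳ _)

  Det-corner : ∀ k (M : Matrix (suc k)) → M zero zero ≈ 1# → (∀ j → M zero (suc j) ≈ 0#) → Det (suc k) M ≈ Det k (λ r c → M (suc r) (suc c))
  Det-corner k M one zeros = ≈-trans (∑-single _ zero (λ { zero ne → ⊥-elim (ne refl) ; (suc j) _ → ≈-trans (*-congˡ (≈-trans (*-congʳ (zeros j)) (⊠-zeroˡ _))) (⊠-zeroʳ _) }))
    (≈-trans (⊠-identityˡ _) (≈-trans (*-congʳ one) (⊠-identityˡ _)))

-- Counting the classes of an equivalence relation

least : ∀ {n} {P : Fin n → Set} → (∀ x → Dec (P x)) → ∃ P →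
        ∃ λ r → P r × (∀ y → P y → r Fin.≤ y)
least {suc n} P? (x , px) with P? zero
... | yes p0 = zero , p0 , λ _ _ → z≤n
least {suc n} P? (zero , px)  | no ¬p0 = ⊥-elim (¬p0 px)
least {suc n} {P} P? (suc x , px) | no ¬p0 =
  let r , pr , min = least (P? ∘ suc) (x , px)
      below : ∀ y → P y → suc r Fin.≤ y
      below = λ { zero p → ⊥-elim (¬p0 p) ; (suc y) p → s≤s (min y p) }
  in suc r , pr , below

record DecEquiv (N : ℕ) : Set₁ where
  infix 4 _~_
  field
    _~_     : Fin N → Fin N → Set
    ~-refl  : ∀ {x} → x ~ x
    ~-sym   : ∀ {x y} → x ~ y → y ~ x
    ~-trans : ∀ {x y z} → x ~ y → y ~ z → x ~ z
    _~?_    : ∀ x y → Dec (x ~ y)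

  IsMin : Fin N → Set
  IsMin x = ∀ y → x ~ y → x Fin.≤ y

  isMin? : ∀ x → Dec (IsMin x)
  isMin? x = FinP.all? (λ y → (x ~? y) →-dec (x Fin.≤? y))

  minOf : ∀ x → ∃ λ r → x ~ r × IsMin r
  minOf x =
    let r , x~r , min = least (x ~?_) (x , ~-refl)
    in r , x~r , λ y r~y → min y (~-trans x~r r~y)

  min-unique : ∀ {x y} → IsMin x → IsMin y → x ~ y → x ≡ y
  min-unique mx my x~y = FinP.≤-antisym (mx _ x~y) (my _ (~-sym x~y))

  -- Least elements represent the classes, as in `countOrbits`; counts become sums of indicators,
  -- which compare pointwise.
  classes : ℕ
  classes = sumℕ (λ x → ind (isMin? x))

open DecEquiv using (classes)

infix 4 _⊑_
_⊑_ : ∀ {N} → DecEquiv N → DecEquiv N → Set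
E ⊑ E′ = ∀ {x y} → DecEquiv._~_ E x y → DecEquiv._~_ E′ x y

classes-antitone : ∀ {N} (E E′ : DecEquiv N) → E ⊑ E′ → classes E′ ≤ classes E
classes-antitone E E′ E⊑E′ = sumℕ-mono (λ x → mono (DecEquiv.isMin? E′ x) (DecEquiv.isMin? E x)
                                             (λ m y x~y → m y (E⊑E′ x~y)))
  where
  mono : ∀ {A B : Set} (d : Dec A) (d′ : Dec B) → (A → B) → ind d ≤ ind d′
  mono (yes a) d′ f = ℕP.≤-reflexive (sym (ind-yes d′ (f a)))
  mono (no _)  d′ f = z≤n

classes-cong : ∀ {N} (E E′ : DecEquiv N) → E ⊑ E′ → E′ ⊑ E → classes E ≡ classes E′
classes-cong E E′ p q = ℕP.≤-antisym (classes-antitone E′ E q) (classes-antitone E E′ p)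

module _ {N : ℕ} (E : DecEquiv N) (a b : Fin N) where
  open DecEquiv E hiding (classes)

  glue : DecEquiv N
  glue = record
    { _~_     = _≈_
    ; ~-refl  = inj₁ ~-refl
    ; ~-sym   = λ { (inj₁ p) → inj₁ (~-sym p)
                  ; (inj₂ (inj₁ (p , q))) → inj₂ (inj₂ (~-sym q , ~-sym p))
                  ; (inj₂ (inj₂ (p , q))) → inj₂ (inj₁ (~-sym q , ~-sym p)) }
    ; ~-trans = tr
    ; _~?_    = λ x y → (x ~? y) ⊎-dec (((x ~? a) ×-dec (b ~? y)) ⊎-dec ((x ~? b) ×-dec (a ~? y)))
    }
    where
    _≈_ : Fin N → Fin N → Set
    x ≈ y = x ~ y ⊎ (x ~ a × b ~ y) ⊎ (x ~ b × a ~ y)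
    tr : ∀ {x y z} → x ≈ y → y ≈ z → x ≈ z
    tr (inj₁ p) (inj₁ q) = inj₁ (~-trans p q)
    tr (inj₁ p) (inj₂ (inj₁ (q , r))) = inj₂ (inj₁ (~-trans p q , r))
    tr (inj₁ p) (inj₂ (inj₂ (q , r))) = inj₂ (inj₂ (~-trans p q , r))
    tr (inj₂ (inj₁ (p , q))) (inj₁ r) = inj₂ (inj₁ (p , ~-trans q r))
    tr (inj₂ (inj₁ (p , q))) (inj₂ (inj₁ (r , s))) = inj₂ (inj₁ (p , s))
    tr (inj₂ (inj₁ (p , q))) (inj₂ (inj₂ (r , s))) = inj₁ (~-trans p s)
    tr (inj₂ (inj₂ (p , q))) (inj₁ r) = inj₂ (inj₂ (p , ~-trans q r))
    tr (inj₂ (inj₂ (p , q))) (inj₂ (inj₁ (r , s))) = inj₁ (~-trans p s)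
    tr (inj₂ (inj₂ (p , q))) (inj₂ (inj₂ (r , s))) = inj₂ (inj₂ (p , s))

  ⊑-glue : E ⊑ glue
  ⊑-glue = inj₁

  glue-edge : DecEquiv._~_ glue a b
  glue-edge = inj₂ (inj₁ (~-refl , ~-refl))

  glue-⊑ : (E′ : DecEquiv N) → E ⊑ E′ → DecEquiv._~_ E′ a b → glue ⊑ E′
  glue-⊑ E′ E⊑E′ a~b (inj₁ p) = E⊑E′ p
  glue-⊑ E′ E⊑E′ a~b (inj₂ (inj₁ (p , q))) = DecEquiv.~-trans E′ (E⊑E′ p) (DecEquiv.~-trans E′ a~b (E⊑E′ q))
  glue-⊑ E′ E⊑E′ a~b (inj₂ (inj₂ (p , q))) = DecEquiv.~-trans E′ (E⊑E′ p) (DecEquiv.~-trans E′ (DecEquiv.~-sym E′ a~b) (E⊑E′ q))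

  classes-glue-related : a ~ b → classes glue ≡ classes E
  classes-glue-related a~b = classes-cong glue E (glue-⊑ E (λ p → p) a~b) ⊑-glue

glue-swap : ∀ {N} (E : DecEquiv N) a b → glue E a b ⊑ glue E b a
glue-swap E a b = glue-⊑ E a b (glue E b a) (⊑-glue E b a) (DecEquiv.~-sym (glue E b a) (glue-edge E b a))

-- Gluing makes exactly one minimum disappear: the larger of the minima of the classes of a and b.
module _ {N : ℕ} (E : DecEquiv N) where
  open DecEquiv E hiding (classes)

  classes-glue-ordered : ∀ a b ra rb → a ~ ra → IsMin ra → b ~ rb → IsMin rb → ra Fin.< rb →
                         classes E ≡ suc (classes (glue E a b))
  classes-glue-ordered a b ra rb a~ra mina b~rb minb ra<rb =
    trans (sumℕ-cong pointwise)
      (trans (sumℕ-+ (λ x → ind (x Fin.≟ rb)) (λ x → ind (isMin?′ x)))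
        (cong (_+ classes (glue E a b))
          (trans (sumℕ-single rb (λ i i≢rb → ind-no (i Fin.≟ rb) i≢rb)) (ind-yes (rb Fin.≟ rb) refl))))
    where
    open DecEquiv (glue E a b) using () renaming (isMin? to isMin?′; IsMin to IsMin′)
    pointwise : ∀ x → ind (isMin? x) ≡ ind (x Fin.≟ rb) + ind (isMin?′ x)
    pointwise x with x Fin.≟ rb
    ... | yes refl = trans (ind-yes (isMin? x) minb)
            (sym (cong suc (ind-no (isMin?′ x)
              (λ m → ℕP.<⇒≱ ra<rb (m ra (inj₂ (inj₂ (~-sym b~rb , a~ra))))))))
    ... | no x≢rb = ind-⇔ (isMin? x) (isMin?′ x) to (λ m y x~y → m y (inj₁ x~y))
      where
      to : IsMin x → IsMin′ x
      to m y (inj₁ p) = m y p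
      to m y (inj₂ (inj₁ (p , q))) with min-unique m mina (~-trans p a~ra)
      ... | refl = FinP.≤-trans (ℕP.<⇒≤ ra<rb) (minb y (~-trans (~-sym b~rb) q))
      to m y (inj₂ (inj₂ (p , q))) = ⊥-elim (x≢rb (min-unique m minb (~-trans p b~rb)))

  classes-glue-unrelated : ∀ a b → ¬ a ~ b → classes E ≡ suc (classes (glue E a b))
  classes-glue-unrelated a b a≁b with minOf a | minOf b
  ... | ra , a~ra , mina | rb , b~rb , minb with FinP.<-cmp ra rb
  ... | tri< ra<rb _ _ = classes-glue-ordered a b ra rb a~ra mina b~rb minb ra<rb
  ... | tri≈ _ refl _ = ⊥-elim (a≁b (~-trans a~ra (~-sym b~rb)))
  ... | tri> _ _ rb<ra =
        trans (classes-glue-ordered b a rb ra b~rb minb a~ra mina rb<ra)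
          (cong suc (classes-cong (glue E b a) (glue E a b) (glue-swap E b a) (glue-swap E a b)))

-- Orbits of a permutation

iter-+ : ∀ {A : Set} (f : A → A) i j x → iter f (i + j) x ≡ iter f i (iter f j x)
iter-+ f zero    j x = refl
iter-+ f (suc i) j x = cong f (iter-+ f i j x)

module _ {N : ℕ} (π π⁻¹ : Fin N → Fin N) (left : ∀ x → π⁻¹ (π x) ≡ x) where

  iter-cancel : ∀ i j x → iter π i x ≡ iter π (i + j) x → x ≡ iter π j x
  iter-cancel zero    j x eq = eq
  iter-cancel (suc i) j x eq = iter-cancel i j x (trans (sym (left _)) (trans (cong π⁻¹ eq) (left _)))

  -- Two of the first `N + 1` iterates coincide, and injectivity strips off the common start.
  -- Symmetry and decidability of the orbit relation rest on this.
  period : ∀ x → ∃ λ p → p < N × iter π (suc p) x ≡ x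
  period x with FinP.pigeonhole (ℕP.n<1+n N) (λ i → iter π (toℕ i) x)
  ... | i , j , i<j , eq = p , p<N , sym (iter-cancel (toℕ i) (suc p) x (trans eq (cong (λ k → iter π k x) (sym i+p≡j))))
    where
    p = toℕ j ∸ suc (toℕ i)
    i+p≡j : toℕ i + suc p ≡ toℕ j
    i+p≡j = trans (ℕP.+-suc (toℕ i) p) (ℕP.m+[n∸m]≡n i<j)
    p<N : p < N
    p<N = ℕP.≤-trans (ℕP.m≤n+m (suc p) (toℕ i)) (subst (_≤ N) (sym i+p≡j) (ℕP.≤-pred (FinP.toℕ<n j)))

  iter-bounded : ∀ x i → ∃ λ j → j < N × iter π j x ≡ iter π i x
  iter-bounded x i with period x
  ... | p , p<N , per = let j , j≤p , eq = below i in j , ℕP.≤-trans (s≤s j≤p) p<N , eq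
    where
    below : ∀ i → ∃ λ j → j ≤ p × iter π j x ≡ iter π i x
    below zero = 0 , z≤n , refl
    below (suc i) with below i
    ... | j , j≤p , eq with ℕP.m≤n⇒m<n∨m≡n j≤p
    ... | inj₁ j<p = suc j , j<p , cong π eq
    ... | inj₂ refl = 0 , z≤n , trans (sym per) (cong π eq)

  orbit : DecEquiv N
  orbit = record
    { _~_     = λ x y → ∃ λ i → iter π i x ≡ y
    ; ~-refl  = 0 , refl
    ; ~-sym   = λ { {x} (i , refl) → back i x }
    ; ~-trans = tr
    ; _~?_    = λ x y → map′ (λ { (j , eq) → toℕ j , eq })
                             (λ { (i , refl) → let j , j<N , eq = iter-bounded x i in
                                  fromℕ< j<N , trans (cong (λ k → iter π k x) (FinP.toℕ-fromℕ< j<N)) eq })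
                             (FinP.any? (λ j → iter π (toℕ j) x Fin.≟ y))
    }
    where
    tr : ∀ {x y z} → (∃ λ i → iter π i x ≡ y) → (∃ λ i → iter π i y ≡ z) → ∃ λ i → iter π i x ≡ z
    tr {x} (i , refl) (j , refl) = j + i , iter-+ π j i x
    back : ∀ i x → ∃ λ j → iter π j (iter π i x) ≡ x
    back zero    x = 0 , refl
    back (suc i) x =
      let p , _ , per = period (iter π i x)
      in tr (p , trans (sym (iter-+ π p 1 (iter π i x)))
                   (trans (cong (λ k → iter π k (iter π i x)) (ℕP.+-comm p 1)) per))
            (back i x)

  orbit-⊑ : (E : DecEquiv N) → (∀ x → DecEquiv._~_ E x (π x)) → orbit ⊑ E
  orbit-⊑ E step (i , refl) = go i _
    where
    go : ∀ i x → DecEquiv._~_ E x (iter π i x)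
    go zero    x = DecEquiv.~-refl E
    go (suc i) x = DecEquiv.~-trans E (go i x) (step _)

  step∈orbit : ∀ x → DecEquiv._~_ orbit x (π x)
  step∈orbit x = 1 , refl

-- Comparison with the computed orbit counts

reach-⊑ : ∀ {N} (E : DecEquiv N) (gs : List (Fin N → Fin N)) → All (λ g → ∀ x → DecEquiv._~_ E x (g x)) gs →
          ∀ k x y → T (reachB gs k x y) → DecEquiv._~_ E x y
reach-⊑ E gs inv zero x y t with toWitness t
... | refl = DecEquiv.~-refl E
reach-⊑ {N} E gs inv (suc k) x y t with Equivalence.to BoolP.T-∨ t
... | inj₁ t′ = reach-⊑ E gs inv k x y t′
... | inj₂ t′ with find (AnyP.any⁻ _ (allFin N) t′)
... | z , _ , tz with Equivalence.to (BoolP.T-∧ {reachB gs k x z}) tz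
... | tx , tg with find (AnyP.any⁻ _ gs tg)
... | g , g∈gs , eq = DecEquiv.~-trans E (reach-⊑ E gs inv k x z tx)
                        (subst (DecEquiv._~_ E z) (toWitness eq) (All.lookup inv g∈gs z))

reach-iter : ∀ {N} (π : Fin N → Fin N) k x i → i ≤ k → T (reachB (π ∷ []) k x (iter π i x))
reach-iter π zero x zero z≤n = fromWitness refl
reach-iter {N} π (suc k) x i i≤k with ℕP.m≤n⇒m<n∨m≡n i≤k
... | inj₁ i<k = Equivalence.from BoolP.T-∨ (inj₁ (reach-iter π k x i (ℕP.≤-pred i<k)))
... | inj₂ refl = Equivalence.from (BoolP.T-∨ {reachB (π ∷ []) k x (iter π (suc k) x)}) (inj₂
        (AnyP.any⁺ _ (lose (MemP.∈-allFin (iter π k x))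
          (Equivalence.from BoolP.T-∧ (reach-iter π k x k ℕP.≤-refl ,
             Equivalence.from (BoolP.T-∨ {⌊ π (iter π k x) Fin.≟ iter π (suc k) x ⌋}) (inj₁ (fromWitness refl)))))))

length-filterᵇ-tabulate : ∀ {A : Set} (p : A → Bool) {n} (f : Fin n → A) →
  length (filterᵇ p (tabulate f)) ≡ sumℕ (λ i → if p (f i) then 1 else 0)
length-filterᵇ-tabulate p {zero}  f = refl
length-filterᵇ-tabulate p {suc n} f with p (f zero)
... | true  = cong suc (length-filterᵇ-tabulate p (f ∘ suc))
... | false = length-filterᵇ-tabulate p (f ∘ suc)

orbitMin : ∀ {N} → List (Fin N → Fin N) → Fin N → Bool
orbitMin {N} gs x = all (λ y → not (reachB gs N x y) ∨ ⌊ x Fin.≤? y ⌋) (allFin N)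

countOrbits-sum : ∀ {N} (gs : List (Fin N → Fin N)) → countOrbits gs ≡ sumℕ (λ x → if orbitMin gs x then 1 else 0)
countOrbits-sum gs = length-filterᵇ-tabulate (orbitMin gs) (λ x → x)

if-mono : ∀ {b c} → (T b → T c) → (if b then 1 else 0) ≤ (if c then 1 else 0)
if-mono {true}  {true}  f = ℕP.≤-refl
if-mono {true}  {false} f = ⊥-elim (f tt)
if-mono {false} {c}     f = z≤n

T-does : ∀ {A : Set} (d : Dec A) → T (does d) → A
T-does (yes a) _ = a

does-T : ∀ {A : Set} (d : Dec A) → A → T (does d)
does-T (yes _) _ = tt
does-T (no ¬a) a = ¬a a

-- A cycle closes within `N` rounds, so every computed minimum is the least element of its orbit.
-- This bound serves for vertices and faces, the opposite one for components.
countOrbits≤classes : ∀ {N} (π π⁻¹ : Fin N → Fin N) (left : ∀ x → π⁻¹ (π x) ≡ x) →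
                      countOrbits (π ∷ []) ≤ classes (orbit π π⁻¹ left)
countOrbits≤classes {N} π π⁻¹ left =
  subst (_≤ classes (orbit π π⁻¹ left)) (sym (countOrbits-sum (π ∷ [])))
    (sumℕ-mono (λ x → if-mono (λ t → does-T (isMin? x) (min x t))))
  where
  open DecEquiv (orbit π π⁻¹ left) using (isMin?; IsMin)
  min : ∀ x → T (orbitMin (π ∷ []) x) → IsMin x
  min x t y (i , refl) with iter-bounded π π⁻¹ left x i
  ... | j , j<N , eq with Equivalence.to (BoolP.T-∨ {not (reachB (π ∷ []) N x (iter π i x))}) (All.lookup (AllP.all⁺ _ (allFin N) t) (MemP.∈-allFin (iter π i x)))
  ... | inj₂ le = toWitness le
  ... | inj₁ nr = ⊥-elim (absurd (reachB (π ∷ []) N x (iter π i x)) nr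
                    (subst (λ w → T (reachB (π ∷ []) N x w)) eq (reach-iter π N x j (ℕP.<⇒≤ j<N))))
    where
    absurd : ∀ b → T (not b) → T b → ⊥
    absurd true ()
    absurd false _ ()

classes≤countOrbits : ∀ {N} (E : DecEquiv N) (gs : List (Fin N → Fin N)) →
                      All (λ g → ∀ x → DecEquiv._~_ E x (g x)) gs → classes E ≤ countOrbits gs
classes≤countOrbits {N} E gs inv =
  subst (classes E ≤_) (sym (countOrbits-sum gs))
    (sumℕ-mono (λ x → if-mono (λ t → AllP.all⁻ _ {xs = allFin N} (All.tabulate (λ {y} _ → ok x (T-does (isMin? x) t) y)))))
  where
  open DecEquiv E using (isMin?; IsMin)
  ok : ∀ x → IsMin x → ∀ y → T (not (reachB gs N x y) ∨ ⌊ x Fin.≤? y ⌋)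
  ok x m y with reachB gs N x y in eq
  ... | false = tt
  ... | true  = fromWitness (m y (reach-⊑ E gs inv N x y (subst T (sym eq) tt)))

-- Fixed-point-free involutions built from transpositions

-- The edge involution of a partly drawn map: darts outside the list are fixed, as loose ends, and
-- the head of the list is the newest edge.
swaps : ∀ {N} → List (Fin N × Fin N) → Fin N → Fin N
swaps [] x = x
swaps ((a , b) ∷ L) x with x Fin.≟ a | x Fin.≟ b
... | yes _ | _     = b
... | no _  | yes _ = a
... | no _  | no _  = swaps L x

data Matching {N : ℕ} : List (Fin N × Fin N) → Set where
  []  : Matching []
  add : ∀ {a b L} → a ≢ b → swaps L a ≡ a → swaps L b ≡ b → Matching L → Matching ((a , b) ∷ L)

module _ {N : ℕ} (a b : Fin N) (L : List (Fin N × Fin N)) where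

  swaps-fst : swaps ((a , b) ∷ L) a ≡ b
  swaps-fst with a Fin.≟ a | a Fin.≟ b
  ... | yes _ | _ = refl
  ... | no ¬p | _ = ⊥-elim (¬p refl)

  swaps-snd : a ≢ b → swaps ((a , b) ∷ L) b ≡ a
  swaps-snd a≢b with b Fin.≟ a | b Fin.≟ b
  ... | yes eq | _     = ⊥-elim (a≢b (sym eq))
  ... | no _   | yes _ = refl
  ... | no _   | no ¬p = ⊥-elim (¬p refl)

  swaps-other : ∀ {x} → x ≢ a → x ≢ b → swaps ((a , b) ∷ L) x ≡ swaps L x
  swaps-other {x} x≢a x≢b with x Fin.≟ a | x Fin.≟ b
  ... | yes p | _     = ⊥-elim (x≢a p)
  ... | no _  | yes p = ⊥-elim (x≢b p)
  ... | no _  | no _  = refl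

swaps-involutive : ∀ {N} {L : List (Fin N × Fin N)} → Matching L → ∀ x → swaps L (swaps L x) ≡ x
swaps-involutive [] x = refl
swaps-involutive {L = (a , b) ∷ L} (add a≢b fa fb mt) x with x Fin.≟ a | x Fin.≟ b
... | yes refl | _        = swaps-snd x b L a≢b
... | no _     | yes refl = swaps-fst a x L
... | no x≢a   | no x≢b   = trans (swaps-other a b L (λ eq → x≢a (back fa eq)) (λ eq → x≢b (back fb eq))) (swaps-involutive mt x)
  where
  back : ∀ {y} → swaps L y ≡ y → swaps L x ≡ y → x ≡ y
  back fy eq = trans (sym (swaps-involutive mt x)) (trans (cong (swaps L) eq) fy)

-- On a map of genus zero every circulation is the coboundary of a function on the faces.
module PlanarMap {N : ℕ} (σ σ⁻¹ : Fin N → Fin N)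
                 (right : ∀ x → σ (σ⁻¹ x) ≡ x) (left : ∀ x → σ⁻¹ (σ x) ≡ x) where

  vertices : DecEquiv N
  vertices = orbit σ σ⁻¹ left

  face-left : ∀ {L} → Matching L → ∀ x → swaps L (σ⁻¹ (σ (swaps L x))) ≡ x
  face-left {L} mt x = trans (cong (swaps L) (left _)) (swaps-involutive mt x)

  faces : ∀ {L} → Matching L → DecEquiv N
  faces {L} mt = orbit (σ ∘ swaps L) (swaps L ∘ σ⁻¹) (face-left mt)

  faces-⊑ : ∀ {L} (mt : Matching L) (E : DecEquiv N) → (∀ x → DecEquiv._~_ E x (σ (swaps L x))) → faces mt ⊑ E
  faces-⊑ {L} mt = orbit-⊑ (σ ∘ swaps L) (swaps L ∘ σ⁻¹) (face-left mt)

  components : List (Fin N × Fin N) → DecEquiv N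
  components [] = vertices
  components ((a , b) ∷ L) = glue (components L) a b

  components-σ : ∀ L x → DecEquiv._~_ (components L) x (σ x)
  components-σ [] x = step∈orbit σ σ⁻¹ left x
  components-σ ((a , b) ∷ L) x = ⊑-glue (components L) a b (components-σ L x)

  components-swaps : ∀ L x → DecEquiv._~_ (components L) x (swaps L x)
  components-swaps [] x = DecEquiv.~-refl vertices
  components-swaps ((a , b) ∷ L) x with x Fin.≟ a | x Fin.≟ b
  ... | yes refl | _        = glue-edge (components L) a b
  ... | no _     | yes refl = DecEquiv.~-sym (glue (components L) a b) (glue-edge (components L) a b)
  ... | no _     | no _     = ⊑-glue (components L) a b (components-swaps L x)

  faces⊑components : ∀ {L} (mt : Matching L) → faces mt ⊑ components L
  faces⊑components {L} mt = faces-⊑ mt (components L)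
    (λ x → DecEquiv.~-trans (components L) (components-swaps L x) (components-σ L _))

  module _ {a b : Fin N} {L : List (Fin N × Fin N)} (a≢b : a ≢ b) (fa : swaps L a ≡ a) (fb : swaps L b ≡ b) (mt : Matching L) where
    private
      mt′ : Matching ((a , b) ∷ L)
      mt′ = add a≢b fa fb mt
      φ φ′ : Fin N → Fin N
      φ  = σ ∘ swaps L
      φ′ = σ ∘ swaps ((a , b) ∷ L)
      open DecEquiv (faces mt) using (_~_; _~?_)
      open DecEquiv (faces mt′) using () renaming (_~_ to _~′_; _~?_ to _~′?_; ~-trans to ~′-trans; ~-sym to ~′-sym)

    φ′-fst : φ′ a ≡ φ b
    φ′-fst = cong σ (trans (swaps-fst a b L) (sym fb))

    φ′-snd : φ′ b ≡ φ a
    φ′-snd = cong σ (trans (swaps-snd a b L a≢b) (sym fa))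

    φ′-other : ∀ {x} → x ≢ a → x ≢ b → φ′ x ≡ φ x
    φ′-other x≢a x≢b = cong σ (swaps-other a b L x≢a x≢b)

    -- The new edge changes the face permutation only by exchanging the images of `a` and `b`. Once
    -- `a` and `b` are identified, the old and the new permutation generate the same relation.
    faces-glued : classes (glue (faces mt) a b) ≡ classes (glue (faces mt′) a b)
    faces-glued = classes-cong (glue (faces mt) a b) (glue (faces mt′) a b)
      (glue-⊑ (faces mt) a b (glue (faces mt′) a b) (faces-⊑ mt (glue (faces mt′) a b) to) (glue-edge (faces mt′) a b))
      (glue-⊑ (faces mt′) a b (glue (faces mt) a b) (faces-⊑ mt′ (glue (faces mt) a b) from) (glue-edge (faces mt) a b))
      where
      to : ∀ x → DecEquiv._~_ (glue (faces mt′) a b) x (φ x)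
      to x with x Fin.≟ a | x Fin.≟ b
      ... | yes refl | _        = inj₂ (inj₁ ((0 , refl) , (1 , φ′-snd)))
      ... | no _     | yes refl = inj₂ (inj₂ ((0 , refl) , (1 , φ′-fst)))
      ... | no p     | no q     = inj₁ (1 , φ′-other p q)
      from : ∀ x → DecEquiv._~_ (glue (faces mt) a b) x (φ′ x)
      from x = from′ x (x Fin.≟ a) (x Fin.≟ b)
        where
        from′ : ∀ x → Dec (x ≡ a) → Dec (x ≡ b) → DecEquiv._~_ (glue (faces mt) a b) x (φ′ x)
        from′ x (yes refl) _          = inj₂ (inj₁ ((0 , refl) , (1 , sym φ′-fst)))
        from′ x (no _)     (yes refl) = inj₂ (inj₂ ((0 , refl) , (1 , sym φ′-snd)))
        from′ x (no p)     (no q)     = inj₁ (1 , sym (φ′-other p q))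

    -- A new edge joining two different faces merges them: following the face of a from φ a = φ′ b, one meets a before b.
    faces-merged : ¬ a ~ b → a ~′ b
    faces-merged a≁b with period φ (swaps L ∘ σ⁻¹) (face-left mt) a
    ... | p , _ , per = ~′-sym ([ subst (b ~′_) per , (λ q → q) ]′ (go p))
      where
      go : ∀ i → b ~′ iter φ (suc i) a ⊎ b ~′ a
      go zero = inj₁ (1 , φ′-snd)
      go (suc i) with go i
      ... | inj₂ q = inj₂ q
      ... | inj₁ q with iter φ (suc i) a Fin.≟ a | iter φ (suc i) a Fin.≟ b
      ... | yes eq | _      = inj₂ (subst (b ~′_) eq q)
      ... | no _   | yes eq = ⊥-elim (a≁b (suc i , eq))
      ... | no x≢a | no x≢b = inj₁ (~′-trans q (1 , φ′-other x≢a x≢b))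

    -- The possible effects of a new edge: it joins two components and merges their faces, cuts a
    -- face in two, or stays within a component without creating a face. For `handle` an upper bound
    -- on the faces is enough to refute it in genus zero.
    data Step : Set where
      bridge : ¬ DecEquiv._~_ (components L) a b →
               classes (components L) ≡ suc (classes (components ((a , b) ∷ L))) →
               classes (faces mt) ≡ suc (classes (faces mt′)) → Step
      chord  : a ~ b → ¬ a ~′ b →
               classes (components L) ≡ classes (components ((a , b) ∷ L)) →
               classes (faces mt′) ≡ suc (classes (faces mt)) → Step
      handle : classes (components L) ≡ classes (components ((a , b) ∷ L)) →
               classes (faces mt′) ≤ classes (faces mt) → Step

    merged-count : ¬ a ~ b → classes (faces mt) ≡ suc (classes (faces mt′))
    merged-count a≁b =
      trans (classes-glue-unrelated (faces mt) a b a≁b)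
        (cong suc (trans faces-glued (classes-glue-related (faces mt′) a b (faces-merged a≁b))))

    unchanged : DecEquiv._~_ (components L) a b → classes (components L) ≡ classes (components ((a , b) ∷ L))
    unchanged a~b = sym (classes-glue-related (components L) a b a~b)

    step : Step
    step with DecEquiv._~?_ (components L) a b
    ... | no a≁b = bridge a≁b (classes-glue-unrelated (components L) a b a≁b) (merged-count (a≁b ∘ faces⊑components mt))
    ... | yes a~b with a ~? b | a ~′? b
    ... | no p  | _     = handle (unchanged a~b) (ℕP.≤-trans (ℕP.n≤1+n _) (ℕP.≤-reflexive (sym (merged-count p))))
    ... | yes p | yes q = handle (unchanged a~b) (ℕP.≤-reflexive
            (trans (sym (classes-glue-related (faces mt′) a b q)) (trans (sym faces-glued) (classes-glue-related (faces mt) a b p))))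
    ... | yes p | no q  = chord p q (unchanged a~b)
            (trans (classes-glue-unrelated (faces mt′) a b q) (cong suc (trans (sym faces-glued) (classes-glue-related (faces mt) a b p))))

  -- One half of Euler's formula. The other half, `euler-inequality`, holds in every genus, so here
  -- every added edge must be a bridge or a chord.
  Genus0 : ∀ {L} → Matching L → Set
  Genus0 {L} mt = length L + 2 * classes (components L) ≤ classes vertices + classes (faces mt)

  -- Without edges the vertices, faces and components coincide. A bridge lowers both sides by one, a
  -- chord raises both by one, and a handle raises the right side without raising the left.
  euler-inequality : ∀ {L} (mt : Matching L) → classes vertices + classes (faces mt) ≤ length L + 2 * classes (components L)
  euler-inequality [] =
    ℕP.≤-reflexive (cong (_+_ (classes vertices)) (trans (classes-cong (faces []) vertices
      (faces-⊑ [] vertices (step∈orbit σ σ⁻¹ left))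
      (orbit-⊑ σ σ⁻¹ left (faces []) (λ x → 1 , refl))) (sym (ℕP.+-identityʳ _))))
  euler-inequality {_ ∷ L} (add a≢b fa fb mt) with step a≢b fa fb mt | euler-inequality mt
  ... | bridge _ C F | ih rewrite C | F | ℕP.+-suc (classes vertices) (classes (faces (add a≢b fa fb mt))) =
    ℕP.≤-pred (ℕP.≤-trans ih (ℕP.≤-reflexive (+-2*-suc (length L) _)))
  ... | chord _ _ C F | ih rewrite sym C | F | ℕP.+-suc (classes vertices) (classes (faces mt)) = s≤s ih
  ... | handle C F | ih rewrite sym C = ℕP.≤-trans (ℕP.+-monoʳ-≤ (classes vertices) F) (ℕP.≤-trans ih (ℕP.n≤1+n _))

  -- Kirchhoff's law in dual form: `w` ranges over the functions that are constant on vertices, and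
  -- the indicator of a vertex gives the net flow there.
  Circulation : (Fin N → ℤ) → Set
  Circulation z = ∀ (w : Fin N → ℤ) → (∀ d → w (σ d) ≡ w d) → sumℤ (λ d → w d ℤ.* z d) ≡ 0ℤ

  sum-σ : ∀ (f : Fin N → ℤ) → sumℤ (f ∘ σ) ≡ sumℤ f
  sum-σ f = sym (sumℤ-permute f (permutation σ σ⁻¹ right left))

  coboundary-circulation : ∀ (χ : Fin N → ℤ) → Circulation (λ d → χ (σ d) ℤ.- χ d)
  coboundary-circulation χ w inv =
    trans (sumℤ-cong (λ d → trans (distrib (w d) (χ (σ d)) (χ d)) (cong (λ t → t ℤ.* χ (σ d) ℤ.+ - 1ℤ ℤ.* (w d ℤ.* χ d)) (sym (inv d)))))
      (trans (sumℤ-+ (λ d → w (σ d) ℤ.* χ (σ d)) (λ d → - 1ℤ ℤ.* (w d ℤ.* χ d)))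
        (trans (cong₂ ℤ._+_ (sum-σ (λ d → w d ℤ.* χ d)) (sym (*-sumℤ (- 1ℤ) (λ d → w d ℤ.* χ d))))
          (cancel (sumℤ (λ d → w d ℤ.* χ d)))))
    where
    distrib : ∀ a b c → a ℤ.* (b ℤ.- c) ≡ a ℤ.* b ℤ.+ - 1ℤ ℤ.* (a ℤ.* c)
    distrib = solve-∀
    cancel : ∀ a → a ℤ.+ - 1ℤ ℤ.* a ≡ 0ℤ
    cancel = solve-∀

  circulation-+* : ∀ c {y z : Fin N → ℤ} → Circulation y → Circulation z → Circulation (λ d → y d ℤ.+ c ℤ.* z d)
  circulation-+* c {y} {z} cy cz w inv =
    trans (sumℤ-cong (λ d → distrib (w d) (y d) (z d) c))
      (trans (sumℤ-+ (λ d → w d ℤ.* y d) (λ d → c ℤ.* (w d ℤ.* z d)))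
        (trans (cong₂ ℤ._+_ (cy w inv) (trans (sym (*-sumℤ c (λ d → w d ℤ.* z d))) (cong (ℤ._*_ c) (cz w inv))))
          (zero′ c)))
    where
    distrib : ∀ a b c k → a ℤ.* (b ℤ.+ k ℤ.* c) ≡ a ℤ.* b ℤ.+ k ℤ.* (a ℤ.* c)
    distrib = solve-∀
    zero′ : ∀ c → 0ℤ ℤ.+ c ℤ.* 0ℤ ≡ 0ℤ
    zero′ = solve-∀

  circulation-cong : ∀ {y z : Fin N → ℤ} → (∀ d → y d ≡ z d) → Circulation y → Circulation z
  circulation-cong eq cy w inv = trans (sumℤ-cong (λ d → cong (ℤ._*_ (w d)) (sym (eq d)))) (cy w inv)

  Antisymmetric : List (Fin N × Fin N) → (Fin N → ℤ) → Set
  Antisymmetric L z = ∀ d → z (swaps L d) ≡ - z d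

  -- A height on the faces, stored on darts: the orbits of `σ ∘ swaps L` are the faces, and the two
  -- darts of an edge belong to its two sides.
  record Potential (L : List (Fin N × Fin N)) (z : Fin N → ℤ) : Set where
    field
      χ        : Fin N → ℤ
      face     : ∀ d → χ (σ (swaps L d)) ≡ χ d
      gradient : ∀ d → χ (swaps L d) ≡ χ d ℤ.+ z d

  invariant-along : ∀ (π : Fin N → Fin N) (χ : Fin N → ℤ) → (∀ d → χ (π d) ≡ χ d) → ∀ {x y} → (∃ λ i → iter π i x ≡ y) → χ y ≡ χ x
  invariant-along π χ inv (zero , refl)  = refl
  invariant-along π χ inv (suc i , refl) = trans (inv _) (invariant-along π χ inv (i , refl))

  module _ {a b : Fin N} {L : List (Fin N × Fin N)} (a≢b : a ≢ b) (fa : swaps L a ≡ a) (fb : swaps L b ≡ b) (mt : Matching L) where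
    private
      L′ : List (Fin N × Fin N)
      L′ = (a , b) ∷ L
      mt′ : Matching L′
      mt′ = add a≢b fa fb mt

    antisymmetric-restrict : ∀ {z} → Antisymmetric L′ z → z a ≡ 0ℤ → Antisymmetric L z
    antisymmetric-restrict {z} anti za d with d Fin.≟ a | d Fin.≟ b
    ... | yes refl | _ = trans (cong z fa) (trans za (cong -_ (sym za)))
    ... | no _ | yes refl = trans (cong z fb) (trans zb (cong -_ (sym zb)))
      where zb = trans (cong z (sym (swaps-fst a d L))) (trans (anti a) (cong -_ za))
    ... | no p | no q = trans (cong z (sym (swaps-other a b L p q))) (anti d)

    -- An edge without flow demands only equal heights at its two darts. The new face permutation
    -- exchanges the images of `a` and `b`, which such a height does not notice.
    potential-extend : ∀ {z} → Antisymmetric L′ z → z a ≡ 0ℤ →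
      (pot : Potential L z) → Potential.χ pot a ≡ Potential.χ pot b → Potential L′ z
    potential-extend {z} anti za pot χab = record { χ = χ ; face = face′ ; gradient = gradient′ }
      where
      open Potential pot
      flat : ∀ {x y} → χ y ≡ χ x → z x ≡ 0ℤ → χ y ≡ χ x ℤ.+ z x
      flat {x} eq zx = trans eq (sym (trans (cong (ℤ._+_ (χ x)) zx) (ℤP.+-identityʳ (χ x))))
      face′ : ∀ d → χ (σ (swaps L′ d)) ≡ χ d
      face′ d with d Fin.≟ a | d Fin.≟ b
      ... | yes refl | _        = trans (cong (χ ∘ σ) (sym fb)) (trans (face b) (sym χab))
      ... | no _     | yes refl = trans (cong (χ ∘ σ) (sym fa)) (trans (face a) χab)
      ... | no _     | no _     = face d
      gradient′ : ∀ d → χ (swaps L′ d) ≡ χ d ℤ.+ z d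
      gradient′ d with d Fin.≟ a | d Fin.≟ b
      ... | yes refl | _        = flat (sym χab) za
      ... | no _     | yes refl = flat χab (trans (cong z (sym (swaps-fst a d L))) (trans (anti a) (cong -_ za)))
      ... | no _     | no _     = gradient d

    -- The flow through a bridge vanishes, since nothing else leaves the component of a.
    bridge-flow : ∀ {z} → ¬ DecEquiv._~_ (components L) a b → Antisymmetric L′ z → Circulation z → z a ≡ 0ℤ
    bridge-flow {z} a≁b anti circ =
      trans (sym total) (circ w (λ d → w-cong (~-sym (components-σ L d))))
      where
      open DecEquiv (components L)
      -- `w` is the indicator of the old component of `a`, and `y` is the product of `w` and `z`
      -- with both ends of the new edge deleted. The old edges make `y` antisymmetric, so it sums to
      -- zero; testing `z` against `w` then leaves `z a` alone.
      w y : Fin N → ℤ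
      w d = + ind (a ~? d)
      w-cong : ∀ {c d} → c ~ d → w c ≡ w d
      w-cong {c} {d} c~d = cong +_ (ind-⇔ (a ~? c) (a ~? d) (λ p → ~-trans p c~d) (λ p → ~-trans p (~-sym c~d)))
      wa : w a ≡ 1ℤ
      wa = cong +_ (ind-yes (a ~? a) ~-refl)
      wb : w b ≡ 0ℤ
      wb = cong +_ (ind-no (a ~? b) a≁b)
      y d with d Fin.≟ a | d Fin.≟ b
      ... | yes _ | _     = 0ℤ
      ... | no _  | yes _ = 0ℤ
      ... | no _  | no _  = w d ℤ.* z d
      at-a : Fin N → ℤ
      at-a d = + ind (d Fin.≟ a) ℤ.* z a
      y-a : y a ≡ 0ℤ
      y-a with a Fin.≟ a | a Fin.≟ b
      ... | yes _ | _ = refl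
      ... | no ¬p | _ = ⊥-elim (¬p refl)
      y-b : y b ≡ 0ℤ
      y-b with b Fin.≟ a | b Fin.≟ b
      ... | yes _ | _     = refl
      ... | no _  | yes _ = refl
      ... | no _  | no ¬p = ⊥-elim (¬p refl)
      y-anti : ∀ d → y (swaps L d) ≡ - y d
      y-anti d with d Fin.≟ a | d Fin.≟ b
      ... | yes refl | _ = trans (cong y fa) y-a
      ... | no _ | yes refl = trans (cong y fb) y-b
      ... | no d≢a | no d≢b with swaps L d Fin.≟ a | swaps L d Fin.≟ b
      ... | yes eq | _      = ⊥-elim (d≢a (trans (sym (swaps-involutive mt d)) (trans (cong (swaps L) eq) fa)))
      ... | no _   | yes eq = ⊥-elim (d≢b (trans (sym (swaps-involutive mt d)) (trans (cong (swaps L) eq) fb)))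
      ... | no _   | no _   =
        trans (cong₂ ℤ._*_ (w-cong (~-sym (components-swaps L d)))
                           (trans (cong z (sym (swaps-other a b L d≢a d≢b))) (anti d)))
              (sym (ℤP.neg-distribʳ-* (w d) (z d)))
      sum-y : sumℤ y ≡ 0ℤ
      sum-y = self-negative _
        (trans (sumℤ-permute y (permutation (swaps L) (swaps L) (swaps-involutive mt) (swaps-involutive mt)))
          (trans (sumℤ-cong (λ d → trans (y-anti d) (sym (ℤP.-1*i≡-i (y d)))))
            (trans (sym (*-sumℤ (- 1ℤ) y)) (ℤP.-1*i≡-i (sumℤ y)))))
      split : ∀ d → w d ℤ.* z d ≡ at-a d ℤ.+ y d
      split d with d Fin.≟ a | d Fin.≟ b
      ... | yes refl | _ = trans (cong (ℤ._* z a) wa) (sym (ℤP.+-identityʳ _))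
      ... | no _ | yes refl = cong (ℤ._* z b) wb
      ... | no _ | no _ = sym (ℤP.+-identityˡ _)
      total : sumℤ (λ d → w d ℤ.* z d) ≡ z a
      total = trans (sumℤ-cong split) (trans (sumℤ-+ at-a y)
        (trans (cong₂ ℤ._+_ (trans (sumℤ-single a (λ d d≢a → cong (λ t → + t ℤ.* z a) (ind-no (d Fin.≟ a) d≢a)))
                 (trans (cong (λ t → + t ℤ.* z a) (ind-yes (a Fin.≟ a) refl)) (ℤP.*-identityˡ (z a)))) sum-y)
          (ℤP.+-identityʳ _)))

  potential-shift : ∀ {L z} (w : Fin N → ℤ) → (∀ d → w (σ d) ≡ w d) → (∀ d → w (swaps L d) ≡ w d) → Potential L z → Potential L z
  potential-shift {L} {z} w wσ wα pot = record
    { χ = λ d → χ d ℤ.+ w d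
    ; face = λ d → cong₂ ℤ._+_ (face d) (trans (wσ _) (wα d))
    ; gradient = λ d → trans (cong₂ ℤ._+_ (gradient d) (wα d)) (exchange (χ d) (z d) (w d)) }
    where
    open Potential pot
    exchange : ∀ a b c → a ℤ.+ b ℤ.+ c ≡ a ℤ.+ c ℤ.+ b
    exchange = solve-∀

  -- The newest edge is freed of its flow and removed. A bridge carries none, and the heights on one
  -- side are shifted until they agree at its ends. For a chord a multiple of the circulation around
  -- one of the two new faces is added first and undone afterwards.
  potential : ∀ {L} (mt : Matching L) → Genus0 mt → ∀ z → Antisymmetric L z → Circulation z → Potential L z
  potential [] _ z anti _ = record
    { χ = λ _ → 0ℤ ; face = λ _ → refl
    ; gradient = λ d → sym (trans (ℤP.+-identityˡ (z d)) (self-negative (z d) (anti d))) }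
  potential {(a , b) ∷ L} (add a≢b fa fb mt) tight z anti circ with step a≢b fa fb mt
  ... | handle C F = ⊥-elim (ℕP.<-irrefl refl
        (ℕP.≤-trans (subst (λ c → suc (length L + 2 * c) ≤ _) (sym C) tight)
          (ℕP.≤-trans (ℕP.+-monoʳ-≤ (classes vertices) F) (euler-inequality mt))))
  ... | bridge a≁b C F = potential-extend a≢b fa fb mt anti za
          (potential-shift w (λ d → w-cong (~-sym (components-σ L d))) (λ d → w-cong (~-sym (components-swaps L d))) pot)
          (trans (cong (λ t → χ a ℤ.+ (χ b ℤ.- χ a) ℤ.* + t) (ind-yes (a ~? a) ~-refl))
            (trans (level (χ a) (χ b)) (cong (λ t → χ b ℤ.+ (χ b ℤ.- χ a) ℤ.* + t) (sym (ind-no (a ~? b) a≁b)))))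
    where
    open DecEquiv (components L) hiding (classes)
    za : z a ≡ 0ℤ
    za = bridge-flow a≢b fa fb mt a≁b anti circ
    tight′ : Genus0 mt
    tight′ rewrite C | F | ℕP.+-suc (classes vertices) (classes (faces (add a≢b fa fb mt))) =
      ℕP.≤-trans (ℕP.≤-reflexive (+-2*-suc (length L) _)) (s≤s tight)
    pot = potential mt tight′ z (antisymmetric-restrict a≢b fa fb mt anti za) circ
    open Potential pot using (χ)
    w : Fin N → ℤ
    w d = (χ b ℤ.- χ a) ℤ.* + ind (a ~? d)
    w-cong : ∀ {c d} → c ~ d → w c ≡ w d
    w-cong {c} {d} c~d = cong (λ t → (χ b ℤ.- χ a) ℤ.* + t)
      (ind-⇔ (a ~? c) (a ~? d) (λ p → ~-trans p c~d) (λ p → ~-trans p (~-sym c~d)))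
    level : ∀ x y → x ℤ.+ (y ℤ.- x) ℤ.* 1ℤ ≡ y ℤ.+ (y ℤ.- x) ℤ.* 0ℤ
    level = solve-∀
  ... | chord a~b a≁b C F = record
    { χ = λ d → χ d ℤ.- z a ℤ.* f d
    ; face = λ d → cong₂ (λ s t → s ℤ.- z a ℤ.* t) (face d) (f-face d)
    ; gradient = λ d → trans (cong (λ s → s ℤ.- z a ℤ.* f (swaps L′ d)) (gradient d)) (undo (χ d) (z d) (z a) (f (swaps L′ d)) (f d)) }
    where
    L′ = (a , b) ∷ L
    mt′ = add a≢b fa fb mt
    open DecEquiv (faces mt′) hiding (classes)
    -- The indicator of the new face at `a`. The dart `b` lies on the other new face, so `f` drops
    -- by one from `a` to `b`, and adding `z a` times its coboundary cancels the flow through the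
    -- new edge.
    f : Fin N → ℤ
    f d = + ind (a ~? d)
    f-face : ∀ d → f (σ (swaps L′ d)) ≡ f d
    f-face d = cong +_ (ind-⇔ (a ~? σ (swaps L′ d)) (a ~? d) (λ p → ~-trans p (~-sym (1 , refl))) (λ p → ~-trans p (1 , refl)))
    z′ : Fin N → ℤ
    z′ d = z d ℤ.+ z a ℤ.* (f (swaps L′ d) ℤ.- f d)
    -- As `f` is constant on faces, `f (swaps L′ d)` equals `f (σ d)`: the change across an edge is
    -- a change around a vertex, and those changes telescope.
    circ′ : Circulation z′
    circ′ = circulation-+* (z a) circ (circulation-cong (λ d → cong (ℤ._- f d)
              (trans (cong (f ∘ σ) (sym (swaps-involutive mt′ d))) (f-face (swaps L′ d)))) (coboundary-circulation f))
    anti′ : Antisymmetric L′ z′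
    anti′ d = trans (cong₂ (λ s t → s ℤ.+ z a ℤ.* (t ℤ.- f (swaps L′ d))) (anti d) (cong f (swaps-involutive mt′ d)))
                (flip (z d) (z a) (f d) (f (swaps L′ d)))
      where
      flip : ∀ x c s t → - x ℤ.+ c ℤ.* (s ℤ.- t) ≡ - (x ℤ.+ c ℤ.* (t ℤ.- s))
      flip = solve-∀
    z′a : z′ a ≡ 0ℤ
    z′a = trans (cong₂ (λ s t → z a ℤ.+ z a ℤ.* (s ℤ.- t))
                  (trans (cong f (swaps-fst a b L)) (cong +_ (ind-no (a ~? b) a≁b)))
                  (cong +_ (ind-yes (a ~? a) ~-refl)))
                (vanish (z a))
      where
      vanish : ∀ c → c ℤ.+ c ℤ.* (0ℤ ℤ.- 1ℤ) ≡ 0ℤ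
      vanish = solve-∀
    tight′ : Genus0 mt
    tight′ = ℕP.≤-pred (subst₂ _≤_ (cong (λ c → suc (length L + 2 * c)) (sym C))
               (trans (cong (_+_ (classes vertices)) F) (ℕP.+-suc (classes vertices) (classes (faces mt)))) tight)
    pot₀ = potential mt tight′ z′ (antisymmetric-restrict a≢b fa fb mt anti′ z′a) circ′
    pot : Potential L′ z′
    pot = potential-extend a≢b fa fb mt anti′ z′a pot₀
            (sym (invariant-along (σ ∘ swaps L) (Potential.χ pot₀) (Potential.face pot₀) a~b))
    open Potential pot using (χ; face; gradient)
    undo : ∀ x y c s t → x ℤ.+ (y ℤ.+ c ℤ.* (s ℤ.- t)) ℤ.- c ℤ.* s ≡ x ℤ.- c ℤ.* t ℤ.+ y
    undo = solve-∀

-- Prefix sums along the boundary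

prefix : ∀ {n} → (Fin n → ℤ) → ℕ → ℤ
prefix g x = sumℤ (λ i → + ind (toℕ i <? x) ℤ.* g i)

prefix-zero : ∀ {n} (g : Fin n → ℤ) → prefix g 0 ≡ 0ℤ
prefix-zero g = sumℤ-zero (λ i → cong (λ t → + t ℤ.* g i) (ind-no (toℕ i <? 0) (λ ())))

prefix-suc : ∀ {n} (g : Fin n → ℤ) i → prefix g (suc (toℕ i)) ≡ prefix g (toℕ i) ℤ.+ g i
prefix-suc g i =
  trans (sumℤ-cong split)
    (trans (sumℤ-+ (λ j → + ind (toℕ j <? toℕ i) ℤ.* g j) (λ j → + ind (j Fin.≟ i) ℤ.* g j))
      (cong (ℤ._+_ (prefix g (toℕ i)))
        (trans (sumℤ-single i (λ j j≢i → cong (λ t → + t ℤ.* g j) (ind-no (j Fin.≟ i) j≢i)))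
          (trans (cong (λ t → + t ℤ.* g i) (ind-yes (i Fin.≟ i) refl)) (ℤP.*-identityˡ (g i))))))
  where
  split : ∀ j → + ind (toℕ j <? suc (toℕ i)) ℤ.* g j ≡ + ind (toℕ j <? toℕ i) ℤ.* g j ℤ.+ + ind (j Fin.≟ i) ℤ.* g j
  split j = trans (cong (λ t → + t ℤ.* g j) count)
              (trans (cong (ℤ._* g j) (ℤP.pos-+ (ind (toℕ j <? toℕ i)) (ind (j Fin.≟ i)))) (ℤP.*-distribʳ-+ (g j) (+ ind (toℕ j <? toℕ i)) (+ ind (j Fin.≟ i))))
    where
    count : ind (toℕ j <? suc (toℕ i)) ≡ ind (toℕ j <? toℕ i) + ind (j Fin.≟ i)
    count with FinP.<-cmp j i
    ... | tri< lt ne _ = trans (ind-yes (toℕ j <? suc (toℕ i)) (ℕP.m<n⇒m<1+n lt))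
                           (sym (cong₂ _+_ (ind-yes (toℕ j <? toℕ i) lt) (ind-no (j Fin.≟ i) ne)))
    ... | tri≈ nlt refl _ = trans (ind-yes (toℕ j <? suc (toℕ j)) ℕP.≤-refl)
                           (sym (cong₂ _+_ (ind-no (toℕ j <? toℕ j) nlt) (ind-yes (j Fin.≟ j) refl)))
    ... | tri> nlt ne gt = trans (ind-no (toℕ j <? suc (toℕ i)) (λ lt → ℕP.<⇒≱ gt (ℕP.≤-pred lt)))
                           (sym (cong₂ _+_ (ind-no (toℕ j <? toℕ i) nlt) (ind-no (j Fin.≟ i) ne)))

cpred-suc : ∀ {p} (r r′ : Fin p) → toℕ r ≡ suc (toℕ r′) → cpred r ≡ r′
cpred-suc (suc r) r′ eq = FinP.toℕ-injective (trans (FinP.toℕ-inject₁ r) (ℕP.suc-injective eq))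

cpred-zero : ∀ {p} (r r′ : Fin p) → toℕ r ≡ 0 → suc (toℕ r′) ≡ p → cpred r ≡ r′
cpred-zero {suc p} zero r′ _ eq = FinP.toℕ-injective (trans (FinP.toℕ-fromℕ p) (ℕP.suc-injective (sym eq)))

-- `cpred` leads from each source to the previous one, from the first source to the first sink, and
-- from each sink to the next; `X₀` is read at the first sink. A height belongs to the corner before
-- its dart, so the edge of source `i` lies between that corner and `X₀` while the edge of sink `j`
-- does not: hence `suc (toℕ i)` against `toℕ j`.
boundary-heights : ∀ {n} (X ζ : Fin (n + n) → ℤ) → (∀ r → X (cpred r) ≡ X r ℤ.+ ζ r) →
  ∃ λ X₀ → (∀ i → X (i ↑ˡ n) ≡ X₀ ℤ.- prefix (λ i → ζ (i ↑ˡ n)) (suc (toℕ i)))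
         × (∀ j → X (n ↑ʳ opposite j) ≡ X₀ ℤ.+ prefix (λ j → ζ (n ↑ʳ opposite j)) (toℕ j))
boundary-heights {zero} X ζ rec = 0ℤ , (λ ()) , (λ ())
boundary-heights {suc n} X ζ rec = X₀ , (λ i → up (toℕ i) i refl) , (λ j → down (toℕ j) j refl)
  where
  X₀ = X (suc n ↑ʳ opposite zero)
  g h : Fin (suc n) → ℤ
  g i = ζ (i ↑ˡ suc n)
  h j = ζ (suc n ↑ʳ opposite j)
  move : ∀ {a b c : ℤ} → a ≡ b ℤ.+ c → b ≡ a ℤ.- c
  move {a} {b} {c} eq = sym (trans (cong (ℤ._- c) eq) (cancel b c))
    where
    cancel : ∀ b c → b ℤ.+ c ℤ.- c ≡ b
    cancel = solve-∀
  regroup : ∀ a b c → a ℤ.- b ℤ.- c ≡ a ℤ.- (b ℤ.+ c)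
  regroup = solve-∀
  up : ∀ x i → toℕ i ≡ x → X (i ↑ˡ suc n) ≡ X₀ ℤ.- prefix g (suc (toℕ i))
  up zero i eq = trans (move (trans (cong X (sym first)) (rec (i ↑ˡ suc n))))
                   (cong (ℤ._-_ X₀) (sym (trans (prefix-suc g i)
                     (trans (cong (ℤ._+ g i) (trans (cong (prefix g) eq) (prefix-zero g))) (ℤP.+-identityˡ (g i))))))
    where
    first : cpred (i ↑ˡ suc n) ≡ suc n ↑ʳ opposite zero
    first = cpred-zero _ _ (trans (FinP.toℕ-↑ˡ i (suc n)) eq)
              (cong suc (trans (FinP.toℕ-↑ʳ (suc n) (fromℕ n)) (trans (cong (_+_ (suc n)) (FinP.toℕ-fromℕ n)) (sym (ℕP.+-suc n n)))))
  up (suc x) i eq = trans (move (trans (cong X (sym prev)) (rec (i ↑ˡ suc n))))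
                   (trans (cong (ℤ._- g i) (up x i′ toi′)) (trans (regroup X₀ (prefix g (suc (toℕ i′))) (g i))
                     (cong (ℤ._-_ X₀) (trans (cong (λ t → prefix g t ℤ.+ g i) (trans (cong suc toi′) (sym eq))) (sym (prefix-suc g i))))))
    where
    x<n : x < suc n
    x<n = ℕP.<-trans (ℕP.≤-reflexive (sym eq)) (FinP.toℕ<n i)
    i′ = fromℕ< x<n
    toi′ : toℕ i′ ≡ x
    toi′ = FinP.toℕ-fromℕ< x<n
    prev : cpred (i ↑ˡ suc n) ≡ i′ ↑ˡ suc n
    prev = cpred-suc _ _ (trans (FinP.toℕ-↑ˡ i (suc n)) (trans eq (cong suc (sym (trans (FinP.toℕ-↑ˡ i′ (suc n)) toi′)))))
  down : ∀ y j → toℕ j ≡ y → X (suc n ↑ʳ opposite j) ≡ X₀ ℤ.+ prefix h (toℕ j)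
  down zero zero eq = sym (trans (cong (ℤ._+_ X₀) (prefix-zero h)) (ℤP.+-identityʳ X₀))
  down (suc y) j eq = trans (cong X (sym prev)) (trans (rec (suc n ↑ʳ opposite j′))
                   (trans (cong (ℤ._+ h j′) (down y j′ toj′)) (trans (ℤP.+-assoc X₀ (prefix h (toℕ j′)) (h j′))
                     (cong (ℤ._+_ X₀) (trans (sym (prefix-suc h j′)) (cong (prefix h) (trans (cong suc toj′) (sym eq))))))))
    where
    y<n : y < suc n
    y<n = ℕP.<-trans (ℕP.≤-reflexive (sym eq)) (FinP.toℕ<n j)
    j′ = fromℕ< y<n
    toj′ : toℕ j′ ≡ y
    toj′ = FinP.toℕ-fromℕ< y<n
    opp : toℕ (opposite j′) ≡ suc (toℕ (opposite j))
    opp = trans (FinP.opposite-prop j′) (trans (cong (n ∸_) toj′)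
            (trans (sym (ℕP.suc-pred (n ∸ y) {{ℕ.≢-nonZero (ℕP.m>n⇒m∸n≢0 (ℕP.≤-pred (subst (_< suc n) eq (FinP.toℕ<n j))))}}))
              (cong suc (trans (ℕP.pred[m∸n]≡m∸[1+n] n y) (trans (cong (n ∸_) (sym eq)) (sym (FinP.opposite-prop j)))))))
    prev : cpred (suc n ↑ʳ opposite j′) ≡ suc n ↑ʳ opposite j
    prev = cpred-suc _ _ (trans (FinP.toℕ-↑ʳ (suc n) (opposite j′)) (trans (cong (_+_ (suc n)) opp)
             (trans (ℕP.+-suc (suc n) _) (cong suc (sym (FinP.toℕ-↑ʳ (suc n) (opposite j)))))))

-- The involution exchanging the two ends of each edge

↑ˡ≢↑ʳ : ∀ {K} (e e′ : Fin K) → e ↑ˡ K ≢ K ↑ʳ e′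
↑ˡ≢↑ʳ {K} e e′ eq with trans (sym (FinP.splitAt-↑ˡ K e K)) (trans (cong (splitAt K) eq) (FinP.splitAt-↑ʳ K K e′))
... | ()

edgePairs : ∀ {j K} → (Fin j → Fin K) → List (Fin (K + K) × Fin (K + K))
edgePairs {K = K} g = tabulate (λ i → g i ↑ˡ K , K ↑ʳ g i)

module _ {K : ℕ} where

  swaps-outside : ∀ {j} (g : Fin j → Fin K) d → (∀ i → d ≢ g i ↑ˡ K) → (∀ i → d ≢ K ↑ʳ g i) → swaps (edgePairs g) d ≡ d
  swaps-outside {zero}  g d p q = refl
  swaps-outside {suc j} g d p q = trans (swaps-other _ _ (edgePairs (g ∘ suc)) (p zero) (q zero)) (swaps-outside (g ∘ suc) d (p ∘ suc) (q ∘ suc))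

  module _ {j : ℕ} (g : Fin (suc j) → Fin K) (inj : ∀ {i i′} → g i ≡ g i′ → i ≡ i′) where

    fresh : ∀ i → g zero ≢ g (suc i)
    fresh i eq with inj eq
    ... | ()

  matching-edgePairs : ∀ {j} (g : Fin j → Fin K) → (∀ {i i′} → g i ≡ g i′ → i ≡ i′) → Matching (edgePairs g)
  matching-edgePairs {zero}  g inj = []
  matching-edgePairs {suc j} g inj = add (↑ˡ≢↑ʳ _ _)
    (swaps-outside (g ∘ suc) _ (λ i eq → fresh g inj i (FinP.↑ˡ-injective K _ _ eq)) (λ i → ↑ˡ≢↑ʳ _ _))
    (swaps-outside (g ∘ suc) _ (λ i eq → ↑ˡ≢↑ʳ _ _ (sym eq)) (λ i eq → fresh g inj i (FinP.↑ʳ-injective K _ _ eq)))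
    (matching-edgePairs (g ∘ suc) (FinP.suc-injective ∘ inj))

  swaps-↑ˡ : ∀ {j} (g : Fin j → Fin K) → (∀ {i i′} → g i ≡ g i′ → i ≡ i′) → ∀ i → swaps (edgePairs g) (g i ↑ˡ K) ≡ K ↑ʳ g i
  swaps-↑ˡ g inj zero = swaps-fst (g zero ↑ˡ K) (K ↑ʳ g zero) (edgePairs (g ∘ suc))
  swaps-↑ˡ g inj (suc i) =
    trans (swaps-other _ _ (edgePairs (g ∘ suc)) (λ eq → fresh g inj i (sym (FinP.↑ˡ-injective K _ _ eq))) (↑ˡ≢↑ʳ _ _))
          (swaps-↑ˡ (g ∘ suc) (FinP.suc-injective ∘ inj) i)

join-view : ∀ K {K′} (d : Fin (K + K′)) → (∃ λ e → d ≡ e ↑ˡ K′) ⊎ (∃ λ e → d ≡ K ↑ʳ e)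
join-view K {K′} d with splitAt K d in eq
... | inj₁ e = inj₁ (e , trans (sym (FinP.join-splitAt K K′ d)) (cong (join K K′) eq))
... | inj₂ e = inj₂ (e , trans (sym (FinP.join-splitAt K K′ d)) (cong (join K K′) eq))

*-ind : ∀ {A : Set} (d : Dec A) {x y : ℤ} → (A → x ≡ y) → + ind d ℤ.* x ≡ + ind d ℤ.* y
*-ind (yes a) f = cong (ℤ._*_ 1ℤ) (f a)
*-ind (no _)  f = refl

-- Edges of the augmented graph, oriented from ∞ to the sources and from the sinks to ∞.
module Augmented {n : ℕ} (Γ : Network n) where
  open Network Γ public

  E : ℕ
  E = M Γ

  V∞ : Set
  V∞ = Fin (suc v)

  arc : Fin m → Fin E
  arc e = e ↑ˡ (n + n)

  -- The boundary lists the sinks from last to first, hence `opposite`.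
  inlet outlet : Fin n → Fin E
  inlet i  = m ↑ʳ (i ↑ˡ n)
  outlet j = m ↑ʳ (n ↑ʳ opposite j)

  kind : Fin E → Fin m ⊎ (Fin n ⊎ Fin n)
  kind e = [ inj₁ , (λ r → [ (λ i → inj₂ (inj₁ i)) , (λ j → inj₂ (inj₂ (opposite j))) ]′ (splitAt n r)) ]′ (splitAt m e)

  kind-arc : ∀ e → kind (arc e) ≡ inj₁ e
  kind-arc e rewrite FinP.splitAt-↑ˡ m e (n + n) = refl

  kind-inlet : ∀ i → kind (inlet i) ≡ inj₂ (inj₁ i)
  kind-inlet i rewrite FinP.splitAt-↑ʳ m (n + n) (i ↑ˡ n) | FinP.splitAt-↑ˡ n i n = refl

  kind-outlet : ∀ j → kind (outlet j) ≡ inj₂ (inj₂ j)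
  kind-outlet j rewrite FinP.splitAt-↑ʳ m (n + n) (n ↑ʳ opposite j) | FinP.splitAt-↑ʳ n n (opposite j) | FinP.opposite-involutive j = refl

  data Kind : Fin E → Set where
    is-arc    : ∀ e → Kind (arc e)
    is-inlet  : ∀ i → Kind (inlet i)
    is-outlet : ∀ j → Kind (outlet j)

  kind-view : ∀ e → Kind e
  kind-view e with join-view m e
  ... | inj₁ (e′ , refl) = is-arc e′
  ... | inj₂ (r , refl) with join-view n r
  ... | inj₁ (i , refl) = is-inlet i
  ... | inj₂ (j , refl) = subst (λ t → Kind (m ↑ʳ (n ↑ʳ t))) (FinP.opposite-involutive j) (is-outlet (opposite j))

  from to : Fin E → V∞
  from e = [ suc ∘ tail , [ (λ _ → zero) , suc ∘ snk ]′ ]′ (kind e)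
  to   e = [ suc ∘ head , [ suc ∘ src , (λ _ → zero) ]′ ]′ (kind e)

  -- The first end of an apex edge is always ∞. Outlets are directed into ∞, so for them the two
  -- darts, and the sign in `signed`, are reversed.
  out-dart in-dart : Fin E → Dart Γ
  out-dart e = [ (λ _ → e ↑ˡ E) , [ (λ _ → e ↑ˡ E) , (λ _ → E ↑ʳ e) ]′ ]′ (kind e)
  in-dart  e = [ (λ _ → E ↑ʳ e) , [ (λ _ → E ↑ʳ e) , (λ _ → e ↑ˡ E) ]′ ]′ (kind e)

  signed : (Fin E → ℤ) → Fin E → ℤ
  signed f e = [ (λ _ → f e) , [ (λ _ → f e) , (λ _ → - f e) ]′ ]′ (kind e)

  dart-flow : (Fin E → ℤ) → Dart Γ → ℤ
  dart-flow f d = [ signed f , -_ ∘ signed f ]′ (splitAt E d)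

  dart-flow-↑ˡ : ∀ f e → dart-flow f (e ↑ˡ E) ≡ signed f e
  dart-flow-↑ˡ f e rewrite FinP.splitAt-↑ˡ E e E = refl

  dart-flow-↑ʳ : ∀ f e → dart-flow f (E ↑ʳ e) ≡ - signed f e
  dart-flow-↑ʳ f e rewrite FinP.splitAt-↑ʳ E E e = refl

  dart-flow-out : ∀ f e → dart-flow f (out-dart e) ≡ f e
  dart-flow-out f e with kind e in eq
  ... | inj₁ _        = trans (dart-flow-↑ˡ f e) (cong [ _ , _ ]′ eq)
  ... | inj₂ (inj₁ _) = trans (dart-flow-↑ˡ f e) (cong [ _ , _ ]′ eq)
  ... | inj₂ (inj₂ _) = trans (dart-flow-↑ʳ f e) (trans (cong -_ (cong [ _ , _ ]′ eq)) (ℤP.neg-involutive (f e)))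

  dart-flow-in : ∀ f e → dart-flow f (in-dart e) ≡ - f e
  dart-flow-in f e with kind e in eq
  ... | inj₁ _        = trans (dart-flow-↑ʳ f e) (cong -_ (cong [ _ , _ ]′ eq))
  ... | inj₂ (inj₁ _) = trans (dart-flow-↑ʳ f e) (cong -_ (cong [ _ , _ ]′ eq))
  ... | inj₂ (inj₂ _) = trans (dart-flow-↑ˡ f e) (cong [ _ , _ ]′ eq)

  α-↑ˡ : ∀ e → α Γ (e ↑ˡ E) ≡ E ↑ʳ e
  α-↑ˡ e rewrite FinP.splitAt-↑ˡ E e E = refl

  α-↑ʳ : ∀ e → α Γ (E ↑ʳ e) ≡ e ↑ˡ E
  α-↑ʳ e rewrite FinP.splitAt-↑ʳ E E e = refl

  α-out : ∀ e → α Γ (out-dart e) ≡ in-dart e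
  α-out e with kind e
  ... | inj₁ _        = α-↑ˡ e
  ... | inj₂ (inj₁ _) = α-↑ˡ e
  ... | inj₂ (inj₂ _) = α-↑ʳ e

  α-in : ∀ e → α Γ (in-dart e) ≡ out-dart e
  α-in e with kind e
  ... | inj₁ _        = α-↑ʳ e
  ... | inj₂ (inj₁ _) = α-↑ʳ e
  ... | inj₂ (inj₂ _) = α-↑ˡ e

  dart-view : ∀ d → (∃ λ e → d ≡ out-dart e) ⊎ (∃ λ e → d ≡ in-dart e)
  dart-view d with join-view E d
  ... | inj₁ (e , refl) = left e
    where
    left : ∀ e → (∃ λ e′ → e ↑ˡ E ≡ out-dart e′) ⊎ (∃ λ e′ → e ↑ˡ E ≡ in-dart e′)
    left e with kind e in eq
    ... | inj₁ _        = inj₁ (e , sym (cong [ _ , _ ]′ eq))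
    ... | inj₂ (inj₁ _) = inj₁ (e , sym (cong [ _ , _ ]′ eq))
    ... | inj₂ (inj₂ _) = inj₂ (e , sym (cong [ _ , _ ]′ eq))
  ... | inj₂ (e , refl) = right e
    where
    right : ∀ e → (∃ λ e′ → E ↑ʳ e ≡ out-dart e′) ⊎ (∃ λ e′ → E ↑ʳ e ≡ in-dart e′)
    right e with kind e in eq
    ... | inj₁ _        = inj₂ (e , sym (cong [ _ , _ ]′ eq))
    ... | inj₂ (inj₁ _) = inj₂ (e , sym (cong [ _ , _ ]′ eq))
    ... | inj₂ (inj₂ _) = inj₁ (e , sym (cong [ _ , _ ]′ eq))

  sum-darts : ∀ (F : Dart Γ → ℤ) → sumℤ F ≡ sumℤ (F ∘ out-dart) ℤ.+ sumℤ (F ∘ in-dart)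
  sum-darts F =
    trans (sumℤ-↑ E F) (trans (sym (sumℤ-+ (λ e → F (e ↑ˡ E)) (λ e → F (E ↑ʳ e))))
      (trans (sumℤ-cong swap-ends) (sumℤ-+ (F ∘ out-dart) (F ∘ in-dart))))
    where
    swap-ends : ∀ e → F (e ↑ˡ E) ℤ.+ F (E ↑ʳ e) ≡ F (out-dart e) ℤ.+ F (in-dart e)
    swap-ends e with kind e
    ... | inj₁ _        = refl
    ... | inj₂ (inj₁ _) = refl
    ... | inj₂ (inj₂ _) = ℤP.+-comm (F (e ↑ˡ E)) (F (E ↑ʳ e))

  from-arc : ∀ e → from (arc e) ≡ suc (tail e)
  from-arc e = cong [ _ , _ ]′ (kind-arc e)
  from-inlet : ∀ i → from (inlet i) ≡ zero
  from-inlet i = cong [ _ , _ ]′ (kind-inlet i)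
  from-outlet : ∀ j → from (outlet j) ≡ suc (snk j)
  from-outlet j = cong [ _ , _ ]′ (kind-outlet j)
  to-arc : ∀ e → to (arc e) ≡ suc (head e)
  to-arc e = cong [ _ , _ ]′ (kind-arc e)
  to-inlet : ∀ i → to (inlet i) ≡ suc (src i)
  to-inlet i = cong [ _ , _ ]′ (kind-inlet i)
  to-outlet : ∀ j → to (outlet j) ≡ zero
  to-outlet j = cong [ _ , _ ]′ (kind-outlet j)

  out-inlet : ∀ i → out-dart (inlet i) ≡ inlet i ↑ˡ E
  out-inlet i = cong [ _ , _ ]′ (kind-inlet i)
  in-outlet : ∀ j → in-dart (outlet j) ≡ outlet j ↑ˡ E
  in-outlet j = cong [ _ , _ ]′ (kind-outlet j)

  private
    vertex-↑ˡ : ∀ e → dartVertex Γ (e ↑ˡ E) ≡ end₁ Γ e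
    vertex-↑ˡ e = cong [ end₁ Γ , end₂ Γ ]′ (FinP.splitAt-↑ˡ E e E)
    vertex-↑ʳ : ∀ e → dartVertex Γ (E ↑ʳ e) ≡ end₂ Γ e
    vertex-↑ʳ e = cong [ end₁ Γ , end₂ Γ ]′ (FinP.splitAt-↑ʳ E E e)
    boundary-inlet : ∀ i → boundary Γ (i ↑ˡ n) ≡ src i
    boundary-inlet i = cong [ src , snk ∘ opposite ]′ (FinP.splitAt-↑ˡ n i n)
    boundary-outlet : ∀ j → boundary Γ (n ↑ʳ opposite j) ≡ snk j
    boundary-outlet j = trans (cong [ src , snk ∘ opposite ]′ (FinP.splitAt-↑ʳ n n (opposite j))) (cong snk (FinP.opposite-involutive j))
    ends-arc : ∀ e → end₁ Γ (arc e) ≡ suc (tail e) × end₂ Γ (arc e) ≡ suc (head e)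
    ends-arc e = cong [ _ , _ ]′ (FinP.splitAt-↑ˡ m e (n + n)) , cong [ _ , _ ]′ (FinP.splitAt-↑ˡ m e (n + n))
    ends-apex : ∀ r → end₁ Γ (m ↑ʳ r) ≡ zero × end₂ Γ (m ↑ʳ r) ≡ suc (boundary Γ r)
    ends-apex r = cong [ _ , _ ]′ (FinP.splitAt-↑ʳ m (n + n) r) , cong [ _ , _ ]′ (FinP.splitAt-↑ʳ m (n + n) r)

  vertex-out : ∀ e → dartVertex Γ (out-dart e) ≡ from e
  vertex-out e with kind-view e
  ... | is-arc e′ = trans (cong (dartVertex Γ) (cong [ _ , _ ]′ (kind-arc e′)))
        (trans (vertex-↑ˡ (arc e′)) (trans (proj₁ (ends-arc e′)) (sym (from-arc e′))))
  ... | is-inlet i = trans (cong (dartVertex Γ) (out-inlet i))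
        (trans (vertex-↑ˡ (inlet i)) (trans (proj₁ (ends-apex (i ↑ˡ n))) (sym (from-inlet i))))
  ... | is-outlet j = trans (cong (dartVertex Γ) (cong [ _ , _ ]′ (kind-outlet j)))
        (trans (vertex-↑ʳ (outlet j)) (trans (proj₂ (ends-apex (n ↑ʳ opposite j))) (trans (cong suc (boundary-outlet j)) (sym (from-outlet j)))))

  vertex-in : ∀ e → dartVertex Γ (in-dart e) ≡ to e
  vertex-in e with kind-view e
  ... | is-arc e′ = trans (cong (dartVertex Γ) (cong [ _ , _ ]′ (kind-arc e′)))
        (trans (vertex-↑ʳ (arc e′)) (trans (proj₂ (ends-arc e′)) (sym (to-arc e′))))
  ... | is-inlet i = trans (cong (dartVertex Γ) (cong [ _ , _ ]′ (kind-inlet i)))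
        (trans (vertex-↑ʳ (inlet i)) (trans (proj₂ (ends-apex (i ↑ˡ n))) (trans (cong suc (boundary-inlet i)) (sym (to-inlet i)))))
  ... | is-outlet j = trans (cong (dartVertex Γ) (in-outlet j))
        (trans (vertex-↑ˡ (outlet j)) (trans (proj₁ (ends-apex (n ↑ʳ opposite j))) (sym (to-outlet j))))

  inflow outflow : (Fin E → ℤ) → V∞ → ℤ
  inflow f x  = sumℤ (λ e → + ind (to e Fin.≟ x) ℤ.* f e)
  outflow f x = sumℤ (λ e → + ind (from e Fin.≟ x) ℤ.* f e)

  Closed : (Fin E → ℤ) → Set
  Closed f = ∀ x → inflow f x ≡ outflow f x

  sum-by-vertex : ∀ (g : Fin E → V∞) (ω : V∞ → ℤ) (f : Fin E → ℤ) →
    sumℤ (λ e → ω (g e) ℤ.* f e) ≡ sumℤ (λ x → ω x ℤ.* sumℤ (λ e → + ind (g e Fin.≟ x) ℤ.* f e))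
  sum-by-vertex g ω f =
    trans (sumℤ-cong (λ e → sym (trans (sumℤ-single (g e) (λ x x≢ → trans (cong (λ t → ω x ℤ.* (+ t ℤ.* f e)) (ind-no (g e Fin.≟ x) (x≢ ∘ sym))) (ℤP.*-zeroʳ (ω x))))
                                      (cong (ℤ._*_ (ω (g e))) (trans (cong (λ t → + t ℤ.* f e) (ind-yes (g e Fin.≟ g e) refl)) (ℤP.*-identityˡ (f e)))))))
      (trans (sumℤ-comm (λ e x → ω x ℤ.* (+ ind (g e Fin.≟ x) ℤ.* f e)))
        (sumℤ-cong (λ x → sym (*-sumℤ (ω x) (λ e → + ind (g e Fin.≟ x) ℤ.* f e)))))

prefix-cong : ∀ {n} {g h : Fin n → ℤ} → (∀ i → g i ≡ h i) → ∀ x → prefix g x ≡ prefix h x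
prefix-cong eq x = sumℤ-cong (λ i → cong (ℤ._*_ (+ ind (toℕ i <? x))) (eq i))

prefix-neg : ∀ {n} (g : Fin n → ℤ) x → prefix (λ i → - g i) x ≡ - prefix g x
prefix-neg g x = trans (sumℤ-cong (λ i → move (+ ind (toℕ i <? x)) (g i)))
  (trans (sym (*-sumℤ (- 1ℤ) (λ i → + ind (toℕ i <? x) ℤ.* g i))) (ℤP.-1*i≡-i (prefix g x)))
  where
  move : ∀ a b → a ℤ.* - b ≡ - 1ℤ ℤ.* (a ℤ.* b)
  move = solve-∀

-- Heights of closed flows on the augmented network

module Planar {n : ℕ} (Γ : Network n) (σ σ⁻¹ : Dart Γ → Dart Γ) (rot : PlanarRotation Γ σ σ⁻¹) where
  open Augmented Γ public

  σσ⁻¹ : ∀ d → σ (σ⁻¹ d) ≡ d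
  σσ⁻¹ = proj₁ rot
  σ⁻¹σ : ∀ d → σ⁻¹ (σ d) ≡ d
  σ⁻¹σ = proj₁ (proj₂ rot)
  σ-vertex : ∀ d → dartVertex Γ (σ d) ≡ dartVertex Γ d
  σ-vertex = proj₁ (proj₂ (proj₂ rot))
  σ-transitive : ∀ d d′ → dartVertex Γ d ≡ dartVertex Γ d′ → ∃ λ i → iter σ i d ≡ d′
  σ-transitive = proj₁ (proj₂ (proj₂ (proj₂ rot)))
  σ-apex : ∀ r → σ (apexDart Γ r) ≡ apexDart Γ (cpred r)
  σ-apex = proj₁ (proj₂ (proj₂ (proj₂ (proj₂ rot))))

  open PlanarMap σ σ⁻¹ σσ⁻¹ σ⁻¹σ

  ends : List (Dart Γ × Dart Γ)
  ends = edgePairs {K = E} (λ e → e)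

  ends-matching : Matching ends
  ends-matching = matching-edgePairs (λ e → e) (λ eq → eq)

  swaps≡α : ∀ d → swaps ends d ≡ α Γ d
  swaps≡α d with join-view E d
  ... | inj₁ (e , refl) = trans (swaps-↑ˡ (λ e → e) (λ eq → eq) e) (sym (α-↑ˡ e))
  ... | inj₂ (e , refl) = trans (trans (cong (swaps ends) (sym (swaps-↑ˡ (λ e → e) (λ eq → eq) e))) (swaps-involutive ends-matching (e ↑ˡ E))) (sym (α-↑ʳ e))

  -- The computed counts bound the numbers of vertices and faces from below and that of components
  -- from above, which is the direction that `Genus0` asks for.
  genus0 : Genus0 ends-matching
  genus0 =
    ℕP.≤-trans (ℕP.+-mono-≤ {length ends} {E} (ℕP.≤-reflexive (ListP.length-tabulate (λ e → e ↑ˡ E , E ↑ʳ e)))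
                            (ℕP.*-monoʳ-≤ 2 (classes≤countOrbits (components ends) (σ ∷ α Γ ∷ []) (components-σ ends ∷ comp-α ∷ []))))
      (ℕP.≤-trans (ℕP.≤-reflexive (sym (proj₂ (proj₂ (proj₂ (proj₂ (proj₂ rot)))))))
        (ℕP.+-mono-≤ (countOrbits≤classes σ σ⁻¹ σ⁻¹σ)
          (ℕP.≤-trans (countOrbits≤classes (σ ∘ α Γ) (swaps ends ∘ σ⁻¹) left′)
            (classes-antitone (faces ends-matching) (orbit (σ ∘ α Γ) (swaps ends ∘ σ⁻¹) left′)
              (faces-⊑ ends-matching (orbit (σ ∘ α Γ) (swaps ends ∘ σ⁻¹) left′) (λ x → 1 , cong σ (sym (swaps≡α x))))))))
    where
    comp-α : ∀ x → DecEquiv._~_ (components ends) x (α Γ x)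
    comp-α x = subst (DecEquiv._~_ (components ends) x) (swaps≡α x) (components-swaps ends x)
    left′ : ∀ x → swaps ends (σ⁻¹ (σ (α Γ x))) ≡ x
    left′ x = trans (cong (swaps ends) (trans (σ⁻¹σ _) (sym (swaps≡α x)))) (swaps-involutive ends-matching x)

  -- h d is the height of the face at the corner just before d in the rotation.
  record Height (f : Fin E → ℤ) : Set where
    field
      h      : Dart Γ → ℤ
      h-edge : ∀ e → h (in-dart e) ≡ h (out-dart e) ℤ.+ f e
      h-σout : ∀ e → h (σ (out-dart e)) ≡ h (in-dart e)
      h-σin  : ∀ e → h (σ (in-dart e)) ≡ h (out-dart e)

  closed⇒circulation : ∀ f → Closed f → Circulation (dart-flow f)
  closed⇒circulation f closed w inv =
    trans (sum-darts (λ d → w d ℤ.* dart-flow f d))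
      (trans (cong₂ ℤ._+_
          (trans (sumℤ-cong (λ e → cong₂ ℤ._*_ (trans (w≡ω (out-dart e)) (cong ω (vertex-out e))) (dart-flow-out f e))) (sum-by-vertex from ω f))
          (trans (sumℤ-cong (λ e → trans (cong₂ ℤ._*_ (trans (w≡ω (in-dart e)) (cong ω (vertex-in e))) (dart-flow-in f e)) (pull (ω (to e)) (f e))))
            (trans (sym (*-sumℤ (- 1ℤ) (λ e → ω (to e) ℤ.* f e))) (cong (ℤ._*_ (- 1ℤ)) (trans (sum-by-vertex to ω f)
              (sumℤ-cong (λ x → cong (ℤ._*_ (ω x)) (closed x))))))))
        (cancel (sumℤ (λ x → ω x ℤ.* outflow f x))))
    where
    -- Since `σ` is transitive on the darts at a vertex, `w` descends to the vertices. The value 0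
    -- at a vertex without darts is an arbitrary choice.
    ω : V∞ → ℤ
    ω x with FinP.any? (λ d → dartVertex Γ d Fin.≟ x)
    ... | yes (d , _) = w d
    ... | no _        = 0ℤ
    w≡ω : ∀ d → w d ≡ ω (dartVertex Γ d)
    w≡ω d with FinP.any? (λ d′ → dartVertex Γ d′ Fin.≟ dartVertex Γ d)
    ... | yes (d′ , eq) = invariant-along σ w inv (σ-transitive d′ d eq)
    ... | no ¬p = ⊥-elim (¬p (d , refl))
    pull : ∀ a b → a ℤ.* - b ≡ - 1ℤ ℤ.* (a ℤ.* b)
    pull = solve-∀
    cancel : ∀ a → a ℤ.+ - 1ℤ ℤ.* a ≡ 0ℤ
    cancel = solve-∀

  abstract
    height : ∀ f → Closed f → Height f
    height f closed = record
      { h = χ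
      ; h-edge = λ e → trans (cong χ (sym (trans (swaps≡α _) (α-out e)))) (trans (gradient (out-dart e)) (cong (ℤ._+_ (χ (out-dart e))) (dart-flow-out f e)))
      ; h-σout = λ e → trans (cong (χ ∘ σ) (sym (trans (swaps≡α _) (α-in e)))) (face (in-dart e))
      ; h-σin  = λ e → trans (cong (χ ∘ σ) (sym (trans (swaps≡α _) (α-out e)))) (face (out-dart e)) }
      where
      anti : Antisymmetric ends (dart-flow f)
      anti d with dart-view d
      ... | inj₁ (e , refl) = trans (cong (dart-flow f) (trans (swaps≡α _) (α-out e))) (trans (dart-flow-in f e) (cong -_ (sym (dart-flow-out f e))))
      ... | inj₂ (e , refl) = trans (cong (dart-flow f) (trans (swaps≡α _) (α-in e))) (trans (dart-flow-out f e)
              (trans (sym (ℤP.neg-involutive (f e))) (cong -_ (sym (dart-flow-in f e)))))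
      open Potential (potential ends-matching genus0 (dart-flow f) anti (closed⇒circulation f closed))

  abstract
    boundary-height : ∀ {f} (H : Height f) → let open Height H in
      ∃ λ X₀ → (∀ i → h (out-dart (inlet i)) ≡ X₀ ℤ.- prefix (f ∘ inlet) (suc (toℕ i)))
             × (∀ j → h (in-dart (outlet j)) ≡ X₀ ℤ.- prefix (f ∘ outlet) (toℕ j))
    boundary-height {f} H =
      let X₀ , up , down = boundary-heights (λ r → h (apexDart Γ r)) ζ rec
      in X₀ , (λ i → trans (cong h (out-inlet i)) (trans (up i) (cong (ℤ._-_ X₀) (prefix-cong ζ-inlet (suc (toℕ i))))))
            , (λ j → trans (cong h (in-outlet j)) (trans (down j) (cong (ℤ._+_ X₀) (trans (prefix-cong ζ-outlet (toℕ j)) (prefix-neg (f ∘ outlet) (toℕ j))))))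
      where
      open Height H
      ζ : Fin (n + n) → ℤ
      ζ r = h (σ (apexDart Γ r)) ℤ.- h (apexDart Γ r)
      cancel : ∀ a b → a ≡ b ℤ.+ (a ℤ.- b)
      cancel = solve-∀
      rec : ∀ r → h (apexDart Γ (cpred r)) ≡ h (apexDart Γ r) ℤ.+ ζ r
      rec r = trans (cong h (sym (σ-apex r))) (cancel (h (σ (apexDart Γ r))) (h (apexDart Γ r)))
      minus : ∀ a b → a ℤ.+ b ℤ.- a ≡ b
      minus = solve-∀
      minus′ : ∀ a b → a ℤ.- (a ℤ.+ b) ≡ - b
      minus′ = solve-∀
      ζ-inlet : ∀ i → ζ (i ↑ˡ n) ≡ f (inlet i)
      ζ-inlet i = trans (cong₂ ℤ._-_ (trans (cong (h ∘ σ) (sym (out-inlet i))) (trans (h-σout (inlet i)) (h-edge (inlet i)))) (cong h (sym (out-inlet i))))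
                    (minus (h (out-dart (inlet i))) (f (inlet i)))
      ζ-outlet : ∀ j → ζ (n ↑ʳ opposite j) ≡ - f (outlet j)
      ζ-outlet j = trans (cong₂ ℤ._-_ (trans (cong (h ∘ σ) (sym (in-outlet j))) (h-σin (outlet j))) (trans (cong h (sym (in-outlet j))) (h-edge (outlet j))))
                    (minus′ (h (out-dart (outlet j))) (f (outlet j)))

  -- Going around a vertex from σ Q, the first exceptional dart met is P or again Q.
  around : ∀ (θ : Dart Γ → ℤ) P Q → dartVertex Γ P ≡ dartVertex Γ Q →
           (∀ d → dartVertex Γ d ≡ dartVertex Γ P → d ≢ P → d ≢ Q → θ (σ d) ≡ θ d) → θ (σ Q) ≡ θ P
  around θ P Q PQ const with σ-transitive (σ Q) P (trans (σ-vertex Q) (sym PQ))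
  ... | i , eq = [ (λ p → trans p (cong θ eq)) , (λ p → p) ]′ (go i)
    where
    vertex : ∀ i → dartVertex Γ (iter σ i (σ Q)) ≡ dartVertex Γ P
    vertex zero    = trans (σ-vertex Q) (sym PQ)
    vertex (suc i) = trans (σ-vertex _) (vertex i)
    go : ∀ i → θ (σ Q) ≡ θ (iter σ i (σ Q)) ⊎ θ (σ Q) ≡ θ P
    go zero = inj₁ refl
    go (suc i) with go i
    ... | inj₂ p = inj₂ p
    ... | inj₁ p with iter σ i (σ Q) Fin.≟ P | iter σ i (σ Q) Fin.≟ Q
    ... | yes q | _     = inj₂ (trans p (cong θ q))
    ... | no _  | yes q = inj₁ (cong (θ ∘ σ) (sym q))
    ... | no d≢P | no d≢Q = inj₁ (trans p (sym (const _ (vertex i) d≢P d≢Q)))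

  constant-around : ∀ (θ : Dart Γ → ℤ) d d′ → dartVertex Γ d ≡ dartVertex Γ d′ →
                    (∀ c → dartVertex Γ c ≡ dartVertex Γ d → θ (σ c) ≡ θ c) → θ d ≡ θ d′
  constant-around θ d d′ same const with σ-transitive d d′ same
  ... | i , refl = go i
    where
    vertex : ∀ i → dartVertex Γ (iter σ i d) ≡ dartVertex Γ d
    vertex zero    = refl
    vertex (suc i) = trans (σ-vertex _) (vertex i)
    go : ∀ i → θ d ≡ θ (iter σ i d)
    go zero    = refl
    go (suc i) = trans (go i) (sym (const _ (vertex i)))

-- Topological order

module _ {v m : ℕ} (tail head : Fin m → Fin v) where

  path-snoc : ∀ {x y} e es → IsPath tail head x y es → tail e ≡ y → IsPath tail head x (head e) (es ++ e ∷ [])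
  path-snoc e [] refl t = t , refl
  path-snoc e (e′ ∷ es) (eq , p) t = eq , path-snoc e es p t

  Into : ℕ → Fin v → Set
  Into zero    x = 0 ≡ 0
  Into (suc k) x = ∃ λ e → head e ≡ x × Into k (tail e)

  into? : ∀ k x → Dec (Into k x)
  into? zero    x = yes refl
  into? (suc k) x = FinP.any? (λ e → (head e Fin.≟ x) ×-dec into? k (tail e))

  visited : ∀ k {x} → Into k x → Fin (suc k) → Fin v
  visited k {x} p zero = x
  visited (suc k) (e , _ , p) (suc i) = visited k p i

  path-from : ∀ k {x} (p : Into k x) i → ∃ λ es → IsPath tail head (visited k p i) x es × length es ≡ toℕ i
  path-from k p zero = [] , refl , refl
  path-from (suc k) (e , refl , p) (suc i) =
    let es , q , len = path-from k p i
    in es ++ e ∷ [] , path-snoc e es q refl , trans (ListP.length-++ es) (trans (ℕP.+-comm (length es) 1) (cong suc len))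

  path-between : ∀ k {x} (p : Into k x) i j → i Fin.< j → ∃ λ es → IsPath tail head (visited k p j) (visited k p i) es × es ≢ []
  path-between k p zero (suc j) _ with path-from k p (suc j)
  ... | es , q , len = es , q , λ { refl → case-impossible len }
    where
    case-impossible : ∀ {a} → 0 ≡ suc a → ⊥
    case-impossible ()
  path-between (suc k) (e , _ , p) (suc i) (suc j) (s≤s i<j) = path-between k p i j i<j

  module _ (acyclic : ∀ x es → IsPath tail head x x es → es ≡ []) where

    -- A path with more edges would visit some vertex twice, and the piece between the two visits
    -- would be a nonempty closed path.
    into-bound : ∀ k x → Into k x → k < v
    into-bound k x p with k <? v
    ... | yes k<v = k<v
    ... | no k≮v with FinP.pigeonhole (s≤s (ℕP.≮⇒≥ k≮v)) (visited k p)
    ... | i , j , i<j , eq with path-between k p i j i<j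
    ... | es , q , es≢[] = ⊥-elim (es≢[] (acyclic _ es (subst (λ y → IsPath tail head (visited k p j) y es) eq q)))

    largest : ℕ → Fin v → ℕ
    largest zero    x = 0
    largest (suc k) x with into? (suc k) x
    ... | yes _ = suc k
    ... | no _  = largest k x

    largest-into : ∀ k x → Into (largest k x) x
    largest-into zero    x = refl
    largest-into (suc k) x with into? (suc k) x
    ... | yes p = p
    ... | no _  = largest-into k x

    ≤largest : ∀ k x j → j ≤ k → Into j x → j ≤ largest k x
    ≤largest zero x j j≤k p = j≤k
    ≤largest (suc k) x j j≤k p with into? (suc k) x
    ... | yes _ = j≤k
    ... | no ¬q with ℕP.m≤n⇒m<n∨m≡n j≤k
    ... | inj₁ j<k = ≤largest k x j (ℕP.≤-pred j<k) p
    ... | inj₂ refl = ⊥-elim (¬q p)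

    rank : Fin v → ℕ
    rank = largest v

    rank-edge : ∀ e → rank (tail e) < rank (head e)
    rank-edge e = ≤largest v (head e) (suc (rank (tail e))) (ℕP.<⇒≤ (into-bound _ _ longer)) longer
      where
      longer : Into (suc (rank (tail e))) (head e)
      longer = e , refl , largest-into v (tail e)

    -- The length of the longest path ending at `x`, with ties broken by the number of the vertex.
    -- Being injective, it lets a sweep meet one vertex at a time.
    key : Fin v → ℕ
    key x = rank x * v + toℕ x

    key-rank : ∀ {x y} → rank x < rank y → key x < key y
    key-rank {x} {y} lt = ℕP.<-≤-trans (ℕP.+-monoʳ-< (rank x * v) (FinP.toℕ<n x))
      (ℕP.≤-trans (ℕP.≤-reflexive (ℕP.+-comm (rank x * v) v)) (ℕP.≤-trans (ℕP.*-monoˡ-≤ v lt) (ℕP.m≤m+n _ _)))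

    key-edge : ∀ e → key (tail e) < key (head e)
    key-edge e = key-rank (rank-edge e)

    key-injective : ∀ {x y} → key x ≡ key y → x ≡ y
    key-injective {x} {y} eq with ℕP.<-cmp (rank x) (rank y)
    ... | tri< lt _ _ = ⊥-elim (ℕP.<⇒≢ (key-rank lt) eq)
    ... | tri> _ _ gt = ⊥-elim (ℕP.<⇒≢ (key-rank gt) (sym eq))
    ... | tri≈ _ same _ = FinP.toℕ-injective (ℕP.+-cancelˡ-≡ (rank x * v) (toℕ x) (toℕ y)
                            (trans eq (cong (λ r → r * v + toℕ y) (sym same))))

    keyBound : ℕ
    keyBound = suc v * v

    key-bound : ∀ x → key x < keyBound
    key-bound x = ℕP.<-≤-trans (ℕP.+-monoʳ-< (rank x * v) (FinP.toℕ<n x))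
      (ℕP.≤-trans (ℕP.≤-reflexive (ℕP.+-comm (rank x * v) v)) (ℕP.*-monoˡ-≤ v (into-bound′ (rank x) (largest-into v x))))
      where
      into-bound′ : ∀ k → Into k x → suc k ≤ suc v
      into-bound′ k p = ℕP.m≤n⇒m≤1+n (into-bound k x p)

-- The augmented network in topological order

module PlanarNetwork {n : ℕ} (Γ : Network n) (acyclic : Acyclic Γ) (ss : SourcesSinks Γ)
                     (σ σ⁻¹ : Dart Γ → Dart Γ) (rot : PlanarRotation Γ σ σ⁻¹) where
  open Planar Γ σ σ⁻¹ rot public

  src-injective : ∀ i i′ → src i ≡ src i′ → i ≡ i′
  src-injective = proj₁ ss
  snk-injective : ∀ j j′ → snk j ≡ snk j′ → j ≡ j′
  snk-injective = proj₁ (proj₂ ss)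
  tail≢snk : ∀ j e → tail e ≢ snk j
  tail≢snk = proj₁ (proj₂ (proj₂ (proj₂ (proj₂ ss))))

  ord : Fin v → ℕ
  ord = key tail head acyclic
  ord-edge : ∀ e → ord (tail e) < ord (head e)
  ord-edge = key-edge tail head acyclic

  -- A vertex that no edge enters is a source and has an inlet; dually for `out-edge`. Hence walks
  -- can be traced back to a source and continued to a sink.
  in-edge : ∀ x → ∃ λ e → to e ≡ suc x
  in-edge x with FinP.any? (λ e → head e Fin.≟ x)
  ... | yes (e , eq) = arc e , trans (to-arc e) (cong suc eq)
  ... | no none with proj₁ (proj₂ (proj₂ (proj₂ (proj₂ (proj₂ ss))))) x (λ e eq → none (e , eq))
  ... | i , eq = inlet i , trans (to-inlet i) (cong suc eq)

  out-edge : ∀ x → ∃ λ e → from e ≡ suc x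
  out-edge x with FinP.any? (λ e → tail e Fin.≟ x)
  ... | yes (e , eq) = arc e , trans (from-arc e) (cong suc eq)
  ... | no none with proj₂ (proj₂ (proj₂ (proj₂ (proj₂ (proj₂ ss))))) x (λ e eq → none (e , eq))
  ... | j , eq = outlet j , trans (from-outlet j) (cong suc eq)

  ord-through : ∀ e {x y} → from e ≡ suc x → to e ≡ suc y → ord x < ord y
  ord-through e p q with kind-view e
  ... | is-arc e′ rewrite sym (FinP.suc-injective (trans (sym (from-arc e′)) p)) | sym (FinP.suc-injective (trans (sym (to-arc e′)) q)) = ord-edge e′
  ... | is-inlet i with trans (sym (from-inlet i)) p
  ... | ()
  ord-through e p q | is-outlet j with trans (sym (to-outlet j)) q
  ... | ()

  -- Flows along walks

  unit : Fin E → Fin E → ℤ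
  unit e e′ = + ind (e′ Fin.≟ e)

  unit-self : ∀ e → unit e e ≡ 1ℤ
  unit-self e = cong +_ (ind-yes (e Fin.≟ e) refl)

  unit-other : ∀ e e′ → e′ ≢ e → unit e e′ ≡ 0ℤ
  unit-other e e′ ne = cong +_ (ind-no (e′ Fin.≟ e) ne)

  sum-unit : ∀ (g : Fin E → ℤ) e → sumℤ (λ e′ → g e′ ℤ.* unit e e′) ≡ g e
  sum-unit g e = trans (sumℤ-single e (λ e′ ne → trans (cong (ℤ._*_ (g e′)) (unit-other e e′ ne)) (ℤP.*-zeroʳ (g e′))))
                   (trans (cong (ℤ._*_ (g e)) (unit-self e)) (ℤP.*-identityʳ (g e)))

  inflow-unit : ∀ e x → inflow (unit e) x ≡ + ind (to e Fin.≟ x)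
  inflow-unit e x = sum-unit (λ e′ → + ind (to e′ Fin.≟ x)) e

  outflow-unit : ∀ e x → outflow (unit e) x ≡ + ind (from e Fin.≟ x)
  outflow-unit e x = sum-unit (λ e′ → + ind (from e′ Fin.≟ x)) e

  private
    sum-+* : ∀ (c : ℤ) (w f g : Fin E → ℤ) → sumℤ (λ e → w e ℤ.* (f e ℤ.+ c ℤ.* g e)) ≡ sumℤ (λ e → w e ℤ.* f e) ℤ.+ c ℤ.* sumℤ (λ e → w e ℤ.* g e)
    sum-+* c w f g = trans (sumℤ-cong (λ e → distrib (w e) (f e) (g e) c))
      (trans (sumℤ-+ (λ e → w e ℤ.* f e) (λ e → c ℤ.* (w e ℤ.* g e)))
        (cong (ℤ._+_ (sumℤ (λ e → w e ℤ.* f e))) (sym (*-sumℤ c (λ e → w e ℤ.* g e)))))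
      where
      distrib : ∀ a b c k → a ℤ.* (b ℤ.+ k ℤ.* c) ≡ a ℤ.* b ℤ.+ k ℤ.* (a ℤ.* c)
      distrib = solve-∀

  inflow-+* : ∀ c f g x → inflow (λ e → f e ℤ.+ c ℤ.* g e) x ≡ inflow f x ℤ.+ c ℤ.* inflow g x
  inflow-+* c f g x = sum-+* c (λ e → + ind (to e Fin.≟ x)) f g

  outflow-+* : ∀ c f g x → outflow (λ e → f e ℤ.+ c ℤ.* g e) x ≡ outflow f x ℤ.+ c ℤ.* outflow g x
  outflow-+* c f g x = sum-+* c (λ e → + ind (from e Fin.≟ x)) f g

  data Walk (i : Fin n) : Fin v → Set where
    start : Walk i (src i)
    snoc  : ∀ {y} → Walk i y → (e : Fin m) → tail e ≡ y → Walk i (head e)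

  flow : ∀ {i y} → Walk i y → Fin E → ℤ
  flow {i} start  = unit (inlet i)
  flow (snoc p e _) = λ e′ → flow p e′ ℤ.+ 1ℤ ℤ.* unit (arc e) e′

  On : ∀ {i y} → Fin v → Walk i y → Set
  On {i} x start = x ≡ src i
  On x (snoc p e _) = On x p ⊎ x ≡ head e

  on-end : ∀ {i y} (p : Walk i y) → On y p
  on-end start = refl
  on-end (snoc p e _) = inj₂ refl

  -- One unit travels from ∞ to `y`, and the indicators are the defects at these two vertices. They
  -- cancel between two walks with the same end, and an outlet removes them for a walk to a sink.
  flow-balance : ∀ {i y} (p : Walk i y) x → inflow (flow p) x ℤ.+ + ind (zero Fin.≟ x) ≡ outflow (flow p) x ℤ.+ + ind (suc y Fin.≟ x)
  flow-balance {i} start x =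
    trans (cong (ℤ._+ (+ ind (zero Fin.≟ x))) (trans (inflow-unit (inlet i) x) (cong (λ t → + ind (t Fin.≟ x)) (to-inlet i))))
      (trans (ℤP.+-comm (+ ind (suc (src i) Fin.≟ x)) (+ ind (zero Fin.≟ x)))
        (cong (ℤ._+ (+ ind (suc (src i) Fin.≟ x))) (sym (trans (outflow-unit (inlet i) x) (cong (λ t → + ind (t Fin.≟ x)) (from-inlet i))))))
  flow-balance (snoc {y} p e refl) x =
    trans (cong (ℤ._+ (+ ind (zero Fin.≟ x))) (trans (inflow-+* 1ℤ (flow p) (unit (arc e)) x)
             (cong (λ t → inflow (flow p) x ℤ.+ 1ℤ ℤ.* t) (trans (inflow-unit (arc e) x) (cong (λ t → + ind (t Fin.≟ x)) (to-arc e))))))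
      (trans (shuffle (inflow (flow p) x) (+ ind (suc (head e) Fin.≟ x)) (+ ind (zero Fin.≟ x)))
        (trans (cong (ℤ._+ (+ ind (suc (head e) Fin.≟ x))) (flow-balance p x))
          (trans (shuffle′ (outflow (flow p) x) (+ ind (suc (tail e) Fin.≟ x)) (+ ind (suc (head e) Fin.≟ x)))
            (cong (ℤ._+ (+ ind (suc (head e) Fin.≟ x))) (sym (trans (outflow-+* 1ℤ (flow p) (unit (arc e)) x)
             (cong (λ t → outflow (flow p) x ℤ.+ 1ℤ ℤ.* t) (trans (outflow-unit (arc e) x) (cong (λ t → + ind (t Fin.≟ x)) (from-arc e))))))))))
    where
    shuffle : ∀ a b c → a ℤ.+ 1ℤ ℤ.* b ℤ.+ c ≡ a ℤ.+ c ℤ.+ b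
    shuffle = solve-∀
    shuffle′ : ∀ a b c → a ℤ.+ b ℤ.+ c ≡ a ℤ.+ 1ℤ ℤ.* b ℤ.+ c
    shuffle′ = solve-∀

  -- For an edge into ∞ the hypothesis is vacuous: a walk uses no outlet.
  flow-off-to : ∀ {i y} (p : Walk i y) e′ → (∀ x → to e′ ≡ suc x → ¬ On x p) → flow p e′ ≡ 0ℤ
  flow-off-to {i} start e′ off = unit-other (inlet i) e′ (λ { refl → off (src i) (to-inlet i) refl })
  flow-off-to (snoc p e _) e′ off =
    cong₂ (λ s t → s ℤ.+ 1ℤ ℤ.* t) (flow-off-to p e′ (λ x q on → off x q (inj₁ on)))
      (unit-other (arc e) e′ (λ { refl → off (head e) (to-arc e) (inj₂ refl) }))

  flow-off-from : ∀ {i y} (p : Walk i y) e′ x → from e′ ≡ suc x → ¬ On x p → flow p e′ ≡ 0ℤ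
  flow-off-from {i} start e′ x eq off = unit-other (inlet i) e′ (λ { refl → absurd (trans (sym (from-inlet i)) eq) })
    where
    absurd : ∀ {k} {y : Fin k} → zero ≢ suc y
    absurd ()
  flow-off-from (snoc p e refl) e′ x eq off =
    cong₂ (λ s t → s ℤ.+ 1ℤ ℤ.* t) (flow-off-from p e′ x eq (off ∘ inj₁))
      (unit-other (arc e) e′ (λ { refl → off (inj₁ (subst (λ t → On t p) (FinP.suc-injective (trans (sym (from-arc e)) eq)) (on-end p))) }))

  difference-closed : ∀ {i i′ y} (p : Walk i y) (q : Walk i′ y) → Closed (λ e → flow p e ℤ.+ - 1ℤ ℤ.* flow q e)
  difference-closed {y = y} p q x =
    trans (inflow-+* (- 1ℤ) (flow p) (flow q) x)
      (trans (cancel (inflow (flow p) x) (inflow (flow q) x) (+ ind (zero Fin.≟ x)))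
        (trans (cong₂ (λ s t → s ℤ.+ - 1ℤ ℤ.* t) (flow-balance p x) (flow-balance q x))
          (trans (sym (cancel (outflow (flow p) x) (outflow (flow q) x) (+ ind (suc y Fin.≟ x))))
            (sym (outflow-+* (- 1ℤ) (flow p) (flow q) x)))))
    where
    cancel : ∀ a b c → a ℤ.+ - 1ℤ ℤ.* b ≡ a ℤ.+ c ℤ.+ - 1ℤ ℤ.* (b ℤ.+ c)
    cancel = solve-∀

  loop-flow : ∀ {i j} → Walk i (snk j) → Fin E → ℤ
  loop-flow {j = j} p e = flow p e ℤ.+ 1ℤ ℤ.* unit (outlet j) e

  loop-closed : ∀ {i j} (p : Walk i (snk j)) → Closed (loop-flow p)
  loop-closed {j = j} p x =
    trans (inflow-+* 1ℤ (flow p) (unit (outlet j)) x)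
      (trans (cong (λ t → inflow (flow p) x ℤ.+ 1ℤ ℤ.* t) (trans (inflow-unit (outlet j) x) (cong (λ t → + ind (t Fin.≟ x)) (to-outlet j))))
        (trans (one (inflow (flow p) x) (+ ind (zero Fin.≟ x)))
          (trans (flow-balance p x)
            (trans (sym (one (outflow (flow p) x) (+ ind (suc (snk j) Fin.≟ x))))
              (trans (cong (λ t → outflow (flow p) x ℤ.+ 1ℤ ℤ.* t) (sym (trans (outflow-unit (outlet j) x) (cong (λ t → + ind (t Fin.≟ x)) (from-outlet j)))))
                (sym (outflow-+* 1ℤ (flow p) (unit (outlet j)) x)))))))
    where
    one : ∀ a b → a ℤ.+ 1ℤ ℤ.* b ≡ a ℤ.+ b
    one = solve-∀

  back-walk : ∀ x → ∃ λ i → Σ (Walk i x) λ p → ∀ y → On y p → ord y ≤ ord x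
  back-walk x = go (suc (ord x)) x ℕP.≤-refl
    where
    go : ∀ k x → ord x < k → ∃ λ i → Σ (Walk i x) λ p → ∀ y → On y p → ord y ≤ ord x
    go (suc k) x lt with in-edge x
    ... | e , eq with kind-view e
    ... | is-inlet i with FinP.suc-injective (trans (sym (to-inlet i)) eq)
    ... | refl = i , start , λ { y refl → ℕP.≤-refl }
    go (suc k) x lt | e , eq | is-outlet j with trans (sym (to-outlet j)) eq
    ... | ()
    go (suc k) x lt | e , eq | is-arc e′ with FinP.suc-injective (trans (sym (to-arc e′)) eq)
    ... | refl with go k (tail e′) (ℕP.<-≤-trans (ord-edge e′) (ℕP.≤-pred lt))
    ... | i , p , below = i , snoc p e′ refl , λ { y (inj₁ on) → ℕP.≤-trans (below y on) (ℕP.<⇒≤ (ord-edge e′)) ; y (inj₂ refl) → ℕP.≤-refl }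

  -- All earlier vertices of the walk have smaller order than `y`, so `p` is the only edge by which
  -- it enters `y`.
  back-walk-through : ∀ y p → to p ≡ suc y → ∃ λ i → Σ (Walk i y) λ W →
    (∀ e → to e ≡ suc y → flow W e ≡ unit p e) × (∀ x → On x W → ord x ≤ ord y)
  back-walk-through y p eq with kind-view p
  ... | is-inlet i with FinP.suc-injective (trans (sym (to-inlet i)) eq)
  ... | refl = i , start , (λ _ _ → refl) , λ { x refl → ℕP.≤-refl }
  back-walk-through y p eq | is-outlet j with trans (sym (to-outlet j)) eq
  ... | ()
  back-walk-through y p eq | is-arc e with FinP.suc-injective (trans (sym (to-arc e)) eq)
  ... | refl with back-walk (tail e)
  ... | i , W , below = i , snoc W e refl , last , λ { x (inj₁ on) → ℕP.≤-trans (below x on) (ℕP.<⇒≤ (ord-edge e)) ; x (inj₂ refl) → ℕP.≤-refl }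
    where
    one : ∀ a → 0ℤ ℤ.+ 1ℤ ℤ.* a ≡ a
    one = solve-∀
    last : ∀ e′ → to e′ ≡ suc (head e) → flow (snoc W e refl) e′ ≡ unit (arc e) e′
    last e′ eq′ = trans (cong (ℤ._+ (1ℤ ℤ.* unit (arc e) e′)) (flow-off-to W e′
        (λ x q on → ℕP.<⇒≱ (ord-edge e) (subst (λ t → ord t ≤ ord (tail e)) (FinP.suc-injective (trans (sym q) eq′)) (below x on)))))
      (one (unit (arc e) e′))

  -- Incoming edges are contiguous: the two back walks from p and q enclose no outgoing edge of y,
  -- since an outgoing edge can be continued to a sink without meeting them.
  record Bimodal (y : Fin v) (p q : Fin E) : Set where
    field
      g      : Fin E → ℤ
      H      : Height g
      κ      : ℤ
      g-in   : ∀ e → to e ≡ suc y → g e ≡ unit p e ℤ.+ - 1ℤ ℤ.* unit q e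
      g-out  : ∀ e → from e ≡ suc y → g e ≡ 0ℤ
      θ-out  : ∀ e → from e ≡ suc y → Height.h H (out-dart e) ≡ κ

  module _ {g : Fin E → ℤ} (H : Height g) where
    open Height H

    flat : ∀ e → g e ≡ 0ℤ → h (in-dart e) ≡ h (out-dart e)
    flat e eq = trans (h-edge e) (trans (cong (ℤ._+_ (h (out-dart e))) eq) (ℤP.+-identityʳ _))

    constant-at : ∀ x → (∀ e → from e ≡ suc x → g e ≡ 0ℤ) → (∀ e → to e ≡ suc x → g e ≡ 0ℤ) →
                  ∀ d d′ → dartVertex Γ d ≡ suc x → dartVertex Γ d′ ≡ suc x → h d ≡ h d′
    constant-at x out0 in0 d d′ dx d′x = constant-around h d d′ (trans dx (sym d′x)) const
      where
      const : ∀ c → dartVertex Γ c ≡ dartVertex Γ d → h (σ c) ≡ h c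
      const c same with dart-view c
      ... | inj₁ (e , refl) = trans (h-σout e) (flat e (out0 e (trans (sym (vertex-out e)) (trans same dx))))
      ... | inj₂ (e , refl) = trans (h-σin e) (sym (flat e (in0 e (trans (sym (vertex-in e)) (trans same dx)))))

    module _ (y : Fin v) (g-zero : ∀ e → (∀ x → to e ≡ suc x → ord y < ord x) → g e ≡ 0ℤ)
             (X₀ : ℤ) (outer : ∀ j → h (in-dart (outlet j)) ≡ X₀) where

      downstream-outlet : ∀ j → h (out-dart (outlet j)) ≡ X₀
      downstream-outlet j = trans (sym (flat (outlet j) (g-zero (outlet j) (λ x te → ⊥-elim (FinP.0≢1+n (trans (sym (to-outlet j)) te)))))) (outer j)

      -- From `e` one continues to a sink through vertices above `y`, where `g` vanishes, so the
      -- height stays the same until the boundary, where it is `X₀` at every outlet. The order grows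
      -- at each step and stays below `keyBound`; `k` counts what is left.
      downstream : ∀ k e x → from e ≡ suc x → ord y ≤ ord x → keyBound tail head acyclic ≤ k + ord x → h (out-dart e) ≡ X₀
      downstream-arc : ∀ k e → ord y ≤ ord (tail e) → keyBound tail head acyclic ≤ suc k + ord (tail e) → h (out-dart (arc e)) ≡ X₀

      downstream zero e x fe le lt = ⊥-elim (ℕP.<⇒≱ (key-bound tail head acyclic x) lt)
      downstream (suc k) e x fe le lt with kind-view e
      ... | is-inlet i  = ⊥-elim (FinP.0≢1+n (trans (sym (from-inlet i)) fe))
      ... | is-outlet j = downstream-outlet j
      ... | is-arc e₀   = downstream-arc k e₀ (subst (λ t → ord y ≤ ord t) (sym tail≡) le) (subst (λ t → keyBound tail head acyclic ≤ suc k + ord t) (sym tail≡) lt)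
        where
        tail≡ : tail e₀ ≡ x
        tail≡ = FinP.suc-injective (trans (sym (from-arc e₀)) fe)

      downstream-arc k e le lt =
        trans (sym (flat (arc e) (g-zero (arc e) (λ z te → subst (λ t → ord y < ord t) (FinP.suc-injective (trans (sym (to-arc e)) te)) y<))))
          (trans (constant-at (head e)
                   (λ e′ fe′ → g-zero e′ (λ z te → ℕP.<-trans y< (ord-through e′ fe′ te)))
                   (λ e′ te′ → g-zero e′ (λ z te → subst (λ t → ord y < ord t) (FinP.suc-injective (trans (sym te′) te)) y<))
                   (in-dart (arc e)) (out-dart (proj₁ next)) (trans (vertex-in (arc e)) (to-arc e)) (trans (vertex-out (proj₁ next)) (proj₂ next)))
            (downstream k (proj₁ next) (head e) (proj₂ next) (ℕP.<⇒≤ y<)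
              (ℕP.≤-trans lt (ℕP.≤-trans (ℕP.≤-reflexive (sym (ℕP.+-suc k (ord (tail e))))) (ℕP.+-monoʳ-≤ k (ord-edge e))))))
        where
        next : ∃ λ e′ → from e′ ≡ suc (head e)
        next = out-edge (head e)
        y< : ord y < ord (head e)
        y< = ℕP.≤-<-trans le (ord-edge e)

  module _ (y : Fin v) (p q : Fin E) {i i′ : Fin n} (W : Walk i y) (W′ : Walk i′ y)
           (W-in : ∀ e → to e ≡ suc y → flow W e ≡ unit p e) (W′-in : ∀ e → to e ≡ suc y → flow W′ e ≡ unit q e)
           (W-below : ∀ x → On x W → ord x ≤ ord y) (W′-below : ∀ x → On x W′ → ord x ≤ ord y) where
    private
      g : Fin E → ℤ
      g e = flow W e ℤ.+ - 1ℤ ℤ.* flow W′ e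
      g-zero : ∀ e → (∀ x → to e ≡ suc x → ord y < ord x) → g e ≡ 0ℤ
      g-zero e above = cong₂ (λ s t → s ℤ.+ - 1ℤ ℤ.* t)
        (flow-off-to W e (λ x te on → ℕP.<⇒≱ (above x te) (W-below x on)))
        (flow-off-to W′ e (λ x te on → ℕP.<⇒≱ (above x te) (W′-below x on)))
      H : Height g
      H = height g (difference-closed W W′)
      X₀ : ℤ
      X₀ = proj₁ (boundary-height H)
      outer : ∀ j → Height.h H (in-dart (outlet j)) ≡ X₀
      outer j = trans (proj₂ (proj₂ (boundary-height H)) j)
        (trans (cong (ℤ._-_ X₀) (sumℤ-zero (λ j′ → trans (cong (ℤ._*_ (+ ind (toℕ j′ <? toℕ j)))
                   (g-zero (outlet j′) (λ x te → ⊥-elim (FinP.0≢1+n (trans (sym (to-outlet j′)) te)))))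
                   (ℤP.*-zeroʳ (+ ind (toℕ j′ <? toℕ j))))))
          (ℤP.+-identityʳ X₀))

    bimodal-walks : Bimodal y p q
    bimodal-walks = record
      { g = g ; H = H ; κ = X₀
      ; g-in = λ e te → cong₂ (λ s t → s ℤ.+ - 1ℤ ℤ.* t) (W-in e te) (W′-in e te)
      ; g-out = λ e fe → g-zero e (λ x te → ord-through e fe te)
      ; θ-out = λ e fe → downstream H y g-zero X₀ outer (keyBound tail head acyclic) e y fe ℕP.≤-refl (ℕP.m≤m+n _ _) }

  abstract
    bimodal : ∀ y p q → to p ≡ suc y → to q ≡ suc y → Bimodal y p q
    bimodal y p q tp tq =
      let _ , W , W-in , W-below = back-walk-through y p tp
          _ , W′ , W′-in , W′-below = back-walk-through y q tq
      in bimodal-walks y p q W W′ W-in W′-in W-below W′-below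

-- Heights on the two sides of the edges at one vertex

module Levels {n : ℕ} (Γ : Network n) (acyclic : Acyclic Γ) (ss : SourcesSinks Γ)
              (σ σ⁻¹ : Dart Γ → Dart Γ) (rot : PlanarRotation Γ σ σ⁻¹) where
  open PlanarNetwork Γ acyclic ss σ σ⁻¹ rot public

  module _ {f : Fin E → ℤ} (H : Height f) (y : Fin v) where
    open Height H

    -- h changes around y only at the darts of p and o.
    level-through : ∀ p o → to p ≡ suc y → from o ≡ suc y →
      (∀ e → to e ≡ suc y → e ≢ p → f e ≡ 0ℤ) → (∀ e → from e ≡ suc y → e ≢ o → f e ≡ 0ℤ) →
      h (out-dart p) ≡ h (out-dart o)
    level-through p o tp fo ins outs =
      trans (sym (h-σin p)) (around h (out-dart o) (in-dart p) (trans (vertex-out o) (trans fo (trans (sym tp) (sym (vertex-in p))))) const)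
      where
      const : ∀ d → dartVertex Γ d ≡ dartVertex Γ (out-dart o) → d ≢ out-dart o → d ≢ in-dart p → h (σ d) ≡ h d
      const d same d≢o d≢p with dart-view d
      ... | inj₁ (e , refl) = trans (h-σout e) (flat H e (outs e (trans (sym (vertex-out e)) (trans same (trans (vertex-out o) fo))) (d≢o ∘ cong out-dart)))
      ... | inj₂ (e , refl) = trans (h-σin e) (sym (flat H e (ins e (trans (sym (vertex-in e)) (trans same (trans (vertex-out o) fo))) (d≢p ∘ cong in-dart))))

    level-outs : ∀ o o′ → from o ≡ suc y → from o′ ≡ suc y →
      (∀ e → to e ≡ suc y → f e ≡ 0ℤ) → (∀ e → from e ≡ suc y → e ≢ o → e ≢ o′ → f e ≡ 0ℤ) →
      h (in-dart o′) ≡ h (out-dart o)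
    level-outs o o′ fo fo′ ins outs =
      trans (sym (h-σout o′)) (around h (out-dart o) (out-dart o′) (trans (vertex-out o) (trans fo (trans (sym fo′) (sym (vertex-out o′))))) const)
      where
      const : ∀ d → dartVertex Γ d ≡ dartVertex Γ (out-dart o) → d ≢ out-dart o → d ≢ out-dart o′ → h (σ d) ≡ h d
      const d same d≢o d≢o′ with dart-view d
      ... | inj₁ (e , refl) = trans (h-σout e) (flat H e (outs e (trans (sym (vertex-out e)) (trans same (trans (vertex-out o) fo))) (d≢o ∘ cong out-dart) (d≢o′ ∘ cong out-dart)))
      ... | inj₂ (e , refl) = trans (h-σin e) (sym (flat H e (ins e (trans (sym (vertex-in e)) (trans same (trans (vertex-out o) fo))))))

    module _ (p q : Fin E) (p≢q : p ≢ q) (tp : to p ≡ suc y) (tq : to q ≡ suc y)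
             (ins : ∀ e → to e ≡ suc y → e ≢ p → e ≢ q → f e ≡ 0ℤ) (opp : f q ≡ - f p) where

      open Bimodal (bimodal y p q tp tq) using (g; κ; g-in; g-out; θ-out) renaming (H to Θ)
      open Height Θ using () renaming (h to θ; h-edge to θ-edge; h-σout to θ-σout; h-σin to θ-σin)

      g-p : g p ≡ 1ℤ
      g-p = trans (g-in p tp) (cong₂ (λ s t → s ℤ.+ - 1ℤ ℤ.* t) (unit-self p) (unit-other q p p≢q))

      g-q : g q ≡ - 1ℤ
      g-q = trans (g-in q tq) (cong₂ (λ s t → s ℤ.+ - 1ℤ ℤ.* t) (unit-other p q (p≢q ∘ sym)) (unit-self q))

      g-other : ∀ e → to e ≡ suc y → e ≢ p → e ≢ q → g e ≡ 0ℤ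
      g-other e te e≢p e≢q = trans (g-in e te) (cong₂ (λ s t → s ℤ.+ - 1ℤ ℤ.* t) (unit-other p e e≢p) (unit-other q e e≢q))

      θ-in : ∀ e → from e ≡ suc y → θ (in-dart e) ≡ κ
      θ-in e fe = trans (flat Θ e (g-out e fe)) (θ-out e fe)

      θ-through : θ (out-dart q) ≡ θ (in-dart p)
      θ-through = trans (sym (θ-σin q)) (around θ (in-dart p) (in-dart q) (trans (vertex-in p) (trans tp (trans (sym tq) (sym (vertex-in q))))) const)
        where
        const : ∀ d → dartVertex Γ d ≡ dartVertex Γ (in-dart p) → d ≢ in-dart p → d ≢ in-dart q → θ (σ d) ≡ θ d
        const d same d≢p d≢q with dart-view d
        ... | inj₁ (e , refl) = trans (θ-σout e) (flat Θ e (g-out e (trans (sym (vertex-out e)) (trans same (trans (vertex-in p) tp)))))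
        ... | inj₂ (e , refl) = trans (θ-σin e) (sym (flat Θ e (g-other e (trans (sym (vertex-in e)) (trans same (trans (vertex-in p) tp))) (d≢p ∘ cong in-dart) (d≢q ∘ cong in-dart))))

      -- h − (f p) θ changes around y only at o and o′.
      level-outs-bimodal : ∀ o o′ → from o ≡ suc y → from o′ ≡ suc y →
        (∀ e → from e ≡ suc y → e ≢ o → e ≢ o′ → f e ≡ 0ℤ) → h (in-dart o′) ≡ h (out-dart o)
      level-outs-bimodal o o′ fo fo′ outs =
        cancel-θ (trans (sym (cong₂ (λ s t → s ℤ.- f p ℤ.* t) (h-σout o′) (trans (θ-σout o′) (θ-in o′ fo′))))
          (trans (around ψ (out-dart o) (out-dart o′) (trans (vertex-out o) (trans fo (trans (sym fo′) (sym (vertex-out o′))))) const)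
            (cong (λ t → h (out-dart o) ℤ.- f p ℤ.* t) (θ-out o fo))))
        where
        ψ : Dart Γ → ℤ
        ψ d = h d ℤ.- f p ℤ.* θ d
        add-back : ∀ a c → a ℤ.- c ℤ.+ c ≡ a
        add-back = solve-∀
        cancel-θ : ∀ {a b c} → a ℤ.- c ≡ b ℤ.- c → a ≡ b
        cancel-θ {a} {b} {c} eq = trans (sym (add-back a c)) (trans (cong (ℤ._+ c) eq) (add-back b c))
        ψ-in : ∀ e → to e ≡ suc y → f e ≡ f p ℤ.* g e → ψ (out-dart e) ≡ ψ (in-dart e)
        ψ-in e te eq = trans (balance (h (out-dart e)) (f p) (θ (out-dart e)) (g e))
          (sym (cong₂ (λ s t → s ℤ.- f p ℤ.* t) (trans (h-edge e) (cong (ℤ._+_ (h (out-dart e))) eq)) (θ-edge e)))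
          where
          balance : ∀ a c t g → a ℤ.- c ℤ.* t ≡ a ℤ.+ c ℤ.* g ℤ.- c ℤ.* (t ℤ.+ g)
          balance = solve-∀
        proportional : ∀ e → to e ≡ suc y → f e ≡ f p ℤ.* g e
        proportional e te with e Fin.≟ p | e Fin.≟ q
        ... | yes refl | _ = sym (trans (cong (ℤ._*_ (f p)) g-p) (ℤP.*-identityʳ (f p)))
        ... | no _ | yes refl = trans opp (sym (trans (cong (ℤ._*_ (f p)) g-q) (neg (f p))))
          where
          neg : ∀ a → a ℤ.* - 1ℤ ≡ - a
          neg = solve-∀
        ... | no e≢p | no e≢q = trans (ins e te e≢p e≢q) (sym (trans (cong (ℤ._*_ (f p)) (g-other e te e≢p e≢q)) (ℤP.*-zeroʳ (f p))))
        const : ∀ d → dartVertex Γ d ≡ dartVertex Γ (out-dart o) → d ≢ out-dart o → d ≢ out-dart o′ → ψ (σ d) ≡ ψ d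
        const d same d≢o d≢o′ with dart-view d
        ... | inj₁ (e , refl) = cong₂ (λ s t → s ℤ.- f p ℤ.* t)
              (trans (h-σout e) (flat H e (outs e fe (d≢o ∘ cong out-dart) (d≢o′ ∘ cong out-dart))))
              (trans (θ-σout e) (flat Θ e (g-out e fe)))
          where
          fe : from e ≡ suc y
          fe = trans (sym (vertex-out e)) (trans same (trans (vertex-out o) fo))
        ... | inj₂ (e , refl) = trans (cong₂ (λ s t → s ℤ.- f p ℤ.* t) (h-σin e) (θ-σin e)) (ψ-in e te (proportional e te))
          where
          te : to e ≡ suc y
          te = trans (sym (vertex-in e)) (trans same (trans (vertex-out o) fo))

      private
        jump : Fin E → ℤ
        jump e = θ (in-dart e) ℤ.* h (in-dart e) ℤ.- θ (out-dart e) ℤ.* h (out-dart e)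

      -- Summation by parts over the darts at y.
      jump-balance : sumℤ (λ e → + ind (to e Fin.≟ suc y) ℤ.* jump e) ≡ sumℤ (λ e → + ind (from e Fin.≟ suc y) ℤ.* jump e)
      jump-balance = rearrange
        (trans (sym (sum-darts F)) (trans (sym (sum-σ F)) (trans (sum-darts (F ∘ σ)) (cong₂ ℤ._+_ (sumℤ-cong F-σout) (sumℤ-cong F-σin)))))
        where
        open PlanarMap σ σ⁻¹ σσ⁻¹ σ⁻¹σ using (sum-σ)
        at : V∞ → ℤ
        at x = + ind (x Fin.≟ suc y)
        F : Dart Γ → ℤ
        F d = at (dartVertex Γ d) ℤ.* (θ d ℤ.* h d)
        F-σout : ∀ e → F (σ (out-dart e)) ≡ at (from e) ℤ.* (θ (in-dart e) ℤ.* h (in-dart e))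
        F-σout e = cong₂ ℤ._*_ (cong at (trans (σ-vertex _) (vertex-out e))) (cong₂ ℤ._*_ (θ-σout e) (h-σout e))
        F-σin : ∀ e → F (σ (in-dart e)) ≡ at (to e) ℤ.* (θ (out-dart e) ℤ.* h (out-dart e))
        F-σin e = cong₂ ℤ._*_ (cong at (trans (σ-vertex _) (vertex-in e))) (cong₂ ℤ._*_ (θ-σin e) (h-σin e))
        A B C D : ℤ
        A = sumℤ (λ e → at (from e) ℤ.* (θ (out-dart e) ℤ.* h (out-dart e)))
        B = sumℤ (λ e → at (to e) ℤ.* (θ (in-dart e) ℤ.* h (in-dart e)))
        C = sumℤ (λ e → at (from e) ℤ.* (θ (in-dart e) ℤ.* h (in-dart e)))
        D = sumℤ (λ e → at (to e) ℤ.* (θ (out-dart e) ℤ.* h (out-dart e)))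
        F-out : sumℤ (F ∘ out-dart) ≡ A
        F-out = sumℤ-cong (λ e → cong (λ x → at x ℤ.* (θ (out-dart e) ℤ.* h (out-dart e))) (vertex-out e))
        F-in : sumℤ (F ∘ in-dart) ≡ B
        F-in = sumℤ-cong (λ e → cong (λ x → at x ℤ.* (θ (in-dart e) ℤ.* h (in-dart e))) (vertex-in e))
        split : ∀ (w s t : Fin E → ℤ) → sumℤ (λ e → w e ℤ.* (s e ℤ.- t e)) ≡ sumℤ (λ e → w e ℤ.* s e) ℤ.- sumℤ (λ e → w e ℤ.* t e)
        split w s t = trans (sumℤ-cong (λ e → distrib (w e) (s e) (t e)))
          (trans (sumℤ-+ (λ e → w e ℤ.* s e) (λ e → - 1ℤ ℤ.* (w e ℤ.* t e)))
            (cong (ℤ._+_ (sumℤ (λ e → w e ℤ.* s e))) (trans (sym (*-sumℤ (- 1ℤ) (λ e → w e ℤ.* t e))) (ℤP.-1*i≡-i _))))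
          where
          distrib : ∀ a b c → a ℤ.* (b ℤ.- c) ≡ a ℤ.* b ℤ.+ - 1ℤ ℤ.* (a ℤ.* c)
          distrib = solve-∀
        exchange : ∀ a b c d → a ℤ.+ b ≡ c ℤ.+ d → b ℤ.- d ≡ c ℤ.- a
        exchange a b c d eq = trans (left a b d) (trans (cong (λ t → t ℤ.- a ℤ.- d) eq) (right a c d))
          where
          left : ∀ a b d → b ℤ.- d ≡ a ℤ.+ b ℤ.- a ℤ.- d
          left = solve-∀
          right : ∀ a c d → c ℤ.+ d ℤ.- a ℤ.- d ≡ c ℤ.- a
          right = solve-∀
        rearrange : sumℤ (F ∘ out-dart) ℤ.+ sumℤ (F ∘ in-dart) ≡ C ℤ.+ D →
                    sumℤ (λ e → at (to e) ℤ.* jump e) ≡ sumℤ (λ e → at (from e) ℤ.* jump e)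
        rearrange eq = trans (split (at ∘ to) (λ e → θ (in-dart e) ℤ.* h (in-dart e)) (λ e → θ (out-dart e) ℤ.* h (out-dart e)))
          (trans (exchange A B C D (trans (sym (cong₂ ℤ._+_ F-out F-in)) eq))
            (sym (split (at ∘ from) (λ e → θ (in-dart e) ℤ.* h (in-dart e)) (λ e → θ (out-dart e) ℤ.* h (out-dart e)))))

      -- At entering edges other than `p` and `q` both heights are flat and nothing jumps. At
      -- leaving edges `θ` equals `κ`, so their jumps add up to `κ` times the outflow of `f`, which
      -- is zero like the inflow. There remains `jump p ℤ.+ jump q` equal to zero, an equation from
      -- which `θ` drops out.
      level-ins : Closed f → h (out-dart q) ≡ h (in-dart p)
      level-ins closed = trans (conclude (h (out-dart p)) (h (out-dart q)) (f p) (θ (out-dart p))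
          (trans (sym (cong₂ ℤ._+_ jump-p jump-q)) (trans (sym ins-jump) (trans jump-balance outs-jump)))) (sym (h-edge p))
        where
        two : ∀ (F : Fin E → ℤ) → (∀ e → to e ≡ suc y → e ≢ p → e ≢ q → F e ≡ 0ℤ) → sumℤ (λ e → + ind (to e Fin.≟ suc y) ℤ.* F e) ≡ F p ℤ.+ F q
        two F zeros = trans (sumℤ-double p q p≢q (λ e e≢p e≢q → other e e≢p e≢q))
            (cong₂ ℤ._+_ (at p tp) (at q tq))
          where
          at : ∀ e → to e ≡ suc y → + ind (to e Fin.≟ suc y) ℤ.* F e ≡ F e
          at e te = trans (cong (λ t → + t ℤ.* F e) (ind-yes (to e Fin.≟ suc y) te)) (ℤP.*-identityˡ (F e))
          other : ∀ e → e ≢ p → e ≢ q → + ind (to e Fin.≟ suc y) ℤ.* F e ≡ 0ℤ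
          other e e≢p e≢q with to e Fin.≟ suc y
          ... | yes te = trans (ℤP.*-identityˡ (F e)) (zeros e te e≢p e≢q)
          ... | no _   = refl
        inflow0 : inflow f (suc y) ≡ 0ℤ
        inflow0 = trans (two f ins) (trans (cong (ℤ._+_ (f p)) opp) (ℤP.+-inverseʳ (f p)))
        ins-jump : sumℤ (λ e → + ind (to e Fin.≟ suc y) ℤ.* jump e) ≡ jump p ℤ.+ jump q
        ins-jump = two jump (λ e te e≢p e≢q → trans (cong₂ (λ s t → s ℤ.* t ℤ.- θ (out-dart e) ℤ.* h (out-dart e))
          (flat Θ e (g-other e te e≢p e≢q)) (flat H e (ins e te e≢p e≢q))) (ℤP.+-inverseʳ (θ (out-dart e) ℤ.* h (out-dart e))))
        outs-jump : sumℤ (λ e → + ind (from e Fin.≟ suc y) ℤ.* jump e) ≡ 0ℤ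
        outs-jump = trans (sumℤ-cong (λ e → trans (*-ind (from e Fin.≟ suc y) (λ fe →
              trans (cong₂ (λ s t → s ℤ.* h (in-dart e) ℤ.- t ℤ.* h (out-dart e)) (θ-in e fe) (θ-out e fe))
                (trans (cong (λ s → κ ℤ.* s ℤ.- κ ℤ.* h (out-dart e)) (h-edge e)) (factor κ (h (out-dart e)) (f e)))))
              (pull (+ ind (from e Fin.≟ suc y)) κ (f e))))
          (trans (sym (*-sumℤ κ (λ e → + ind (from e Fin.≟ suc y) ℤ.* f e)))
            (trans (cong (ℤ._*_ κ) (trans (sym (closed (suc y))) inflow0)) (ℤP.*-zeroʳ κ)))
          where
          factor : ∀ k a b → k ℤ.* (a ℤ.+ b) ℤ.- k ℤ.* a ≡ k ℤ.* b
          factor = solve-∀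
          pull : ∀ a k b → a ℤ.* (k ℤ.* b) ≡ k ℤ.* (a ℤ.* b)
          pull = solve-∀
        θq : θ (in-dart q) ≡ θ (out-dart p)
        θq = trans (θ-edge q) (trans (cong₂ ℤ._+_ (trans θ-through (trans (θ-edge p) (cong (ℤ._+_ (θ (out-dart p))) g-p))) g-q) (cancel (θ (out-dart p))))
          where
          cancel : ∀ a → a ℤ.+ 1ℤ ℤ.+ - 1ℤ ≡ a
          cancel = solve-∀
        jump-p : jump p ≡ (θ (out-dart p) ℤ.+ 1ℤ) ℤ.* (h (out-dart p) ℤ.+ f p) ℤ.- θ (out-dart p) ℤ.* h (out-dart p)
        jump-p = cong₂ (λ s t → s ℤ.* t ℤ.- θ (out-dart p) ℤ.* h (out-dart p))
          (trans (θ-edge p) (cong (ℤ._+_ (θ (out-dart p))) g-p)) (h-edge p)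
        jump-q : jump q ≡ θ (out-dart p) ℤ.* (h (out-dart q) ℤ.+ - f p) ℤ.- (θ (out-dart p) ℤ.+ 1ℤ) ℤ.* h (out-dart q)
        jump-q = cong₂ ℤ._-_ (cong₂ ℤ._*_ θq (trans (h-edge q) (cong (ℤ._+_ (h (out-dart q))) opp)))
          (cong (ℤ._* h (out-dart q)) (trans θ-through (trans (θ-edge p) (cong (ℤ._+_ (θ (out-dart p))) g-p))))
        conclude : ∀ hp hq ε a → (a ℤ.+ 1ℤ) ℤ.* (hp ℤ.+ ε) ℤ.- a ℤ.* hp ℤ.+ (a ℤ.* (hq ℤ.+ - ε) ℤ.- (a ℤ.+ 1ℤ) ℤ.* hq) ≡ 0ℤ → hq ≡ hp ℤ.+ ε
        conclude hp hq ε a eq = sym (ℤP.i-j≡0⇒i≡j (hp ℤ.+ ε) hq (trans (sym (simplify hp hq ε a)) eq))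
          where
          simplify : ∀ hp hq ε a → (a ℤ.+ 1ℤ) ℤ.* (hp ℤ.+ ε) ℤ.- a ℤ.* hp ℤ.+ (a ℤ.* (hq ℤ.+ - ε) ℤ.- (a ℤ.+ 1ℤ) ℤ.* hq) ≡ hp ℤ.+ ε ℤ.- hq
          simplify = solve-∀

-- Exchanging two families of disjoint paths

≤1-cases : ∀ {x} → x ≤ 1 → x ≡ 0 ⊎ x ≡ 1
≤1-cases z≤n       = inj₁ refl
≤1-cases (s≤s z≤n) = inj₂ refl

≢-sum : ∀ {x y} → x ≤ 1 → y ≤ 1 → x ≢ y → x + y ≡ 1
≢-sum x≤1 y≤1 x≢y with ≤1-cases x≤1 | ≤1-cases y≤1
... | inj₁ refl | inj₁ refl = ⊥-elim (x≢y refl)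
... | inj₁ refl | inj₂ refl = refl
... | inj₂ refl | inj₁ refl = refl
... | inj₂ refl | inj₂ refl = ⊥-elim (x≢y refl)

+-self≢1 : ∀ x → x + x ≢ 1
+-self≢1 zero ()
+-self≢1 (suc x) eq with trans (sym (ℕP.+-suc x x)) (ℕP.suc-injective eq)
... | ()

module Exchange {n : ℕ} (Γ : Network n) (acyclic : Acyclic Γ) (ss : SourcesSinks Γ)
                (σ σ⁻¹ : Dart Γ → Dart Γ) (rot : PlanarRotation Γ σ σ⁻¹) where
  open Levels Γ acyclic ss σ σ⁻¹ rot public

  degree : (Fin E → V∞) → (Fin E → ℕ) → V∞ → ℕ
  degree end p x = sumℕ (λ e → ind (end e Fin.≟ x) * p e)

  -- In an acyclic network this describes a family of paths that leave ∞, return to it, and are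
  -- vertex-disjoint otherwise. All of them meet at ∞, so the bound is imposed at the other
  -- vertices.
  record Balanced (p : Fin E → ℕ) : Set where
    field
      conserved : ∀ y → degree to p (suc y) ≡ degree from p (suc y)
      bounded   : ∀ y → degree to p (suc y) ≤ 1

    bounded′ : ∀ y → degree from p (suc y) ≤ 1
    bounded′ y = subst (_≤ 1) (conserved y) (bounded y)

  module _ (end : Fin E → V∞) {x : V∞} where

    private
      weight : ∀ (p : Fin E → ℕ) e → end e ≡ x → ind (end e Fin.≟ x) * p e ≡ p e
      weight p e eq = trans (cong (_* p e) (ind-yes (end e Fin.≟ x) eq)) (ℕP.*-identityˡ (p e))

    edge≤degree : ∀ p e → end e ≡ x → p e ≤ degree end p x
    edge≤degree p e eq = subst (_≤ degree end p x) (weight p e eq) (term≤sumℕ (λ e → ind (end e Fin.≟ x) * p e) e)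

    edges≤degree : ∀ p e e′ → e ≢ e′ → end e ≡ x → end e′ ≡ x → p e + p e′ ≤ degree end p x
    edges≤degree p e e′ ne eq eq′ = subst (_≤ degree end p x) (cong₂ _+_ (weight p e eq) (weight p e′ eq′)) (two-terms≤sumℕ (λ e → ind (end e Fin.≟ x) * p e) ne)

    degree-cong : ∀ p q → (∀ e → end e ≡ x → p e ≡ q e) → degree end p x ≡ degree end q x
    degree-cong p q eq = sumℕ-cong agree
      where
      agree : ∀ e → ind (end e Fin.≟ x) * p e ≡ ind (end e Fin.≟ x) * q e
      agree e with end e Fin.≟ x
      ... | yes w = cong (_+ 0) (eq e w)
      ... | no _  = refl

    degree-+ : ∀ p q → degree end (λ e → p e + q e) x ≡ degree end p x + degree end q x
    degree-+ p q = trans (sumℕ-cong (λ e → ℕP.*-distribˡ-+ (ind (end e Fin.≟ x)) (p e) (q e)))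
                     (sumℕ-+ (λ e → ind (end e Fin.≟ x) * p e) (λ e → ind (end e Fin.≟ x) * q e))

  balanced-≤1 : ∀ {p} → Balanced p → ∀ e → p e ≤ 1
  balanced-≤1 {p} bal e with kind-view e
  ... | is-arc e′   = ℕP.≤-trans (edge≤degree to p (arc e′) (to-arc e′)) (Balanced.bounded bal (head e′))
  ... | is-inlet i  = ℕP.≤-trans (edge≤degree to p (inlet i) (to-inlet i)) (Balanced.bounded bal (src i))
  ... | is-outlet j = ℕP.≤-trans (edge≤degree from p (outlet j) (from-outlet j)) (Balanced.bounded′ bal (snk j))

  difference : (Fin E → ℕ) → (Fin E → ℕ) → Fin E → ℤ
  difference p q e = + p e ℤ.- + q e

  private
    net-degree : ∀ (end : Fin E → V∞) p q x → sumℤ (λ e → + ind (end e Fin.≟ x) ℤ.* difference p q e) ≡ + degree end p x ℤ.- + degree end q x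
    net-degree end p q x =
      trans (sumℤ-cong (λ e → distrib (ind (end e Fin.≟ x)) (p e) (q e)))
        (trans (sumℤ-+ (λ e → + (ind (end e Fin.≟ x) * p e)) (λ e → - 1ℤ ℤ.* + (ind (end e Fin.≟ x) * q e)))
          (cong₂ ℤ._+_ (sym (pos-sum (λ e → ind (end e Fin.≟ x) * p e)))
            (trans (sym (*-sumℤ (- 1ℤ) (λ e → + (ind (end e Fin.≟ x) * q e))))
              (trans (ℤP.-1*i≡-i _) (cong -_ (sym (pos-sum (λ e → ind (end e Fin.≟ x) * q e))))))))
      where
      expand : ∀ a b c → a ℤ.* (b ℤ.- c) ≡ a ℤ.* b ℤ.+ - 1ℤ ℤ.* (a ℤ.* c)
      expand = solve-∀
      distrib : ∀ w a b → + w ℤ.* (+ a ℤ.- + b) ≡ + (w * a) ℤ.+ - 1ℤ ℤ.* + (w * b)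
      distrib w a b = trans (expand (+ w) (+ a) (+ b)) (cong₂ (λ s t → s ℤ.+ - 1ℤ ℤ.* t) (sym (ℤP.pos-* w a)) (sym (ℤP.pos-* w b)))

  difference-balanced : ∀ {p q} → Balanced p → Balanced q → Closed (difference p q)
  -- Conservation at ∞ follows from that at all other vertices, because inflow and outflow have the
  -- same total.
  difference-balanced {p} {q} bp bq zero = cancel (inflow f zero) (outflow f zero) (sumℤ (λ y → inflow f (suc y))) (sumℤ (λ y → outflow f (suc y))) (sumℤ-cong inner) totals
    where
    f = difference p q
    inner : ∀ y → inflow f (suc y) ≡ outflow f (suc y)
    inner y = trans (net-degree to p q (suc y)) (trans (cong₂ (λ s t → + s ℤ.- + t) (Balanced.conserved bp y) (Balanced.conserved bq y)) (sym (net-degree from p q (suc y))))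
    total : ∀ (end : Fin E → V∞) → sumℤ (λ x → sumℤ (λ e → + ind (end e Fin.≟ x) ℤ.* f e)) ≡ sumℤ (λ e → 1ℤ ℤ.* f e)
    total end = sym (trans (sum-by-vertex end (λ _ → 1ℤ) f) (sumℤ-cong (λ x → ℤP.*-identityˡ (sumℤ (λ e → + ind (end e Fin.≟ x) ℤ.* f e)))))
    totals : sumℤ (inflow f) ≡ sumℤ (outflow f)
    totals = trans (total to) (sym (total from))
    cancel : ∀ a b c d → c ≡ d → a ℤ.+ c ≡ b ℤ.+ d → a ≡ b
    cancel a b c d refl eq = trans (add-sub a c) (trans (cong (ℤ._- c) eq) (sym (add-sub b c)))
      where
      add-sub : ∀ a c → a ≡ a ℤ.+ c ℤ.- c
      add-sub = solve-∀
  difference-balanced {p} {q} bp bq (suc y) =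
    trans (net-degree to p q (suc y)) (trans (cong₂ (λ s t → + s ℤ.- + t) (Balanced.conserved bp y) (Balanced.conserved bq y)) (sym (net-degree from p q (suc y))))

  difference≡0 : ∀ {a b} → a ≡ b → + a ℤ.- + b ≡ 0ℤ
  difference≡0 {a} refl = ℤP.+-inverseʳ (+ a)

  module Pair (p₀ q₀ : Fin E → ℕ) (bp₀ : Balanced p₀) (bq₀ : Balanced q₀) where

    f : Fin E → ℤ
    f = difference p₀ q₀

    Single : Fin E → Set
    Single e = p₀ e ≢ q₀ e

    module _ (end : Fin E → V∞) (x : V∞) (dp : degree end p₀ x ≤ 1) (dq : degree end q₀ x ≤ 1) where

      private
        exclude : ∀ (p : Fin E → ℕ) → degree end p x ≤ 1 → ∀ e e′ → e ≢ e′ → end e ≡ x → end e′ ≡ x → p e ≡ 1 → p e′ ≡ 0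
        exclude p d e e′ ne ee ee′ pe = ℕP.n≤0⇒n≡0 (ℕP.+-cancelˡ-≤ 1 _ _ (subst (λ t → t + p e′ ≤ 1) pe (ℕP.≤-trans (edges≤degree end p e e′ ne ee ee′) d)))
        cases : ∀ e → end e ≡ x → Single e → (p₀ e ≡ 1 × q₀ e ≡ 0) ⊎ (p₀ e ≡ 0 × q₀ e ≡ 1)
        cases e ee ne with ≤1-cases (ℕP.≤-trans (edge≤degree end p₀ e ee) dp) | ≤1-cases (ℕP.≤-trans (edge≤degree end q₀ e ee) dq)
        ... | inj₁ a | inj₁ b = ⊥-elim (ne (trans a (sym b)))
        ... | inj₁ a | inj₂ b = inj₂ (a , b)
        ... | inj₂ a | inj₁ b = inj₁ (a , b)
        ... | inj₂ a | inj₂ b = ⊥-elim (ne (trans a (sym b)))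

      -- Each family uses at most one of the edges at this end. So one of `e`, `e′` belongs to `p₀`
      -- alone and the other to `q₀` alone, and no further edge is used.
      star-two : ∀ e e′ → e ≢ e′ → end e ≡ x → end e′ ≡ x → Single e → Single e′ →
                 (f e′ ≡ - f e) × (∀ e″ → end e″ ≡ x → e″ ≢ e → e″ ≢ e′ → f e″ ≡ 0ℤ)
      star-two e e′ ne ee ee′ se se′ with cases e ee se | cases e′ ee′ se′
      ... | inj₁ (a , _) | inj₁ (a′ , _) = ⊥-elim (ℕP.0≢1+n (trans (sym (exclude p₀ dp e e′ ne ee ee′ a)) a′))
      ... | inj₂ (_ , b) | inj₂ (_ , b′) = ⊥-elim (ℕP.0≢1+n (trans (sym (exclude q₀ dq e e′ ne ee ee′ b)) b′))
      ... | inj₁ (a , b) | inj₂ (a′ , b′) rewrite a | b | a′ | b′ = refl , λ e″ ee″ ne₁ ne₂ →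
              difference≡0 (trans (exclude p₀ dp e e″ (ne₁ ∘ sym) ee ee″ a) (sym (exclude q₀ dq e′ e″ (ne₂ ∘ sym) ee′ ee″ b′)))
      ... | inj₂ (a , b) | inj₁ (a′ , b′) rewrite a | b | a′ | b′ = refl , λ e″ ee″ ne₁ ne₂ →
              difference≡0 (trans (exclude p₀ dp e′ e″ (ne₂ ∘ sym) ee′ ee″ a′) (sym (exclude q₀ dq e e″ (ne₁ ∘ sym) ee ee″ b)))

      star-one : degree end p₀ x + degree end q₀ x ≡ 1 → ∀ e → end e ≡ x → Single e → ∀ e′ → end e′ ≡ x → e′ ≢ e → f e′ ≡ 0ℤ
      star-one tot e ee se e′ ee′ ne = difference≡0 (trans (ℕP.m+n≡0⇒m≡0 (p₀ e′) none) (sym (ℕP.m+n≡0⇒n≡0 (p₀ e′) none)))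
        where
        pq : Fin E → ℕ
        pq e = p₀ e + q₀ e
        pq≤1 : degree end pq x ≤ 1
        pq≤1 = ℕP.≤-reflexive (trans (degree-+ end p₀ q₀) tot)
        none : pq e′ ≡ 0
        none = exclude pq pq≤1 e e′ (ne ∘ sym) ee ee′ (≢-sum (ℕP.≤-trans (edge≤degree end p₀ e ee) dp) (ℕP.≤-trans (edge≤degree end q₀ e ee) dq) se)

    closed : Closed f
    closed = difference-balanced bp₀ bq₀

    H : Height f
    H = height f closed
    open Height H

    X₀ : ℤ
    X₀ = proj₁ (boundary-height H)

    Upper : Fin E → Set
    Upper e = X₀ ℤ.≤ h (out-dart e) × X₀ ℤ.≤ h (in-dart e)

    upper? : ∀ e → Dec (Upper e)
    upper? e = (X₀ ℤ.≤? h (out-dart e)) ×-dec (X₀ ℤ.≤? h (in-dart e))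

    private
      other-end : ∀ e e′ → h (in-dart e′) ≡ h (out-dart e) → f e′ ≡ - f e → h (out-dart e′) ≡ h (in-dart e)
      other-end e e′ eq opp = sym (trans (h-edge e) (trans (cong (ℤ._+ f e) (trans (sym eq) (trans (h-edge e′) (cong (ℤ._+_ (h (out-dart e′))) opp)))) (cancel (h (out-dart e′)) (f e))))
        where
        cancel : ∀ a b → a ℤ.+ - b ℤ.+ b ≡ a
        cancel = solve-∀

      opposite-levels : ∀ e e′ → h (in-dart e′) ≡ h (out-dart e) → f e′ ≡ - f e → Upper e → Upper e′
      opposite-levels e e′ eq opp (a , b) = subst (X₀ ℤ.≤_) (sym (other-end e e′ eq opp)) b , subst (X₀ ℤ.≤_) (sym eq) a

      f-single : ∀ {e} → f e ≢ 0ℤ → Single e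
      f-single ne eq = ne (difference≡0 eq)

    upper-ins : ∀ y e e′ → to e ≡ suc y → to e′ ≡ suc y → Single e → Single e′ → Upper e → Upper e′
    upper-ins y e e′ te te′ se se′ up with e Fin.≟ e′
    ... | yes refl = up
    ... | no ne with star-two to (suc y) (Balanced.bounded bp₀ y) (Balanced.bounded bq₀ y) e′ e (ne ∘ sym) te′ te se′ se
    ... | opp , zeros = opposite-levels e e′ (sym (level-ins H y e′ e (ne ∘ sym) te′ te zeros opp closed)) (trans (sym (ℤP.neg-involutive (f e′))) (cong -_ (sym opp))) up

    -- The two leaving edges carry opposite flows, so the net inflow at `y` is zero. If no entering
    -- edge carries flow, `h` changes only at the two leaving darts; a single one would violate
    -- conservation; with two, their effect on `h` is compensated by `θ`, which is where
    -- non-alternation enters.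
    upper-outs : ∀ y e e′ → from e ≡ suc y → from e′ ≡ suc y → Single e → Single e′ → Upper e → Upper e′
    upper-outs y e e′ fe fe′ se se′ up with e Fin.≟ e′
    ... | yes refl = up
    ... | no ne with star-two from (suc y) (Balanced.bounded′ bp₀ y) (Balanced.bounded′ bq₀ y) e e′ ne fe fe′ se se′
    ... | opp , zeros with FinP.any? (λ p → (to p Fin.≟ suc y) ×-dec ¬? (f p ℤ.≟ 0ℤ))
    ... | no none = opposite-levels e e′ (level-outs H y e e′ fe fe′ in0 zeros) opp up
      where
      in0 : ∀ p → to p ≡ suc y → f p ≡ 0ℤ
      in0 p tp with f p ℤ.≟ 0ℤ
      ... | yes eq = eq
      ... | no nz  = ⊥-elim (none (p , tp , nz))
    ... | yes (p , tp , fp) with FinP.any? (λ q → (to q Fin.≟ suc y) ×-dec (¬? (q Fin.≟ p) ×-dec ¬? (f q ℤ.≟ 0ℤ)))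
    ... | yes (q , tq , q≢p , fq) =
      let opp′ , zeros′ = star-two to (suc y) (Balanced.bounded bp₀ y) (Balanced.bounded bq₀ y) p q (q≢p ∘ sym) tp tq (f-single fp) (f-single fq)
      in opposite-levels e e′ (level-outs-bimodal H y p q (q≢p ∘ sym) tp tq zeros′ opp′ e e′ fe fe′ zeros) opp up
    ... | no none = ⊥-elim (fp (trans (sym in-only) (trans (closed (suc y)) out-cancel)))
      where
      in-only : inflow f (suc y) ≡ f p
      in-only = trans (sumℤ-single p other) (trans (cong (λ t → + t ℤ.* f p) (ind-yes (to p Fin.≟ suc y) tp)) (ℤP.*-identityˡ (f p)))
        where
        other : ∀ q → q ≢ p → + ind (to q Fin.≟ suc y) ℤ.* f q ≡ 0ℤ
        other q q≢p with to q Fin.≟ suc y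
        ... | no _ = refl
        ... | yes tq with f q ℤ.≟ 0ℤ
        ... | yes eq = trans (ℤP.*-identityˡ (f q)) eq
        ... | no nz  = ⊥-elim (none (q , tq , q≢p , nz))
      out-cancel : outflow f (suc y) ≡ 0ℤ
      out-cancel = trans (sumℤ-double e e′ ne other)
        (trans (cong₂ ℤ._+_ (at e fe) (at e′ fe′)) (trans (cong (ℤ._+_ (f e)) opp) (ℤP.+-inverseʳ (f e))))
        where
        at : ∀ e → from e ≡ suc y → + ind (from e Fin.≟ suc y) ℤ.* f e ≡ f e
        at e fe = trans (cong (λ t → + t ℤ.* f e) (ind-yes (from e Fin.≟ suc y) fe)) (ℤP.*-identityˡ (f e))
        other : ∀ o → o ≢ e → o ≢ e′ → + ind (from o Fin.≟ suc y) ℤ.* f o ≡ 0ℤ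
        other o ne₁ ne₂ with from o Fin.≟ suc y
        ... | no _ = refl
        ... | yes fo = trans (ℤP.*-identityˡ (f o)) (zeros o fo ne₁ ne₂)

    -- Total degree one means that only one of the two families visits `y`. Then `e` and `o` carry
    -- its flow, and `h` changes at no other dart.
    through-levels : ∀ y e o → to e ≡ suc y → from o ≡ suc y → Single e → Single o →
      degree to p₀ (suc y) + degree to q₀ (suc y) ≡ 1 → h (out-dart e) ≡ h (out-dart o) × h (in-dart e) ≡ h (in-dart o)
    through-levels y e o te fo se so tot = lo , trans (h-edge e) (trans (cong₂ ℤ._+_ lo fe≡fo) (sym (h-edge o)))
      where
      ins = star-one to (suc y) (Balanced.bounded bp₀ y) (Balanced.bounded bq₀ y) tot e te se
      outs = star-one from (suc y) (Balanced.bounded′ bp₀ y) (Balanced.bounded′ bq₀ y) (trans (sym (cong₂ _+_ (Balanced.conserved bp₀ y) (Balanced.conserved bq₀ y))) tot) o fo so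
      lo : h (out-dart e) ≡ h (out-dart o)
      lo = level-through H y e o te fo ins outs
      only : ∀ (end : Fin E → V∞) e → end e ≡ suc y → (∀ e′ → end e′ ≡ suc y → e′ ≢ e → f e′ ≡ 0ℤ) → sumℤ (λ e → + ind (end e Fin.≟ suc y) ℤ.* f e) ≡ f e
      only end e ee zeros = trans (sumℤ-single e other) (trans (cong (λ t → + t ℤ.* f e) (ind-yes (end e Fin.≟ suc y) ee)) (ℤP.*-identityˡ (f e)))
        where
        other : ∀ e′ → e′ ≢ e → + ind (end e′ Fin.≟ suc y) ℤ.* f e′ ≡ 0ℤ
        other e′ ne with end e′ Fin.≟ suc y
        ... | no _ = refl
        ... | yes ee′ = trans (ℤP.*-identityˡ (f e′)) (zeros e′ ee′ ne)
      fe≡fo : f e ≡ f o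
      fe≡fo = trans (sym (only to e te ins)) (trans (closed (suc y)) (only from o fo outs))

    U : Fin E → Bool
    U e = does (upper? e)

    select : ∀ {A : Set} → Bool → A → A → A
    select b x y = if b then x else y

    private
      does-⇔ : ∀ {A B : Set} (d : Dec A) (d′ : Dec B) → (A → B) → (B → A) → does d ≡ does d′
      does-⇔ (yes a) (yes _) _ _ = refl
      does-⇔ (yes a) (no ¬b) f _ = ⊥-elim (¬b (f a))
      does-⇔ (no ¬a) (yes b) _ g = ⊥-elim (¬a (g b))
      does-⇔ (no _)  (no _)  _ _ = refl

      select-same : ∀ {A : Set} b {x y : A} → x ≡ y → select b x y ≡ y
      select-same true  eq = eq
      select-same false eq = refl

      select-≤1 : ∀ b {x y} → x ≤ 1 → y ≤ 1 → select b x y ≤ 1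
      select-≤1 true  p _ = p
      select-≤1 false _ q = q

    U-ins : ∀ y e e′ → to e ≡ suc y → to e′ ≡ suc y → Single e → Single e′ → U e ≡ U e′
    U-ins y e e′ te te′ se se′ = does-⇔ (upper? e) (upper? e′) (upper-ins y e e′ te te′ se se′) (upper-ins y e′ e te′ te se′ se)

    U-outs : ∀ y e e′ → from e ≡ suc y → from e′ ≡ suc y → Single e → Single e′ → U e ≡ U e′
    U-outs y e e′ te te′ se se′ = does-⇔ (upper? e) (upper? e′) (upper-outs y e e′ te te′ se se′) (upper-outs y e′ e te′ te se′ se)

    U-through : ∀ y e o → to e ≡ suc y → from o ≡ suc y → Single e → Single o →
                degree to p₀ (suc y) + degree to q₀ (suc y) ≡ 1 → U e ≡ U o
    U-through y e o te fo se so tot with through-levels y e o te fo se so tot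
    ... | lo , hi = does-⇔ (upper? e) (upper? o)
      (λ { (a , b) → subst (X₀ ℤ.≤_) lo a , subst (X₀ ℤ.≤_) hi b })
      (λ { (a , b) → subst (X₀ ℤ.≤_) (sym lo) a , subst (X₀ ℤ.≤_) (sym hi) b })

    module _ (p q : Fin E → ℕ) (bp : Balanced p) (bq : Balanced q) (same : ∀ e → p e + q e ≡ p₀ e + q₀ e) where

      swapped : Fin E → ℕ
      swapped e = select (U e) (q e) (p e)

      -- Being used by exactly one family is the parity of the sum, which the pairs `(p , q)` and
      -- `(p₀ , q₀)` share. So the set `U` made from the latter applies to the former.
      single : ∀ e → p e ≢ q e → Single e
      single e ne eq = +-self≢1 (q₀ e) (trans (cong (_+ q₀ e) (sym eq)) (trans (sym (same e)) (≢-sum (balanced-≤1 bp e) (balanced-≤1 bq e) ne)))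

      -- Where `p` and `q` differ, the edges at this end have the same value of `U`, so the degree
      -- is taken over as a whole from one of the two families.
      degree-swapped : ∀ (end : Fin E → V∞) y →
        (∀ e e′ → end e ≡ suc y → end e′ ≡ suc y → Single e → Single e′ → U e ≡ U e′) →
        (degree end swapped (suc y) ≡ degree end p (suc y) × degree end p (suc y) ≡ degree end q (suc y))
        ⊎ (∃ λ e → end e ≡ suc y × Single e × degree end swapped (suc y) ≡ select (U e) (degree end q (suc y)) (degree end p (suc y)))
      degree-swapped end y agree with FinP.any? (λ e → (end e Fin.≟ suc y) ×-dec ¬? (p e ℕ.≟ q e))
      ... | no none = inj₁ (degree-cong end swapped p (λ e ee → select-same (U e) (sym (eq e ee))) , degree-cong end p q eq)
        where
        eq : ∀ e → end e ≡ suc y → p e ≡ q e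
        eq e ee with p e ℕ.≟ q e
        ... | yes r = r
        ... | no ne = ⊥-elim (none (e , ee , ne))
      ... | yes (e , ee , ne) = inj₂ (e , ee , single e ne , trans (degree-cong end swapped (λ e′ → select (U e) (q e′) (p e′)) pointwise) (pull (U e)))
        where
        pointwise : ∀ e′ → end e′ ≡ suc y → swapped e′ ≡ select (U e) (q e′) (p e′)
        pointwise e′ ee′ with p e′ ℕ.≟ q e′
        ... | yes r  = trans (select-same (U e′) (sym r)) (sym (select-same (U e) (sym r)))
        ... | no ne′ = cong (λ b → select b (q e′) (p e′)) (agree e′ e ee′ ee (single e′ ne′) (single e ne))
        pull : ∀ b → degree end (λ e′ → select b (q e′) (p e′)) (suc y) ≡ select b (degree end q (suc y)) (degree end p (suc y))
        pull true  = refl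
        pull false = refl

      -- If both families visit `y`, or neither, the choices made for entering and for leaving edges
      -- may be independent, as all degrees agree. If just one does, `U-through` makes the two
      -- choices equal.
      swapped-balanced : Balanced swapped
      swapped-balanced = record { conserved = cons ; bounded = bound }
        where
        module P = Balanced bp
        module Q = Balanced bq
        totals : ∀ y → degree to p (suc y) + degree to q (suc y) ≡ degree to p₀ (suc y) + degree to q₀ (suc y)
        totals y = trans (sym (degree-+ to p q)) (trans (degree-cong to (λ e → p e + q e) (λ e → p₀ e + q₀ e) (λ e _ → same e)) (degree-+ to p₀ q₀))
        bound : ∀ y → degree to swapped (suc y) ≤ 1
        bound y with degree-swapped to y (U-ins y)
        ... | inj₁ (eq , _)         = subst (_≤ 1) (sym eq) (P.bounded y)
        ... | inj₂ (e , _ , _ , eq) = subst (_≤ 1) (sym eq) (select-≤1 (U e) (Q.bounded y) (P.bounded y))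
        cons : ∀ y → degree to swapped (suc y) ≡ degree from swapped (suc y)
        cons y with degree-swapped to y (U-ins y) | degree-swapped from y (U-outs y)
        ... | inj₁ (eq , _) | inj₁ (eq′ , _) = trans eq (trans (P.conserved y) (sym eq′))
        ... | inj₁ (eq , pq) | inj₂ (o , _ , _ , eq′) = trans eq (trans (P.conserved y)
                (sym (trans eq′ (select-same (U o) (trans (sym (Q.conserved y)) (trans (sym pq) (P.conserved y)))))))
        ... | inj₂ (e , _ , _ , eq) | inj₁ (eq′ , pq) = trans eq (trans (select-same (U e) (trans (Q.conserved y) (trans (sym pq) (sym (P.conserved y)))))
                (trans (P.conserved y) (sym eq′)))
        ... | inj₂ (e , te , se , eq) | inj₂ (o , fo , so , eq′) with degree to p (suc y) ℕ.≟ degree to q (suc y)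
        ... | yes pq = trans eq (trans (select-same (U e) (sym pq)) (trans (P.conserved y)
                (sym (trans eq′ (select-same (U o) (trans (sym (Q.conserved y)) (trans (sym pq) (P.conserved y))))))))
        ... | no ne = trans eq (trans (cong₂ (λ b t → select b t (degree to p (suc y)))
                  (U-through y e o te fo se so (trans (sym (totals y)) (≢-sum (P.bounded y) (Q.bounded y) ne))) (Q.conserved y))
                (trans (cong (select (U o) (degree from q (suc y))) (P.conserved y)) (sym eq′)))

    upper-outlet : (∀ x → prefix (f ∘ outlet) x ℤ.≤ 0ℤ) → ∀ j → U (outlet j) ≡ true
    upper-outlet below j = does-⇔ (upper? (outlet j)) (yes both) (λ p → p) (λ p → p)
      where
      hin : h (in-dart (outlet j)) ≡ X₀ ℤ.- prefix (f ∘ outlet) (toℕ j)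
      hin = proj₂ (proj₂ (boundary-height H)) j
      hout : h (out-dart (outlet j)) ≡ X₀ ℤ.- prefix (f ∘ outlet) (suc (toℕ j))
      hout = trans (shift (h (out-dart (outlet j))) (f (outlet j))) (trans (cong (ℤ._- f (outlet j)) (trans (sym (h-edge (outlet j))) hin))
        (trans (regroup X₀ (prefix (f ∘ outlet) (toℕ j)) (f (outlet j))) (cong (ℤ._-_ X₀) (sym (prefix-suc (f ∘ outlet) j)))))
        where
        shift : ∀ a b → a ≡ a ℤ.+ b ℤ.- b
        shift = solve-∀
        regroup : ∀ a b c → a ℤ.- b ℤ.- c ≡ a ℤ.- (b ℤ.+ c)
        regroup = solve-∀
      above : ∀ {c} → c ℤ.≤ 0ℤ → X₀ ℤ.≤ X₀ ℤ.- c
      above {c} le = subst (ℤ._≤ X₀ ℤ.- c) (ℤP.+-identityʳ X₀) (ℤP.+-monoʳ-≤ X₀ (ℤP.neg-mono-≤ le))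
      both : Upper (outlet j)
      both = subst (X₀ ℤ.≤_) (sym hout) (above (below (suc (toℕ j)))) , subst (X₀ ℤ.≤_) (sym hin) (above (below (toℕ j)))

    -- Both heights at an inlet are at most `X₀`. If both were also at least `X₀` they would be
    -- equal and the edge would carry no net flow, contrary to `Single`.
    lower-inlet : (∀ x → 0ℤ ℤ.≤ prefix (f ∘ inlet) x) → ∀ i → Single (inlet i) → U (inlet i) ≡ false
    lower-inlet above i si = does-⇔ (upper? (inlet i)) (no (λ ())) not-both (λ ())
      where
      hout : h (out-dart (inlet i)) ≡ X₀ ℤ.- prefix (f ∘ inlet) (suc (toℕ i))
      hout = proj₁ (proj₂ (boundary-height H)) i
      hin : h (in-dart (inlet i)) ≡ X₀ ℤ.- prefix (f ∘ inlet) (toℕ i)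
      hin = trans (h-edge (inlet i)) (trans (cong (ℤ._+ f (inlet i)) (trans hout (cong (ℤ._-_ X₀) (prefix-suc (f ∘ inlet) i))))
        (regroup X₀ (prefix (f ∘ inlet) (toℕ i)) (f (inlet i))))
        where
        regroup : ∀ a b c → a ℤ.- (b ℤ.+ c) ℤ.+ c ≡ a ℤ.- b
        regroup = solve-∀
      below : ∀ {c} → 0ℤ ℤ.≤ c → X₀ ℤ.- c ℤ.≤ X₀
      below {c} le = subst (X₀ ℤ.- c ℤ.≤_) (ℤP.+-identityʳ X₀) (ℤP.+-monoʳ-≤ X₀ (ℤP.neg-mono-≤ le))
      not-both : Upper (inlet i) → ⊥
      not-both (a , b) = si (ℤP.+-injective zero-flow)
        where
        out≡ : h (out-dart (inlet i)) ≡ X₀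
        out≡ = ℤP.≤-antisym (subst (ℤ._≤ X₀) (sym hout) (below (above (suc (toℕ i))))) a
        in≡ : h (in-dart (inlet i)) ≡ X₀
        in≡ = ℤP.≤-antisym (subst (ℤ._≤ X₀) (sym hin) (below (above (toℕ i)))) b
        zero-flow : + p₀ (inlet i) ≡ + q₀ (inlet i)
        zero-flow = ℤP.i-j≡0⇒i≡j _ _ (trans (isolate (h (out-dart (inlet i))) (f (inlet i))) (trans (cong₂ ℤ._-_ (trans (sym (h-edge (inlet i))) in≡) out≡) (ℤP.+-inverseʳ X₀)))
          where
          isolate : ∀ a b → b ≡ a ℤ.+ b ℤ.- a
          isolate = solve-∀

-- The determinant of polynomials

module PolyDet {m : ℕ} where
  open CommutativeRing (polyRing {m}) public using () renaming (refl to ≋-refl; sym to ≋-sym; trans to ≋-trans; reflexive to ≋-reflexive; +-cong to +P-cong; -‿cong to -P-cong; +-identityʳ to +P-identityʳ; +-comm to +P-comm; +-assoc to +P-assoc; zeroˡ to *P-zeroˡ; zeroʳ to *P-zeroʳ)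
  open RingP (CommutativeRing.ring (polyRing {m})) using () renaming (-‿distribˡ-* to -P-distribˡ)
  open Determinant (polyRing {m}) public

  alt-ε : ∀ i (p : Poly m) → alt i p ≋ ε i *P p
  alt-ε zero    p = ≋-sym (*P-identityˡ p)
  alt-ε (suc i) p = ≋-trans (-P-cong (alt-ε i p)) (-P-distribˡ (ε i) p)

  sumP-∑ : ∀ {k} {A : Set} (f : A → Poly m) (g : Fin k → A) → sumP (map f (tabulate g)) ≋ ∑ (f ∘ g)
  sumP-∑ {zero}  f g = ≋-sym (∑-zero (λ ()))
  sumP-∑ {suc k} f g = ≋-trans (+P-cong (≋-refl {f (g zero)}) (sumP-∑ f (g ∘ suc))) (≋-sym (∑-suc (f ∘ g)))

  det-Det : ∀ k (M : Fin k → Fin k → Poly m) → det k M ≋ Det k M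
  det-Det zero    M = ≋-refl
  det-Det (suc k) M = ≋-trans (sumP-∑ (λ j → alt (toℕ j) (M zero j *P det k (minor M j))) (λ j → j))
    (∑-cong (λ j → ≋-trans (alt-ε (toℕ j) (M zero j *P det k (minor M j))) (*P-cong (≋-refl {ε (toℕ j)}) (*P-cong (≋-refl {M zero j}) (det-Det k (minor M j))))))

  coeff-∑ : ∀ {k} (f : Fin k → Poly m) μ → coeff (∑ f) μ ≡ sumℤ (λ i → coeff (f i) μ)
  coeff-∑ {zero}  f μ = coeff-cong (∑-zero {f = f} (λ ())) μ
  coeff-∑ {suc k} f μ = trans (coeff-cong (∑-suc f) μ) (trans (coeff-+ (f zero) (∑ (f ∘ suc)) μ) (cong (ℤ._+_ (coeff (f zero) μ)) (coeff-∑ (f ∘ suc) μ)))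

  -- Exchanging the rows shows only that the determinant is its own negative, which in a general
  -- commutative ring does not make it zero; hence the passage to integer coefficients.
  Det-equal-rows : ∀ k (M : Matrix k) r s → r ≢ s → (∀ j → M r j ≋ M s j) → ∀ μ → coeff (Det k M) μ ≡ 0ℤ
  Det-equal-rows k M r s r≢s eq μ with FinP.<-cmp r s
  ... | tri< r<s _ _ = self-negative _ (trans (coeff-cong (Det-swap k r s M M r<s (rowsSwapped eq (λ j → ≋-sym (eq j)) (λ _ _ _ _ → ≋-refl))) μ) (coeff-neg (Det k M) μ))
  ... | tri≈ _ r≡s _ = ⊥-elim (r≢s r≡s)
  ... | tri> _ _ s<r = self-negative _ (trans (coeff-cong (Det-swap k s r M M s<r (rowsSwapped (λ j → ≋-sym (eq j)) eq (λ _ _ _ _ → ≋-refl))) μ) (coeff-neg (Det k M) μ))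

-- Generating functions of paths

module PathWeights {n : ℕ} (Γ : Network n) (acyclic : Acyclic Γ) (tail≢snk : ∀ j e → Network.tail Γ e ≢ Network.snk Γ j)
                   (snk-injective : ∀ j j′ → Network.snk Γ j ≡ Network.snk Γ j′ → j ≡ j′) where
  open Network Γ
  open PolyDet {m}

  private
    ord : Fin v → ℕ
    ord = key tail head acyclic
    B : ℕ
    B = keyBound tail head acyclic

  Path : Fin v → Fin v → List (Fin m) → Set
  Path = IsPath tail head

  path-ord : ∀ x y es → Path x y es → ord x + length es ≤ ord y
  path-ord x y [] refl = ℕP.≤-reflexive (ℕP.+-identityʳ (ord x))
  path-ord x y (e ∷ es) (refl , p) = ℕP.≤-trans (ℕP.≤-reflexive (ℕP.+-suc (ord x) (length es)))
    (ℕP.≤-trans (ℕP.+-monoˡ-≤ (length es) (key-edge tail head acyclic e)) (path-ord (head e) y es p))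

  path-short : ∀ x y es → Path x y es → length es < B
  path-short x y es p = ℕP.≤-<-trans (ℕP.≤-trans (ℕP.m≤n+m (length es) (ord x)) (path-ord x y es p)) (key-bound tail head acyclic y)

  mutual
    -- The first argument is fuel: `paths k x j` lists exactly the paths with fewer than `k` edges.
    paths : ℕ → Fin v → Fin n → List (List (Fin m))
    paths zero    x j = []
    paths (suc k) x j = trivial x j ++ concat (tabulate (extend k x j))

    trivial : Fin v → Fin n → List (List (Fin m))
    trivial x j = if does (x Fin.≟ snk j) then [] ∷ [] else []

    extend : ℕ → Fin v → Fin n → Fin m → List (List (Fin m))
    extend k x j e = if does (tail e Fin.≟ x) then map (e ∷_) (paths k (head e) j) else []

  trivial⁻ : ∀ x j {es} → es ∈ trivial x j → es ≡ [] × x ≡ snk j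
  trivial⁻ x j mem with x Fin.≟ snk j
  trivial⁻ x j (here refl) | yes eq = refl , eq

  trivial⁺ : ∀ x j → x ≡ snk j → [] ∈ trivial x j
  trivial⁺ x j eq with x Fin.≟ snk j
  ... | yes _ = here refl
  ... | no ne = ⊥-elim (ne eq)

  extend⁻ : ∀ k x j e {es} → es ∈ extend k x j e → tail e ≡ x × ∃ λ es′ → es′ ∈ paths k (head e) j × es ≡ e ∷ es′
  extend⁻ k x j e mem with tail e Fin.≟ x
  ... | yes eq = eq , MemP.∈-map⁻ (e ∷_) mem

  extend⁺ : ∀ k x j e {es} → tail e ≡ x → es ∈ paths k (head e) j → e ∷ es ∈ extend k x j e
  extend⁺ k x j e eq mem with tail e Fin.≟ x
  ... | yes _ = MemP.∈-map⁺ (e ∷_) mem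
  ... | no ne = ⊥-elim (ne eq)

  paths-sound : ∀ k x j es → es ∈ paths k x j → Path x (snk j) es
  paths-sound (suc k) x j es mem with MemP.∈-++⁻ (trivial x j) mem
  ... | inj₁ mem₁ with trivial⁻ x j mem₁
  ... | refl , eq = eq
  paths-sound (suc k) x j es mem | inj₂ mem₂ with MemP.∈-concat⁻′ (tabulate (extend k x j)) mem₂
  ... | xs , mem₃ , mem₄ with MemP.∈-tabulate⁻ mem₄
  ... | e , refl with extend⁻ k x j e mem₃
  ... | eq , es′ , mem₅ , refl = eq , paths-sound k (head e) j es′ mem₅

  paths-complete : ∀ k x j es → length es < k → Path x (snk j) es → es ∈ paths k x j
  paths-complete (suc k) x j [] _ eq = MemP.∈-++⁺ˡ (trivial⁺ x j eq)
  paths-complete (suc k) x j (e ∷ es) (s≤s lt) (eq , p) =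
    MemP.∈-++⁺ʳ (trivial x j) (MemP.∈-concat⁺′ (extend⁺ k x j e eq (paths-complete k (head e) j es lt p)) (MemP.∈-tabulate⁺ e))

  paths-unique : ∀ k x j → Unique (paths k x j)
  paths-unique zero    x j = []
  paths-unique (suc k) x j = UniqueP.++⁺ trivial-unique
    (UniqueP.concat⁺ (AllP.tabulate⁺ extend-unique) (AllPairsP.tabulate⁺ disjoint)) λ { (mem , mem′) → apart mem mem′ }
    where
    trivial-unique : Unique (trivial x j)
    trivial-unique with x Fin.≟ snk j
    ... | yes _ = [] ∷ []
    ... | no _  = []
    extend-unique : ∀ e → Unique (extend k x j e)
    extend-unique e with tail e Fin.≟ x
    ... | yes _ = UniqueP.map⁺ ListP.∷-injectiveʳ (paths-unique k (head e) j)
    ... | no _  = []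
    disjoint : ∀ {e e′} → e ≢ e′ → ∀ {es} → es ∈ extend k x j e × es ∈ extend k x j e′ → ⊥
    disjoint {e} {e′} ne (mem , mem′) with extend⁻ k x j e mem | extend⁻ k x j e′ mem′
    ... | _ , _ , _ , refl | _ , _ , _ , eq = ne (ListP.∷-injectiveˡ eq)
    apart : ∀ {es} → es ∈ trivial x j → es ∈ concat (tabulate (extend k x j)) → ⊥
    apart mem mem′ with trivial⁻ x j mem
    ... | refl , _ with MemP.∈-concat⁻′ (tabulate (extend k x j)) mem′
    ... | xs , mem₃ , mem₄ with MemP.∈-tabulate⁻ mem₄
    ... | e , refl with extend⁻ k x j e mem₃
    ... | _ , _ , _ , ()

  weightSum : List (List (Fin m)) → Poly m
  weightSum L = sumP (map (pathWeight Γ) L)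

  weightSum-↭ : ∀ {L L′} → L Perm.↭ L′ → weightSum L ≋ weightSum L′
  weightSum-↭ Perm.refl = ≋-refl
  weightSum-↭ (Perm.prep x p) = +P-cong (≋-refl {pathWeight Γ x}) (weightSum-↭ p)
  weightSum-↭ (Perm.swap {xs} {ys} x y p) = ≋-trans (≋-sym (+P-assoc (pathWeight Γ x) (pathWeight Γ y) (weightSum xs)))
    (≋-trans (+P-cong (+P-comm (pathWeight Γ x) (pathWeight Γ y)) (weightSum-↭ p)) (+P-assoc (pathWeight Γ y) (pathWeight Γ x) (weightSum ys)))
  weightSum-↭ (Perm.trans p q) = ≋-trans (weightSum-↭ p) (weightSum-↭ q)

  weightSum-++ : ∀ L L′ → weightSum (L ++ L′) ≋ weightSum L +P weightSum L′
  weightSum-++ [] L′ = ≋-refl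
  weightSum-++ (x ∷ L) L′ = ≋-trans (+P-cong (≋-refl {pathWeight Γ x}) (weightSum-++ L L′)) (≋-sym (+P-assoc (pathWeight Γ x) (weightSum L) (weightSum L′)))

  weightSum-concat : ∀ {k} (f : Fin k → List (List (Fin m))) → weightSum (concat (tabulate f)) ≋ ∑ (weightSum ∘ f)
  weightSum-concat {zero}  f = ≋-sym (∑-zero (λ ()))
  weightSum-concat {suc k} f = ≋-trans (weightSum-++ (f zero) (concat (tabulate (f ∘ suc))))
    (≋-trans (+P-cong (≋-refl {weightSum (f zero)}) (weightSum-concat (f ∘ suc))) (≋-sym (∑-suc (weightSum ∘ f))))

  weightSum-∷ : ∀ e L → weightSum (map (e ∷_) L) ≋ var e *P weightSum L
  weightSum-∷ e [] = ≋-sym (*P-zeroʳ (var e))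
  weightSum-∷ e (x ∷ L) = ≋-trans (+P-cong (≋-refl {var e *P pathWeight Γ x}) (weightSum-∷ e L)) (≋-sym (*P-distribˡ (var e) (pathWeight Γ x) (weightSum L)))

  Enumerates : Fin v → Fin n → List (List (Fin m)) → Set
  Enumerates x j L = Unique L × (∀ es → (es ∈ L → Path x (snk j) es) × (Path x (snk j) es → es ∈ L))

  -- Repetition-free lists with the same members are permutations of each other. So the given
  -- enumeration may be traded for `paths`, whose recursion is known.
  enumeration-≋ : ∀ {x j L L′} → Enumerates x j L → Enumerates x j L′ → weightSum L ≋ weightSum L′
  enumeration-≋ (u , mem) (u′ , mem′) = weightSum-↭ (∼bag⇒↭ (unique∧set⇒bag u u′
    (λ {es} → mk⇔ (λ p → proj₂ (mem′ es) (proj₁ (mem es) p)) (λ p → proj₂ (mem es) (proj₁ (mem′ es) p)))))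

  paths-enumerate : ∀ k → B ≤ k → ∀ x j → Enumerates x j (paths k x j)
  paths-enumerate k B≤k x j = paths-unique k x j , λ es → paths-sound k x j es ,
    λ p → paths-complete k x j es (ℕP.<-≤-trans (path-short x (snk j) es p) B≤k) p

  -- One unit of fuel beyond `B`: after one unfolding `paths B` remains, which is still complete,
  -- and `W` satisfies a recursion in terms of itself.
  W : Fin v → Fin n → Poly m
  W x j = weightSum (paths (suc B) x j)

  W-enumeration : ∀ {x j L} → Enumerates x j L → weightSum L ≋ W x j
  W-enumeration en = enumeration-≋ en (paths-enumerate (suc B) (ℕP.n≤1+n B) _ _)

  outVar : Fin v → Fin m → Poly m
  outVar x e = if does (tail e Fin.≟ x) then var e else 0P

  private
    W-extend : ∀ x j → weightSum (concat (tabulate (extend B x j))) ≋ ∑ (λ e → outVar x e *P W (head e) j)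
    W-extend x j = ≋-trans (weightSum-concat (extend B x j)) (∑-cong step)
      where
      step : ∀ e → weightSum (extend B x j e) ≋ outVar x e *P W (head e) j
      step e with tail e Fin.≟ x
      ... | yes _ = ≋-trans (weightSum-∷ e (paths B (head e) j)) (*P-cong (≋-refl {var e}) (W-enumeration (paths-enumerate B ℕP.≤-refl (head e) j)))
      ... | no _  = ≋-sym (*P-zeroˡ (W (head e) j))

  W-inner : ∀ x → (∀ j → x ≢ snk j) → ∀ j → W x j ≋ ∑ (λ e → outVar x e *P W (head e) j)
  W-inner x inner j = ≋-trans (weightSum-++ (trivial x j) (concat (tabulate (extend B x j))))
    (≋-trans (+P-cong (none (x Fin.≟ snk j)) (W-extend x j)) ≋-refl)
    where
    none : (d : Dec (x ≡ snk j)) → weightSum (if does d then [] ∷ [] else []) ≋ 0P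
    none (yes eq) = ⊥-elim (inner j eq)
    none (no _)   = ≋-refl

  W-sink : ∀ j′ j → W (snk j′) j ≋ (if does (j′ Fin.≟ j) then 1P else 0P)
  W-sink j′ j = ≋-trans (weightSum-++ (trivial (snk j′) j) (concat (tabulate (extend B (snk j′) j))))
    (≋-trans (+P-cong (≋-refl {weightSum (trivial (snk j′) j)}) (≋-trans (W-extend (snk j′) j) (∑-zero stuck)))
      (≋-trans (+P-identityʳ (weightSum (trivial (snk j′) j))) (same (snk j′ Fin.≟ snk j) (j′ Fin.≟ j))))
    where
    stuck : ∀ e → outVar (snk j′) e *P W (head e) j ≋ 0P
    stuck e with tail e Fin.≟ snk j′
    ... | yes eq = ⊥-elim (tail≢snk j′ e eq)
    ... | no _   = *P-zeroˡ (W (head e) j)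
    same : (d : Dec (snk j′ ≡ snk j)) (d′ : Dec (j′ ≡ j)) → weightSum (if does d then [] ∷ [] else []) ≋ (if does d′ then 1P else 0P)
    same (yes _)  (yes _)    = ≋-refl
    same (yes eq) (no ne)    = ⊥-elim (ne (snk-injective j′ j eq))
    same (no ne)  (yes refl) = ⊥-elim (ne refl)
    same (no _)   (no _)     = ≋-refl

-- Disjoint paths keep the order of their ends

prefix-indicator : ∀ {n} (i : Fin n) x → prefix (λ i′ → + ind (i′ Fin.≟ i)) x ≡ + ind (toℕ i <? x)
prefix-indicator i x = trans (sumℤ-single i (λ i′ ne → trans (cong (λ t → + ind (toℕ i′ <? x) ℤ.* + t) (ind-no (i′ Fin.≟ i) ne)) (ℤP.*-zeroʳ (+ ind (toℕ i′ <? x)))))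
  (trans (cong (λ t → + ind (toℕ i <? x) ℤ.* + t) (ind-yes (i Fin.≟ i) refl)) (ℤP.*-identityʳ _))

module NonCrossing {n : ℕ} (Γ : Network n) (acyclic : Acyclic Γ) (ss : SourcesSinks Γ)
                   (σ σ⁻¹ : Dart Γ → Dart Γ) (rot : PlanarRotation Γ σ σ⁻¹) where
  open PlanarNetwork Γ acyclic ss σ σ⁻¹ rot public

  inlet-injective : ∀ {i i′} → inlet i ≡ inlet i′ → i ≡ i′
  inlet-injective {i} {i′} eq = src-injective i i′ (FinP.suc-injective (trans (sym (to-inlet i)) (trans (cong to eq) (to-inlet i′))))

  outlet-injective : ∀ {j j′} → outlet j ≡ outlet j′ → j ≡ j′
  outlet-injective {j} {j′} eq = snk-injective j j′ (FinP.suc-injective (trans (sym (from-outlet j)) (trans (cong from eq) (from-outlet j′))))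

  arc≢inlet : ∀ e i → arc e ≢ inlet i
  arc≢inlet e i eq = FinP.0≢1+n (trans (sym (from-inlet i)) (trans (cong from (sym eq)) (from-arc e)))

  outlet≢inlet : ∀ j i → outlet j ≢ inlet i
  outlet≢inlet j i eq = FinP.0≢1+n (trans (sym (from-inlet i)) (trans (cong from (sym eq)) (from-outlet j)))

  flow-inlet : ∀ {i y} (p : Walk i y) i′ → flow p (inlet i′) ≡ + ind (i′ Fin.≟ i)
  flow-inlet {i} start i′ = cong +_ (ind-⇔ (inlet i′ Fin.≟ inlet i) (i′ Fin.≟ i) inlet-injective (cong inlet))
  flow-inlet (snoc p e _) i′ = trans (cong₂ (λ s t → s ℤ.+ 1ℤ ℤ.* t) (flow-inlet p i′) (unit-other (arc e) (inlet i′) (arc≢inlet e i′ ∘ sym)))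
    (ℤP.+-identityʳ _)

  flow-outlet : ∀ {i y} (p : Walk i y) j → flow p (outlet j) ≡ 0ℤ
  flow-outlet p j = flow-off-to p (outlet j) (λ x eq → ⊥-elim (FinP.0≢1+n (trans (sym (to-outlet j)) eq)))

  module _ {i : Fin n} {j : Fin n} (p : Walk i (snk j)) where

    loop-inlet : ∀ i′ → loop-flow p (inlet i′) ≡ + ind (i′ Fin.≟ i)
    loop-inlet i′ = trans (cong₂ (λ s t → s ℤ.+ 1ℤ ℤ.* t) (flow-inlet p i′) (unit-other (outlet j) (inlet i′) (outlet≢inlet j i′ ∘ sym))) (ℤP.+-identityʳ _)

    loop-outlet : ∀ j′ → loop-flow p (outlet j′) ≡ + ind (j′ Fin.≟ j)
    loop-outlet j′ = trans (cong₂ (λ s t → s ℤ.+ 1ℤ ℤ.* t) (flow-outlet p j′) (cong +_ (ind-⇔ (outlet j′ Fin.≟ outlet j) (j′ Fin.≟ j) outlet-injective (cong outlet))))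
      (trans (ℤP.+-identityˡ _) (ℤP.*-identityˡ _))

    loop-off-to : ∀ x → ¬ On x p → ∀ e → to e ≡ suc x → loop-flow p e ≡ 0ℤ
    loop-off-to x off e te = cong₂ (λ s t → s ℤ.+ 1ℤ ℤ.* t)
      (flow-off-to p e (λ y eq on → off (subst (λ t → On t p) (FinP.suc-injective (trans (sym eq) te)) on)))
      (unit-other (outlet j) e (λ { refl → FinP.0≢1+n (trans (sym (to-outlet j)) te) }))

    loop-off-from : ∀ x → ¬ On x p → ∀ e → from e ≡ suc x → loop-flow p e ≡ 0ℤ
    loop-off-from x off e fe = cong₂ (λ s t → s ℤ.+ 1ℤ ℤ.* t) (flow-off-from p e x fe off)
      (unit-other (outlet j) e (λ { refl → off (subst (λ t → On t p) (FinP.suc-injective (trans (sym (from-outlet j)) fe)) (on-end p)) }))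

    module _ (H : Height (loop-flow p)) where
      open Height H

      -- No edge at a vertex of `q` carries flow of the loop, so the height found at the inlet of
      -- `q` persists along it.
      height-along : ∀ {i′ y} (q : Walk i′ y) → (∀ x → On x q → ¬ On x p) → ∀ d → dartVertex Γ d ≡ suc y → h d ≡ h (out-dart (inlet i′))
      height-along {i′} start off d dy =
        trans (constant-at H (src i′) (loop-off-from _ (off _ refl)) (loop-off-to _ (off _ refl)) d (in-dart (inlet i′)) dy (trans (vertex-in (inlet i′)) (to-inlet i′)))
          (flat H (inlet i′) (loop-off-to _ (off _ refl) (inlet i′) (to-inlet i′)))
      height-along (snoc q e refl) off d dy =
        trans (constant-at H (head e) (loop-off-from _ (off _ (inj₂ refl))) (loop-off-to _ (off _ (inj₂ refl))) d (in-dart (arc e)) dy (trans (vertex-in (arc e)) (to-arc e)))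
          (trans (flat H (arc e) (loop-off-to _ (off _ (inj₂ refl)) (arc e) (to-arc e)))
            (height-along q (λ x on → off x (inj₁ on)) (out-dart (arc e)) (trans (vertex-out (arc e)) (from-arc e))))

  -- The loop through p separates the sources after i from the sinks before j.
  noncrossing : ∀ {i i′ j j′} (p : Walk i (snk j)) (q : Walk i′ (snk j′)) → (∀ x → On x q → ¬ On x p) → i Fin.< i′ → j Fin.< j′
  noncrossing {i} {i′} {j} {j′} p q off i<i′ = ind-pos (toℕ j <? toℕ j′) (ℕP.≤-reflexive (sym (ℤP.+-injective below)))
    where
    H : Height (loop-flow p)
    H = height (loop-flow p) (loop-closed p)
    open Height H
    X₀ : ℤ
    X₀ = proj₁ (boundary-height H)
    cancel : ∀ {a b c : ℤ} → a ℤ.- b ≡ a ℤ.- c → b ≡ c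
    cancel {a} {b} {c} eq = trans (twice a b) (trans (cong (ℤ._-_ a) eq) (sym (twice a c)))
      where
      twice : ∀ a b → b ≡ a ℤ.- (a ℤ.- b)
      twice = solve-∀
    -- The height is the same at both ends of `q`: at the inlet `i′` it is `X₀` minus one, because
    -- `i` precedes `i′`, and at the outlet `j′` it is `X₀` minus the indicator of `j` preceding
    -- `j′`.
    below : + ind (toℕ j <? toℕ j′) ≡ 1ℤ
    below = cancel {X₀}
      (trans (cong (ℤ._-_ X₀) (sym (trans (prefix-cong (loop-outlet p) (toℕ j′)) (prefix-indicator j (toℕ j′)))))
        (trans (sym (proj₂ (proj₂ (boundary-height H)) j′))
          (trans (flat H (outlet j′) (loop-off-from p (snk j′) (off _ (on-end q)) (outlet j′) (from-outlet j′)))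
            (trans (height-along p H q off (out-dart (outlet j′)) (trans (vertex-out (outlet j′)) (from-outlet j′)))
              (trans (proj₁ (proj₂ (boundary-height H)) i′)
                (cong (ℤ._-_ X₀) (trans (prefix-cong (loop-inlet p) (suc (toℕ i′))) (trans (prefix-indicator i (suc (toℕ i′)))
                  (cong +_ (ind-yes (toℕ i <? suc (toℕ i′)) (ℕP.m<n⇒m<1+n i<i′)))))))))))

-- Endpoints with multiplicity, and coincidence determinants

tally : ∀ {k N} → (Fin k → Fin N) → Fin N → ℕ
tally c i = sumℕ (λ r → ind (c r Fin.≟ i))

tally-hit : ∀ {k N} (c : Fin k → Fin N) r → 1 ≤ tally c (c r)
tally-hit c r = subst (_≤ tally c (c r)) (ind-yes (c r Fin.≟ c r) refl) (term≤sumℕ (λ s → ind (c s Fin.≟ c r)) r)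

tally-miss : ∀ {k N} (c : Fin k → Fin N) i → (∀ r → c r ≢ i) → tally c i ≡ 0
tally-miss c i miss = sumℕ-zero (λ r → ind-no (c r Fin.≟ i) (miss r))

tally-map : ∀ {k N N′} (f : Fin N → Fin N′) → (∀ i i′ → f i ≡ f i′ → i ≡ i′) → ∀ (c : Fin k → Fin N) i → tally (f ∘ c) (f i) ≡ tally c i
tally-map f inj c i = sumℕ-cong (λ r → ind-⇔ (f (c r) Fin.≟ f i) (c r Fin.≟ i) (inj (c r) i) (cong f))

increasing-tail : ∀ {k n} {c : Fin (suc k) → Fin n} → StrictlyIncreasing c → StrictlyIncreasing (c ∘ suc)
increasing-tail inc r s r<s = inc (suc r) (suc s) (s≤s r<s)

increasing-injective : ∀ {k n} {c : Fin k → Fin n} → StrictlyIncreasing c → ∀ r s → c r ≡ c s → r ≡ s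
increasing-injective inc r s eq with FinP.<-cmp r s
... | tri< lt _ _ = ⊥-elim (ℕP.<⇒≢ (inc r s lt) (cong toℕ eq))
... | tri≈ _ p _  = p
... | tri> _ _ gt = ⊥-elim (ℕP.<⇒≢ (inc s r gt) (cong toℕ (sym eq)))

head-least : ∀ {k n} {c : Fin (suc k) → Fin n} → StrictlyIncreasing c → ∀ r → c zero Fin.≤ c r
head-least inc zero    = ℕP.≤-refl
head-least inc (suc r) = ℕP.<⇒≤ (inc zero (suc r) (s≤s z≤n))

move : ∀ {k N} → (Fin k → Fin N) → Fin k → Fin N → Fin k → Fin N
move u r y s = if does (s Fin.≟ r) then y else u s

module _ {k N : ℕ} (u : Fin k → Fin N) (r : Fin k) (y : Fin N) where

  move-at : move u r y r ≡ y
  move-at with r Fin.≟ r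
  ... | yes _ = refl
  ... | no ne = ⊥-elim (ne refl)

  move-off : ∀ s → s ≢ r → move u r y s ≡ u s
  move-off s ne with s Fin.≟ r
  ... | yes eq = ⊥-elim (ne eq)
  ... | no _   = refl

  tally-move : ∀ w → tally (move u r y) w + ind (u r Fin.≟ w) ≡ tally u w + ind (y Fin.≟ w)
  tally-move w = trans (cong (_+_ (tally (move u r y) w)) (sym (at-r (ind (u r Fin.≟ w)))))
    (trans (sym (sumℕ-+ (λ s → ind (move u r y s Fin.≟ w)) (λ s → ind (s Fin.≟ r) * ind (u r Fin.≟ w))))
      (trans (sumℕ-cong pointwise)
        (trans (sumℕ-+ (λ s → ind (u s Fin.≟ w)) (λ s → ind (s Fin.≟ r) * ind (y Fin.≟ w)))
          (cong (_+_ (tally u w)) (at-r (ind (y Fin.≟ w)))))))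
    where
    at-r : ∀ a → sumℕ (λ s → ind (s Fin.≟ r) * a) ≡ a
    at-r a = trans (sumℕ-single r (λ s ne → cong (_* a) (ind-no (s Fin.≟ r) ne))) (trans (cong (_* a) (ind-yes (r Fin.≟ r) refl)) (ℕP.*-identityˡ a))
    pointwise : ∀ s → ind (move u r y s Fin.≟ w) + ind (s Fin.≟ r) * ind (u r Fin.≟ w) ≡ ind (u s Fin.≟ w) + ind (s Fin.≟ r) * ind (y Fin.≟ w)
    pointwise s with s Fin.≟ r
    ... | yes refl = trans (cong (_+_ (ind (y Fin.≟ w))) (ℕP.*-identityˡ _)) (trans (ℕP.+-comm (ind (y Fin.≟ w)) (ind (u s Fin.≟ w))) (cong (_+_ (ind (u s Fin.≟ w))) (sym (ℕP.*-identityˡ _))))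
    ... | no _     = refl

module _ {m : ℕ} where
  open PolyDet {m}

  -- If the first entries differ, the smaller one is missing from the other sequence and gives a
  -- zero row or column; if they agree, the corner splits off. A difference is reported through
  -- tallies because these contradict the balance in `Valid`.
  coincidence-det : ∀ k {n} (c J : Fin k → Fin n) → StrictlyIncreasing c → StrictlyIncreasing J → (M : Matrix k) →
    (∀ r s → M r s ≋ (if does (c r Fin.≟ J s) then 1P else 0P)) →
    ((∀ r → c r ≡ J r) × Det k M ≋ 1P) ⊎ ((∃ λ i → tally c i ≢ tally J i) × Det k M ≋ 0P)
  coincidence-det zero c J _ _ M eq = inj₁ ((λ ()) , ≋-refl)
  coincidence-det (suc k) c J ic iJ M eq = split (FinP.<-cmp (c zero) (J zero))
    where
    hit : ∀ r s → c r ≡ J s → M r s ≋ 1P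
    hit r s p = ≋-trans (eq r s) (go (c r Fin.≟ J s))
      where
      go : (d : Dec (c r ≡ J s)) → (if does d then 1P else 0P) ≋ 1P
      go (yes _) = ≋-refl
      go (no ne) = ⊥-elim (ne p)
    miss : ∀ r s → c r ≢ J s → M r s ≋ 0P
    miss r s p = ≋-trans (eq r s) (go (c r Fin.≟ J s))
      where
      go : (d : Dec (c r ≡ J s)) → (if does d then 1P else 0P) ≋ 0P
      go (yes q) = ⊥-elim (p q)
      go (no _)  = ≋-refl
    split : _ → ((∀ r → c r ≡ J r) × Det (suc k) M ≋ 1P) ⊎ ((∃ λ i → tally c i ≢ tally J i) × Det (suc k) M ≋ 0P)
    split (tri< lt _ _) = inj₂ ((c zero , λ same → ℕP.1+n≰n (subst (1 ≤_) (trans same (tally-miss J (c zero) (λ s → before s ∘ sym))) (tally-hit c zero)))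
                               , Det-zero-row k M (λ s → miss zero s (before s)))
      where
      before : ∀ s → c zero ≢ J s
      before s p = ℕP.<⇒≢ (ℕP.<-≤-trans lt (head-least iJ s)) (cong toℕ p)
    split (tri> _ _ gt) = inj₂ ((J zero , λ same → ℕP.1+n≰n (subst (1 ≤_) (trans (sym same) (tally-miss c (J zero) after)) (tally-hit J zero)))
                               , Det-zero-column k M (λ r → miss r zero (after r)))
      where
      after : ∀ r → c r ≢ J zero
      after r p = ℕP.<⇒≢ (ℕP.<-≤-trans gt (head-least ic r)) (cong toℕ (sym p))
    split (tri≈ _ same _) with coincidence-det k (c ∘ suc) (J ∘ suc) (increasing-tail ic) (increasing-tail iJ) (λ r s → M (suc r) (suc s)) (λ r s → eq (suc r) (suc s))
    ... | inj₁ (all , one) = inj₁ ((λ { zero → same ; (suc r) → all r }) , ≋-trans corner one)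
      where
      corner = Det-corner k M (hit zero zero same) (λ s → miss zero (suc s) (λ p → ℕP.<⇒≢ (iJ zero (suc s) (s≤s z≤n)) (cong toℕ (trans (sym same) p))))
    ... | inj₂ ((i , ne) , none) = inj₂ ((i , λ p → ne (ℕP.+-cancelˡ-≡ (ind (c zero Fin.≟ i)) _ _ (trans p (cong (λ t → ind (t Fin.≟ i) + tally (J ∘ suc) i) (sym same))))) , ≋-trans corner none)
      where
      corner = Det-corner k M (hit zero zero same) (λ s → miss zero (suc s) (λ p → ℕP.<⇒≢ (iJ zero (suc s) (s≤s z≤n)) (cong toℕ (trans (sym same) p))))

sum-unique : ∀ {m} {A : Set} {Q : Fin m → Set} (a? : Dec A) (Q? : ∀ e → Dec (Q e)) → (A → ∃ Q) → (∀ e → Q e → A) → (∀ e e′ → Q e → Q e′ → e ≡ e′) →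
             sumℤ (λ e → + ind (Q? e)) ≡ + ind a?
sum-unique (no ¬a) Q? ex all uniq = sumℤ-zero (λ e → cong +_ (ind-no (Q? e) (¬a ∘ all e)))
sum-unique (yes a) Q? ex all uniq = let e , q = ex a in
  trans (sumℤ-single e (λ e′ ne → cong +_ (ind-no (Q? e′) (λ q′ → ne (uniq e′ e q′ q))))) (cong +_ (ind-yes (Q? e) q))

-- The Lindström–Gessel–Viennot lemma in coefficient form

module LGV {n : ℕ} (Γ : Network n) (acyclic : Acyclic Γ) (ss : SourcesSinks Γ)
           (σ σ⁻¹ : Dart Γ → Dart Γ) (rot : PlanarRotation Γ σ σ⁻¹)
           {k : ℕ} (I J : Fin k → Fin n) (incI : StrictlyIncreasing I) (incJ : StrictlyIncreasing J) where
  open NonCrossing Γ acyclic ss σ σ⁻¹ rot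
  open PathWeights Γ acyclic tail≢snk snk-injective
  open PolyDet {m}

  private
    B : ℕ
    B = keyBound tail head acyclic

  ins outs : Monomial m → Fin v → ℕ
  ins μ w  = sumℕ (λ e → ind (head e Fin.≟ w) * Vec.lookup μ e)
  outs μ w = sumℕ (λ e → ind (tail e Fin.≟ w) * Vec.lookup μ e)

  -- μ is a disjoint union of paths from the vertices u to the sinks J, all edges of which leave vertices of order at least x.
  record Valid (x : ℕ) (μ : Monomial m) (u : Fin k → Fin v) : Set where
    constructor valid
    field
      balance : ∀ w → ins μ w + tally u w ≡ outs μ w + tally (snk ∘ J) w
      bound   : ∀ w → ins μ w + tally u w ≤ 1
      above   : ∀ e → ord (tail e) < x → Vec.lookup μ e ≡ 0

  valid? : ∀ x μ u → Dec (Valid x μ u)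
  valid? x μ u = map′ (λ { (a , b , c) → valid a b c }) (λ { (valid a b c) → a , b , c })
    (FinP.all? (λ w → ins μ w + tally u w ℕ.≟ outs μ w + tally (snk ∘ J) w)
      ×-dec (FinP.all? (λ w → ins μ w + tally u w ≤? 1)
      ×-dec FinP.all? (λ e → (ord (tail e) <? x) →-dec (Vec.lookup μ e ℕ.≟ 0))))

  D : (Fin k → Fin v) → Poly m
  D u = Det k (λ r c → W (u r) (J c))

  inner⇒untargeted : ∀ w → (∀ j → w ≢ snk j) → tally (snk ∘ J) w ≡ 0
  inner⇒untargeted w inner = tally-miss (snk ∘ J) w (λ r eq → inner (J r) (sym eq))

  module _ (end : Fin m → Fin v) (μ : Monomial m) (w : Fin v) where

    edge≤end : ∀ e → end e ≡ w → Vec.lookup μ e ≤ sumℕ (λ e → ind (end e Fin.≟ w) * Vec.lookup μ e)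
    edge≤end e eq = subst (_≤ sumℕ (λ e → ind (end e Fin.≟ w) * Vec.lookup μ e)) (trans (cong (_* Vec.lookup μ e) (ind-yes (end e Fin.≟ w) eq)) (ℕP.*-identityˡ _))
      (term≤sumℕ (λ e → ind (end e Fin.≟ w) * Vec.lookup μ e) e)

    edges≤end : ∀ e e′ → e ≢ e′ → end e ≡ w → end e′ ≡ w → Vec.lookup μ e + Vec.lookup μ e′ ≤ sumℕ (λ e → ind (end e Fin.≟ w) * Vec.lookup μ e)
    edges≤end e e′ ne eq eq′ = subst (_≤ sumℕ (λ e → ind (end e Fin.≟ w) * Vec.lookup μ e))
      (cong₂ _+_ (trans (cong (_* Vec.lookup μ e) (ind-yes (end e Fin.≟ w) eq)) (ℕP.*-identityˡ _)) (trans (cong (_* Vec.lookup μ e′) (ind-yes (end e′ Fin.≟ w) eq′)) (ℕP.*-identityˡ _)))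
      (two-terms≤sumℕ (λ e → ind (end e Fin.≟ w) * Vec.lookup μ e) ne)

    end-zero : (∀ e → end e ≡ w → Vec.lookup μ e ≡ 0) → sumℕ (λ e → ind (end e Fin.≟ w) * Vec.lookup μ e) ≡ 0
    end-zero zeros = sumℕ-zero go
      where
      go : ∀ e → ind (end e Fin.≟ w) * Vec.lookup μ e ≡ 0
      go e with end e Fin.≟ w
      ... | yes eq = trans (ℕP.*-identityˡ _) (zeros e eq)
      ... | no _   = refl

    end-remove : ∀ e → 1 ≤ Vec.lookup μ e →
      sumℕ (λ e′ → ind (end e′ Fin.≟ w) * Vec.lookup μ e′) ≡ sumℕ (λ e′ → ind (end e′ Fin.≟ w) * Vec.lookup (μ ⊖ monomial e) e′) + ind (end e Fin.≟ w)
    end-remove e pos = trans (sumℕ-cong (λ e′ → trans (cong (_*_ (ind (end e′ Fin.≟ w))) (split e′)) (ℕP.*-distribˡ-+ (ind (end e′ Fin.≟ w)) _ _)))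
      (trans (sumℕ-+ (λ e′ → ind (end e′ Fin.≟ w) * Vec.lookup (μ ⊖ monomial e) e′) (λ e′ → ind (end e′ Fin.≟ w) * ind (e′ Fin.≟ e)))
        (cong (_+_ (sumℕ (λ e′ → ind (end e′ Fin.≟ w) * Vec.lookup (μ ⊖ monomial e) e′)))
          (trans (sumℕ-single e (λ e′ ne → trans (cong (_*_ (ind (end e′ Fin.≟ w))) (ind-no (e′ Fin.≟ e) ne)) (ℕP.*-zeroʳ (ind (end e′ Fin.≟ w)))))
            (trans (cong (_*_ (ind (end e Fin.≟ w))) (ind-yes (e Fin.≟ e) refl)) (ℕP.*-identityʳ _)))))
      where
      split : ∀ e′ → Vec.lookup μ e′ ≡ Vec.lookup (μ ⊖ monomial e) e′ + ind (e′ Fin.≟ e)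
      split e′ = sym (trans (cong₂ _+_ (lookup-⊖ μ (monomial e) e′) (sym (lookup-monomial e e′))) (ℕP.m∸n+n≡m (subst (_≤ Vec.lookup μ e′) (sym (lookup-monomial e e′)) (below (e′ Fin.≟ e)))))
        where
        below : (d : Dec (e′ ≡ e)) → ind d ≤ Vec.lookup μ e′
        below (yes refl) = pos
        below (no _)     = z≤n

  module Step (x : ℕ) (u : Fin k → Fin v) (r : Fin k) (inner : ∀ j → u r ≢ snk j) (now : ord (u r) ≡ x) (μ : Monomial m) where

    Next : Fin m → Set
    Next e = tail e ≡ u r × 1 ≤ Vec.lookup μ e × Valid (suc x) (μ ⊖ monomial e) (move u r (head e))

    next? : ∀ e → Dec (Next e)
    next? e = (tail e Fin.≟ u r) ×-dec ((1 ≤? Vec.lookup μ e) ×-dec valid? (suc x) (μ ⊖ monomial e) (move u r (head e)))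

    module _ (e : Fin m) (te : tail e ≡ u r) (pos : 1 ≤ Vec.lookup μ e) where
      private
        μ′ = μ ⊖ monomial e
        u′ = move u r (head e)

      arrivals : ∀ w → ins μ w + tally u w ≡ ins μ′ w + tally u′ w + ind (u r Fin.≟ w)
      arrivals w = trans (cong (_+ tally u w) (end-remove head μ w e pos)) (trans (ℕP.+-assoc (ins μ′ w) _ _)
        (trans (cong (_+_ (ins μ′ w)) (trans (ℕP.+-comm (ind (head e Fin.≟ w)) (tally u w)) (sym (tally-move u r (head e) w)))) (sym (ℕP.+-assoc (ins μ′ w) _ _))))

      departures : ∀ w → outs μ w + tally (snk ∘ J) w ≡ outs μ′ w + tally (snk ∘ J) w + ind (u r Fin.≟ w)
      departures w = trans (cong (_+ tally (snk ∘ J) w) (trans (end-remove tail μ w e pos) (cong (λ t → outs μ′ w + ind (t Fin.≟ w)) te)))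
        (trans (ℕP.+-assoc (outs μ′ w) _ _) (trans (cong (_+_ (outs μ′ w)) (ℕP.+-comm (ind (u r Fin.≟ w)) _)) (sym (ℕP.+-assoc (outs μ′ w) _ _))))

      lookup-removed : ∀ e′ → Vec.lookup μ′ e′ ≤ Vec.lookup μ e′
      lookup-removed e′ = subst (_≤ Vec.lookup μ e′) (sym (lookup-⊖ μ (monomial e) e′)) (ℕP.m∸n≤m (Vec.lookup μ e′) (Vec.lookup (monomial e) e′))

      lookup-kept : ∀ e′ → e′ ≢ e → Vec.lookup μ e′ ≡ Vec.lookup μ′ e′
      lookup-kept e′ ne = sym (trans (lookup-⊖ μ (monomial e) e′) (cong (Vec.lookup μ e′ ∸_) (trans (lookup-monomial e e′) (ind-no (e′ Fin.≟ e) ne))))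

      -- As `key` is injective, all edges leaving at order `x` leave `u r`. The bound allows only
      -- one of them, and that one is `e`.
      descend : Valid x μ u → Valid (suc x) μ′ u′
      descend (valid bal bnd abv) = valid bal′ bnd′ abv′
        where
        bal′ : ∀ w → ins μ′ w + tally u′ w ≡ outs μ′ w + tally (snk ∘ J) w
        bal′ w = ℕP.+-cancelʳ-≡ (ind (u r Fin.≟ w)) _ _ (trans (sym (arrivals w)) (trans (bal w) (departures w)))
        bnd′ : ∀ w → ins μ′ w + tally u′ w ≤ 1
        bnd′ w = ℕP.≤-trans (ℕP.m≤m+n _ (ind (u r Fin.≟ w))) (subst (_≤ 1) (arrivals w) (bnd w))
        left-none : outs μ′ (u r) ≡ 0
        left-none = ℕP.n≤0⇒n≡0 (ℕP.≤-trans (ℕP.m≤m+n _ _) (ℕP.≤-pred (subst (_≤ 1) (trans (bal (u r)) (trans (departures (u r)) (trans (cong (_+_ (outs μ′ (u r) + tally (snk ∘ J) (u r))) (ind-yes (u r Fin.≟ u r) refl)) (ℕP.+-comm _ 1)))) (bnd (u r)))))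
        abv′ : ∀ e′ → ord (tail e′) < suc x → Vec.lookup μ′ e′ ≡ 0
        abv′ e′ lt with ℕP.m≤n⇒m<n∨m≡n (ℕP.≤-pred lt)
        ... | inj₁ lt′ = ℕP.n≤0⇒n≡0 (subst (Vec.lookup μ′ e′ ≤_) (abv e′ lt′) (lookup-removed e′))
        ... | inj₂ eq  = ℕP.n≤0⇒n≡0 (subst (Vec.lookup μ′ e′ ≤_) left-none (edge≤end tail μ′ (u r) e′ (key-injective tail head acyclic (trans eq (sym now)))))

      -- The point at issue is the bound at `u r`. No edge of `μ′` leaves it, its order being `x`,
      -- and it is no sink; so by balance nothing else arrives there.
      ascend : Valid (suc x) μ′ u′ → Valid x μ u
      ascend (valid bal bnd abv) = valid bal′ bnd′ abv′
        where
        bal′ : ∀ w → ins μ w + tally u w ≡ outs μ w + tally (snk ∘ J) w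
        bal′ w = trans (arrivals w) (trans (cong (_+ ind (u r Fin.≟ w)) (bal w)) (sym (departures w)))
        empty : ins μ′ (u r) + tally u′ (u r) ≡ 0
        empty = trans (bal (u r)) (cong₂ _+_ (end-zero tail μ′ (u r) (λ e′ eq → abv e′ (s≤s (ℕP.≤-reflexive (trans (cong ord eq) now))))) (inner⇒untargeted (u r) inner))
        bnd′ : ∀ w → ins μ w + tally u w ≤ 1
        bnd′ w with u r Fin.≟ w
        ... | yes refl = ℕP.≤-reflexive (trans (arrivals w) (cong₂ _+_ empty (ind-yes (w Fin.≟ w) refl)))
        ... | no ne    = subst (_≤ 1) (sym (trans (arrivals w) (trans (cong (_+_ (ins μ′ w + tally u′ w)) (ind-no (u r Fin.≟ w) ne)) (ℕP.+-identityʳ _)))) (bnd w)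
        abv′ : ∀ e′ → ord (tail e′) < x → Vec.lookup μ e′ ≡ 0
        abv′ e′ lt = trans (lookup-kept e′ (λ { refl → ℕP.<⇒≢ lt (trans (cong ord te) now) })) (abv e′ (ℕP.m<n⇒m<1+n lt))

    departs : Valid x μ u → ∃ Next
    departs val@(valid bal bnd abv) with sumℕ-pos (λ e → ind (tail e Fin.≟ u r) * Vec.lookup μ e) (subst (1 ≤_) leaves (ℕP.≤-trans (tally-hit u r) (ℕP.m≤n+m _ _)))
      where
      leaves : ins μ (u r) + tally u (u r) ≡ outs μ (u r)
      leaves = trans (bal (u r)) (trans (cong (_+_ (outs μ (u r))) (inner⇒untargeted (u r) inner)) (ℕP.+-identityʳ _))
    ... | e , pos = e , te , has , descend e te has val
      where
      both : tail e ≡ u r × 1 ≤ Vec.lookup μ e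
      both = go (tail e Fin.≟ u r) pos
        where
        go : (d : Dec (tail e ≡ u r)) → 1 ≤ ind d * Vec.lookup μ e → tail e ≡ u r × 1 ≤ Vec.lookup μ e
        go (yes eq) p = eq , subst (1 ≤_) (ℕP.*-identityˡ _) p
        go (no _) ()
      te = proj₁ both
      has = proj₂ both

    next-unique : ∀ e e′ → Next e → Next e′ → e ≡ e′
    next-unique e e′ (te , pos , val) (te′ , pos′ , _) with e Fin.≟ e′
    ... | yes eq = eq
    ... | no ne = ⊥-elim (ℕP.1+n≰n (ℕP.≤-trans (ℕP.+-mono-≤ pos pos′) (ℕP.≤-trans (edges≤end tail μ (u r) e e′ ne te te′)
            (ℕP.≤-trans (ℕP.m≤m+n _ _) (subst (_≤ 1) (Valid.balance up (u r)) (Valid.bound up (u r)))))))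
      where
      up : Valid x μ u
      up = ascend e te pos val

    expansion : coeff (D u) μ ≡ sumℤ (λ e → coeff (outVar (u r) e *P D (move u r (head e))) μ)
    expansion = trans (coeff-cong (Det-linear k r (λ s c → W (u s) (J c)) (λ e s c → W (move u r (head e) s) (J c)) (outVar (u r))
        (λ c → ≋-trans (W-inner (u r) inner (J c)) (∑-cong (λ e → *P-cong (≋-refl {outVar (u r) e}) (≋-reflexive (cong (λ t → W t (J c)) (sym (move-at u r (head e))))))))
        (λ e s c ne → ≋-reflexive (cong (λ t → W t (J c)) (move-off u r (head e) s ne)))) μ)
      (coeff-∑ (λ e → outVar (u r) e *P D (move u r (head e))) μ)

    summand : ∀ e → (tail e ≡ u r → ∀ μ′ → coeff (D (move u r (head e))) μ′ ≡ + ind (valid? (suc x) μ′ (move u r (head e)))) →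
              coeff (outVar (u r) e *P D (move u r (head e))) μ ≡ + ind (next? e)
    summand e ih = go (tail e Fin.≟ u r) (1 ≤? Vec.lookup μ e)
      where
      go : (d : Dec (tail e ≡ u r)) (d′ : Dec (1 ≤ Vec.lookup μ e)) →
           coeff ((if does d then var e else 0P) *P D (move u r (head e))) μ ≡ + ind (next? e)
      go (yes te) (yes pos) = trans (coeff-var-pos e (D (move u r (head e))) μ pos) (trans (ih te (μ ⊖ monomial e))
        (cong +_ (ind-⇔ (valid? (suc x) (μ ⊖ monomial e) (move u r (head e))) (next? e) (λ val → te , pos , val) (λ { (_ , _ , val) → val }))))
      go (yes te) (no zero′) = trans (coeff-var-zero e (D (move u r (head e))) μ (ℕP.n≤0⇒n≡0 (ℕP.≤-pred (ℕP.≰⇒> zero′)))) (cong +_ (sym (ind-no (next? e) (λ { (_ , pos , _) → zero′ pos }))))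
      go (no ne) _ = trans (coeff-cong (*P-zeroˡ (D (move u r (head e)))) μ) (cong +_ (sym (ind-no (next? e) (λ { (te , _) → ne te }))))

    -- Expanding row `r` over the edges at `u r` mirrors removing the first edge of path `r` from
    -- `μ`. A valid `μ` has exactly one such edge and an invalid one has none, so the sum of
    -- indicators is again an indicator.
    step : (∀ e → tail e ≡ u r → ∀ μ′ → coeff (D (move u r (head e))) μ′ ≡ + ind (valid? (suc x) μ′ (move u r (head e)))) → coeff (D u) μ ≡ + ind (valid? x μ u)
    step ih = trans expansion (trans (sumℤ-cong (λ e → summand e (ih e))) (sum-unique (valid? x μ u) next? departs (λ { e (te , pos , val) → ascend e te pos val }) next-unique))

  -- How the positions `u` were reached. The determinant does not see this, but it is needed at the
  -- end: disjointness of the walks forces the sinks reached to be in increasing order.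
  record History (x : ℕ) (u : Fin k → Fin v) : Set where
    field
      walk     : ∀ r → Walk (I r) (u r)
      disjoint : ∀ r s → r ≢ s → ∀ y → On y (walk r) → ¬ On y (walk s)
      settled  : ∀ r y → On y (walk r) → ord y < x ⊎ y ≡ u r

  module _ {x : ℕ} {u : Fin k → Fin v} (hist : History x u) where
    open History hist

    history-injective : ∀ r s → r ≢ s → u r ≢ u s
    history-injective r s ne eq = disjoint r s ne (u r) (on-end (walk r)) (subst (λ t → On t (walk s)) (sym eq) (on-end (walk s)))

    later : History (suc x) u
    later = record { walk = walk ; disjoint = disjoint ; settled = λ r y on → [ (λ lt → inj₁ (ℕP.m<n⇒m<1+n lt)) , inj₂ ]′ (settled r y on) }

    module _ (r : Fin k) (e : Fin m) (te : tail e ≡ u r) (now : ord (u r) ≡ x) (free : ∀ s → s ≢ r → u s ≢ head e) where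

      private
        new : ∀ s → Dec (s ≡ r) → Σ (Fin v) (Walk (I s))
        new s (yes refl) = head e , snoc (walk s) e te
        new s (no _)     = u s , walk s

        new-end : ∀ s (d : Dec (s ≡ r)) → proj₁ (new s d) ≡ (if does d then head e else u s)
        new-end s (yes refl) = refl
        new-end s (no _)     = refl

        new-on : ∀ s (d : Dec (s ≡ r)) y → On y (proj₂ (new s d)) → On y (walk s) ⊎ (s ≡ r × y ≡ head e)
        new-on s (yes refl) y (inj₁ on) = inj₁ on
        new-on s (yes refl) y (inj₂ eq) = inj₂ (refl , eq)
        new-on s (no _)     y on        = inj₁ on

        on-subst : ∀ {i y z} (eq : y ≡ z) (p : Walk i y) x → On x (subst (Walk i) eq p) → On x p
        on-subst refl p x on = on

        fresh-head : ∀ s → s ≢ r → ¬ On (head e) (walk s)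
        fresh-head s ne on with settled s (head e) on
        ... | inj₁ lt = ℕP.<-asym lt (subst (_< ord (head e)) (trans (cong ord te) now) (ord-edge e))
        ... | inj₂ eq = free s ne (sym eq)

      advance : History (suc x) (move u r (head e))
      advance = record
        { walk = λ s → subst (Walk (I s)) (new-end s (s Fin.≟ r)) (proj₂ (new s (s Fin.≟ r)))
        ; disjoint = λ s t ne y on on′ → apart s t ne y
            (new-on s (s Fin.≟ r) y (on-subst (new-end s (s Fin.≟ r)) _ y on)) (new-on t (t Fin.≟ r) y (on-subst (new-end t (t Fin.≟ r)) _ y on′))
        ; settled = λ s y on → settled′ s y (new-on s (s Fin.≟ r) y (on-subst (new-end s (s Fin.≟ r)) _ y on)) }
        where
        apart : ∀ s t → s ≢ t → ∀ y → On y (walk s) ⊎ (s ≡ r × y ≡ head e) → On y (walk t) ⊎ (t ≡ r × y ≡ head e) → ⊥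
        apart s t ne y (inj₁ on) (inj₁ on′) = disjoint s t ne y on on′
        apart s t ne y (inj₁ on) (inj₂ (refl , refl)) = fresh-head s ne on
        apart s t ne y (inj₂ (refl , refl)) (inj₁ on) = fresh-head t (ne ∘ sym) on
        apart s t ne y (inj₂ (refl , _)) (inj₂ (refl , _)) = ne refl
        settled′ : ∀ s y → On y (walk s) ⊎ (s ≡ r × y ≡ head e) → ord y < suc x ⊎ y ≡ move u r (head e) s
        settled′ s y (inj₂ (refl , eq)) = inj₂ (trans eq (sym (move-at u r (head e))))
        settled′ s y (inj₁ on) with settled s y on
        ... | inj₁ lt = inj₁ (ℕP.m<n⇒m<1+n lt)
        ... | inj₂ eq with s Fin.≟ r
        ... | yes refl = inj₁ (s≤s (ℕP.≤-reflexive (trans (cong ord eq) now)))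
        ... | no _     = inj₂ eq

  Pending : ℕ → (Fin k → Fin v) → Set
  Pending x u = ∀ r → x ≤ ord (u r) ⊎ (∃ λ j → u r ≡ snk j)

  private
    cast-walk : ∀ {i y z} → y ≡ z → Walk i y → Walk i z
    cast-walk refl p = p

    on-cast : ∀ {i y z} (eq : y ≡ z) (p : Walk i y) x → On x (cast-walk eq p) → On x p
    on-cast refl p x on = on

  -- With threshold `B` validity leaves no edge in `μ`, so the balance says that the sinks reached
  -- are those of `J`. The matrix has become a coincidence matrix, with determinant one in this case
  -- and zero otherwise.
  finish-at : ∀ u (c : Fin k → Fin n) → (∀ r → u r ≡ snk (c r)) → StrictlyIncreasing c → ∀ μ → coeff (D u) μ ≡ + ind (valid? B μ u)
  finish-at u c at-sink increasing μ = go (coincidence-det k c J increasing incJ (λ r s → W (u r) (J s))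
      (λ r s → ≋-trans (≋-reflexive (cong (λ t → W t (J s)) (at-sink r))) (W-sink (c r) (J s))))
    where
    loads : ∀ w → tally u w ≡ tally (snk ∘ c) w
    loads w = sumℕ-cong (λ r → cong (λ t → ind (t Fin.≟ w)) (at-sink r))
    vanish : ∀ {u} → Valid B μ u → Vec.replicate m 0 ≡ μ
    vanish val = lookup-ext (λ e → trans (VecP.lookup-replicate e 0) (sym (Valid.above val e (key-bound tail head acyclic (tail e)))))
    empty : (end : Fin m → Fin v) → Vec.replicate m 0 ≡ μ → ∀ w → sumℕ (λ e → ind (end e Fin.≟ w) * Vec.lookup μ e) ≡ 0
    empty end refl w = end-zero end (Vec.replicate m 0) w (λ e _ → VecP.lookup-replicate e 0)
    go : ((∀ r → c r ≡ J r) × D u ≋ 1P) ⊎ ((∃ λ i → tally c i ≢ tally J i) × D u ≋ 0P) → coeff (D u) μ ≡ + ind (valid? B μ u)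
    go (inj₁ (same , one)) = trans (coeff-cong one μ) (trans (coeff-one μ) (cong +_ (ind-⇔ (Vec.replicate m 0 ≟ᵐ μ) (valid? B μ u) to-valid vanish)))
      where
      targets : ∀ w → tally u w ≡ tally (snk ∘ J) w
      targets w = trans (loads w) (sumℕ-cong (λ r → cong (λ t → ind (snk t Fin.≟ w)) (same r)))
      at-most-one : ∀ w → tally (snk ∘ J) w ≤ 1
      at-most-one w with FinP.any? (λ r → snk (J r) Fin.≟ w)
      ... | no none = ℕP.≤-trans (ℕP.≤-reflexive (tally-miss (snk ∘ J) w (λ r eq → none (r , eq)))) z≤n
      ... | yes (r , eq) = ℕP.≤-trans (ℕP.≤-reflexive (sumℕ-single r (λ s ne → ind-no (snk (J s) Fin.≟ w) (λ eq′ → ne (increasing-injective incJ s r (snk-injective _ _ (trans eq′ (sym eq)))))))) (ind-≤1 (snk (J r) Fin.≟ w))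
      to-valid : Vec.replicate m 0 ≡ μ → Valid B μ u
      to-valid eq = valid (λ w → trans (cong₂ _+_ (empty head eq w) (targets w)) (sym (cong (_+ tally (snk ∘ J) w) (empty tail eq w))))
        (λ w → subst (_≤ 1) (sym (cong₂ _+_ (empty head eq w) (targets w))) (at-most-one w))
        (λ e _ → trans (cong (λ t → Vec.lookup t e) (sym eq)) (VecP.lookup-replicate e 0))
    go (inj₂ ((i , ne) , none)) = trans (coeff-cong none μ) (cong +_ (sym (ind-no (valid? B μ u) invalid)))
      where
      invalid : ¬ Valid B μ u
      invalid val = ne (trans (sym (tally-map snk snk-injective c i)) (trans (sym (loads (snk i)))
        (trans (trans (sym (cong (_+ tally u (snk i)) (empty head (vanish val) (snk i)))) (trans (Valid.balance val (snk i)) (cong (_+ tally (snk ∘ J) (snk i)) (empty tail (vanish val) (snk i)))))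
          (tally-map snk snk-injective J i))))

  finish : ∀ u → Pending B u → History B u → ∀ μ → coeff (D u) μ ≡ + ind (valid? B μ u)
  finish u pending hist = finish-at u (proj₁ ∘ at-sink) (proj₂ ∘ at-sink) increasing
    where
    open History hist
    at-sink : ∀ r → ∃ λ j → u r ≡ snk j
    at-sink r with pending r
    ... | inj₁ le = ⊥-elim (ℕP.<⇒≱ (key-bound tail head acyclic (u r)) le)
    ... | inj₂ s  = s
    increasing : StrictlyIncreasing (proj₁ ∘ at-sink)
    increasing r s r<s = noncrossing (cast-walk (proj₂ (at-sink r)) (walk r)) (cast-walk (proj₂ (at-sink s)) (walk s))
      (λ y on on′ → disjoint s r (λ eq → ℕP.<⇒≢ r<s (cong toℕ (sym eq))) y (on-cast (proj₂ (at-sink s)) (walk s) y on) (on-cast (proj₂ (at-sink r)) (walk r) y on′)) (incI r s r<s)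

  -- The vertices are processed in topological order, so each path is advanced only when no other path can still reach its position.
  sweep : ∀ d x → x + d ≡ B → ∀ u → Pending x u → History x u → ∀ μ → coeff (D u) μ ≡ + ind (valid? x μ u)
  sweep zero x eq u pending hist μ = subst (λ x → Pending x u → History x u → coeff (D u) μ ≡ + ind (valid? x μ u)) (trans (sym eq) (ℕP.+-identityʳ x)) (λ p h → finish u p h μ) pending hist
  sweep (suc d) x eq u pending hist μ with FinP.any? (λ r → (ord (u r) ℕ.≟ x) ×-dec ¬? (FinP.any? (λ j → u r Fin.≟ snk j)))
  ... | no none = trans (sweep d (suc x) (trans (sym (ℕP.+-suc x d)) eq) u pending′ (later hist) μ)
          (cong +_ (ind-⇔ (valid? (suc x) μ u) (valid? x μ u) (λ { (valid a b c) → valid a b (λ e lt → c e (ℕP.m<n⇒m<1+n lt)) }) (λ { (valid a b c) → valid a b (above′ a c) })))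
    where
    pending′ : Pending (suc x) u
    pending′ r with pending r
    ... | inj₂ s = inj₂ s
    ... | inj₁ le with ℕP.m≤n⇒m<n∨m≡n le
    ... | inj₁ lt = inj₁ lt
    ... | inj₂ eq with FinP.any? (λ j → u r Fin.≟ snk j)
    ... | yes s = inj₂ s
    ... | no ns = ⊥-elim (none (r , sym eq , ns))
    above′ : (∀ w → ins μ w + tally u w ≡ outs μ w + tally (snk ∘ J) w) → (∀ e → ord (tail e) < x → Vec.lookup μ e ≡ 0) → ∀ e → ord (tail e) < suc x → Vec.lookup μ e ≡ 0
    above′ bal abv e lt with ℕP.m≤n⇒m<n∨m≡n (ℕP.≤-pred lt)
    ... | inj₁ lt′ = abv e lt′
    -- Nothing arrives at the tail of `e`: edges into it start below order `x`, and a path standing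
    -- there would be at a sink, which no edge leaves. By balance nothing leaves it either.
    ... | inj₂ eq = ℕP.n≤0⇒n≡0 (ℕP.≤-trans (edge≤end tail μ (tail e) e refl) (ℕP.≤-trans (ℕP.m≤m+n _ _) (ℕP.≤-reflexive (trans (sym (bal (tail e)))
            (cong₂ _+_ (end-zero head μ (tail e) (λ e′ eq′ → abv e′ (subst (ord (tail e′) <_) (trans (cong ord eq′) eq) (ord-edge e′))))
              (tally-miss u (tail e) (λ r eq′ → none (r , trans (cong ord eq′) eq , λ { (j , s) → tail≢snk j e (trans (sym eq′) s) }))))))))
  ... | yes (r , now , inner) = Step.step x u r (λ j eq → inner (j , eq)) now μ advanced
    where
    advanced : ∀ e → tail e ≡ u r → ∀ μ′ → coeff (D (move u r (head e))) μ′ ≡ + ind (valid? (suc x) μ′ (move u r (head e)))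
    advanced e te μ′ with FinP.any? (λ s → ¬? (s Fin.≟ r) ×-dec (u s Fin.≟ head e))
    -- Two paths meet at `head e`: the determinant has two equal rows, and the bound at `head e`
    -- rules out validity. This takes the place of cancelling intersecting families in pairs.
    ... | yes (s , ne , hit) = trans (Det-equal-rows k (λ t c → W (move u r (head e) t) (J c)) s r ne
              (λ c → ≋-reflexive (cong (λ t → W t (J c)) (trans (move-off u r (head e) s ne) (trans hit (sym (move-at u r (head e))))))) μ′)
            (cong +_ (sym (ind-no (valid? (suc x) μ′ (move u r (head e))) collide)))
      where
      collide : ¬ Valid (suc x) μ′ (move u r (head e))
      collide val = ℕP.1+n≰n (ℕP.≤-trans (subst (_≤ tally (move u r (head e)) (head e))
          (cong₂ _+_ (ind-yes (move u r (head e) s Fin.≟ head e) (trans (move-off u r (head e) s ne) hit)) (ind-yes (move u r (head e) r Fin.≟ head e) (move-at u r (head e))))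
          (two-terms≤sumℕ (λ t → ind (move u r (head e) t Fin.≟ head e)) ne))
        (ℕP.≤-trans (ℕP.m≤n+m _ (ins μ′ (head e))) (Valid.bound val (head e))))
    ... | no free = sweep d (suc x) (trans (sym (ℕP.+-suc x d)) eq) (move u r (head e)) pending′ (advance hist r e te now (λ s ne hit → free (s , ne , hit))) μ′
      where
      pending′ : Pending (suc x) (move u r (head e))
      pending′ s with s Fin.≟ r
      ... | yes refl = inj₁ (subst (_< ord (head e)) (trans (cong ord te) now) (ord-edge e))
      ... | no ne with pending s
      ... | inj₂ sink = inj₂ sink
      ... | inj₁ le with ℕP.m≤n⇒m<n∨m≡n le
      ... | inj₁ lt = inj₁ lt
      ... | inj₂ eq = ⊥-elim (history-injective hist s r ne (key-injective tail head acyclic (trans (sym eq) (sym now))))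

  lgv : ∀ μ → coeff (D (src ∘ I)) μ ≡ + ind (valid? 0 μ (src ∘ I))
  lgv = sweep B 0 refl (src ∘ I) (λ r → inj₁ z≤n) record
    { walk = λ r → start
    ; disjoint = λ { r s ne y refl on → ne (increasing-injective incI r s (src-injective _ _ on)) }
    ; settled = λ r y on → inj₂ on }

-- Comparison of the two products of minors

tally-spread : ∀ {k N} (g : Fin N → ℕ) (c : Fin k → Fin N) → sumℕ (λ i → g i * tally c i) ≡ sumℕ (λ r → g (c r))
tally-spread g c = trans (sumℕ-cong (λ i → *-sumℕ (g i) (λ r → ind (c r Fin.≟ i))))
  (trans (sumℕ-comm (λ i r → g i * ind (c r Fin.≟ i)))
    (sumℕ-cong (λ r → trans (sumℕ-single (c r) (λ i ne → trans (cong (_*_ (g i)) (ind-no (c r Fin.≟ i) (ne ∘ sym))) (ℕP.*-zeroʳ (g i))))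
      (trans (cong (_*_ (g (c r))) (ind-yes (c r Fin.≟ c r) refl)) (ℕP.*-identityʳ (g (c r)))))))

prefix-tallies : ∀ {k N} (c d : Fin k → Fin N) x → prefix (λ i → + tally c i ℤ.- + tally d i) x ≡ + sumℕ (λ r → ind (toℕ (c r) <? x)) ℤ.- + sumℕ (λ r → ind (toℕ (d r) <? x))
prefix-tallies c d x =
  trans (sumℤ-cong (λ i → expand (+ ind (toℕ i <? x)) (+ tally c i) (+ tally d i)))
    (trans (sumℤ-+ (λ i → + ind (toℕ i <? x) ℤ.* + tally c i) (λ i → - 1ℤ ℤ.* (+ ind (toℕ i <? x) ℤ.* + tally d i)))
      (cong₂ ℤ._+_ (spread c) (trans (sym (*-sumℤ (- 1ℤ) (λ i → + ind (toℕ i <? x) ℤ.* + tally d i))) (trans (ℤP.-1*i≡-i _) (cong -_ (spread d))))))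
  where
  expand : ∀ a b c → a ℤ.* (b ℤ.- c) ≡ a ℤ.* b ℤ.+ - 1ℤ ℤ.* (a ℤ.* c)
  expand = solve-∀
  spread : ∀ {k} (c : Fin k → Fin _) → sumℤ (λ i → + ind (toℕ i <? x) ℤ.* + tally c i) ≡ + sumℕ (λ r → ind (toℕ (c r) <? x))
  spread c = trans (sumℤ-cong (λ i → sym (ℤP.pos-* (ind (toℕ i <? x)) (tally c i)))) (trans (sym (pos-sum (λ i → ind (toℕ i <? x) * tally c i))) (cong +_ (tally-spread (λ i → ind (toℕ i <? x)) c)))

-- Later indices leave fewer of them before `x`. This fixes the signs of the prefix sums along the
-- boundary, and so the side of `X₀` on which the heights lie.
counts-antitone : ∀ {k N} (c d : Fin k → Fin N) → (∀ r → c r Fin.≤ d r) → ∀ x → sumℕ (λ r → ind (toℕ (d r) <? x)) ≤ sumℕ (λ r → ind (toℕ (c r) <? x))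
counts-antitone c d le x = sumℕ-mono (λ r → go r (toℕ (d r) <? x))
  where
  go : ∀ r (e : Dec (toℕ (d r) < x)) → ind e ≤ ind (toℕ (c r) <? x)
  go r (yes lt) = ℕP.≤-reflexive (sym (ind-yes (toℕ (c r) <? x) (ℕP.≤-<-trans (le r) lt)))
  go r (no _)   = z≤n

module MinorMatrix {n : ℕ} (Γ : Network n) (acyclic : Acyclic Γ) (ss : SourcesSinks Γ)
             (σ σ⁻¹ : Dart Γ → Dart Γ) (rot : PlanarRotation Γ σ σ⁻¹) where
  open Exchange Γ acyclic ss σ σ⁻¹ rot
  open PathWeights Γ acyclic tail≢snk snk-injective using (W; W-enumeration)
  open PolyDet {m} using (≋-sym; ≋-trans; ≋-reflexive; det-Det; Det-cong)
  module L {k : ℕ} = LGV Γ acyclic ss σ σ⁻¹ rot {k}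

  sum-kinds : ∀ (F : Fin E → ℕ) → sumℕ F ≡ sumℕ (F ∘ arc) + (sumℕ (F ∘ inlet) + sumℕ (F ∘ outlet))
  sum-kinds F = trans (sumℕ-↑ m F) (cong (_+_ (sumℕ (F ∘ arc))) (trans (sumℕ-↑ n (λ r → F (m ↑ʳ r)))
    (cong (_+_ (sumℕ (F ∘ inlet))) (sumℕ-permute (λ j → F (m ↑ʳ (n ↑ʳ j))) (permutation opposite opposite FinP.opposite-involutive FinP.opposite-involutive)))))

  module _ {k : ℕ} (ν : Monomial m) (I J : Fin k → Fin n) where

    -- The endpoints, as multiplicities of inlets and outlets, close `ν` through ∞. `Valid` with
    -- threshold 0 then becomes `Balanced`.
    augment : Fin E → ℕ
    augment e = [ Vec.lookup ν , [ tally I , tally J ]′ ]′ (kind e)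

    augment-arc : ∀ e → augment (arc e) ≡ Vec.lookup ν e
    augment-arc e = cong [ _ , _ ]′ (kind-arc e)
    augment-inlet : ∀ i → augment (inlet i) ≡ tally I i
    augment-inlet i = cong [ _ , _ ]′ (kind-inlet i)
    augment-outlet : ∀ j → augment (outlet j) ≡ tally J j
    augment-outlet j = cong [ _ , _ ]′ (kind-outlet j)

    private
      ind-suc : ∀ {x : V∞} {a w : Fin v} → x ≡ suc a → ind (x Fin.≟ suc w) ≡ ind (a Fin.≟ w)
      ind-suc {a = a} {w} refl = ind-⇔ (suc a Fin.≟ suc w) (a Fin.≟ w) FinP.suc-injective (cong suc)
      ind-zero : ∀ {x : V∞} {w : Fin v} → x ≡ zero → ind (x Fin.≟ suc w) ≡ 0
      ind-zero {w = w} refl = ind-no (zero Fin.≟ suc w) (λ ())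

    degree-to : ∀ w → degree to augment (suc w) ≡ sumℕ (λ e → ind (head e Fin.≟ w) * Vec.lookup ν e) + tally (src ∘ I) w
    degree-to w = trans (sum-kinds (λ e → ind (to e Fin.≟ suc w) * augment e)) (cong₂ _+_
      (sumℕ-cong (λ e → cong₂ _*_ (ind-suc (to-arc e)) (augment-arc e)))
      (trans (cong₂ _+_ (trans (sumℕ-cong (λ i → cong₂ _*_ (ind-suc (to-inlet i)) (augment-inlet i))) (tally-spread (λ i → ind (src i Fin.≟ w)) I))
                        (sumℕ-zero (λ j → cong (_* augment (outlet j)) (ind-zero (to-outlet j))))) (ℕP.+-identityʳ _)))

    degree-from : ∀ w → degree from augment (suc w) ≡ sumℕ (λ e → ind (tail e Fin.≟ w) * Vec.lookup ν e) + tally (snk ∘ J) w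
    degree-from w = trans (sum-kinds (λ e → ind (from e Fin.≟ suc w) * augment e)) (cong₂ _+_
      (sumℕ-cong (λ e → cong₂ _*_ (ind-suc (from-arc e)) (augment-arc e)))
      (cong₂ _+_ (sumℕ-zero (λ i → cong (_* augment (inlet i)) (ind-zero (from-inlet i))))
                 (trans (sumℕ-cong (λ j → cong₂ _*_ (ind-suc (from-outlet j)) (augment-outlet j))) (tally-spread (λ j → ind (snk j Fin.≟ w)) J))))

    module _ (incI : StrictlyIncreasing I) (incJ : StrictlyIncreasing J) where

      valid⇒balanced : L.Valid I J incI incJ 0 ν (src ∘ I) → Balanced augment
      valid⇒balanced (L.valid bal bnd _) = record
        { conserved = λ w → trans (degree-to w) (trans (bal w) (sym (degree-from w)))
        ; bounded = λ w → subst (_≤ 1) (sym (degree-to w)) (bnd w) }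

      balanced⇒valid : Balanced augment → L.Valid I J incI incJ 0 ν (src ∘ I)
      balanced⇒valid b = L.valid (λ w → trans (sym (degree-to w)) (trans (Balanced.conserved b w) (degree-from w)))
        (λ w → subst (_≤ 1) (degree-to w) (Balanced.bounded b w)) (λ e ())

  balanced-cong : ∀ {p q} → (∀ e → p e ≡ q e) → Balanced p → Balanced q
  balanced-cong {p} {q} eq b = record
    { conserved = λ w → trans (sym (degree-cong to p q (λ e _ → eq e))) (trans (Balanced.conserved b w) (degree-cong from p q (λ e _ → eq e)))
    ; bounded = λ w → subst (_≤ 1) (degree-cong to p q (λ e _ → eq e)) (Balanced.bounded b w) }

  module _ {k : ℕ} (I₁ I₂ J₁ J₂ : Fin k → Fin n)
           (incI₁ : StrictlyIncreasing I₁) (incI₂ : StrictlyIncreasing I₂) (incJ₁ : StrictlyIncreasing J₁) (incJ₂ : StrictlyIncreasing J₂)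
           (I₁≤I₂ : ∀ r → I₁ r Fin.≤ I₂ r) (J₁≤J₂ : ∀ r → J₁ r Fin.≤ J₂ r) (μ : Monomial m) where

    V₁₁ V₁₂ V₂₁ V₂₂ : Monomial m → Set
    V₁₁ ν = L.Valid I₁ J₁ incI₁ incJ₁ 0 ν (src ∘ I₁)
    V₁₂ ν = L.Valid I₁ J₂ incI₁ incJ₂ 0 ν (src ∘ I₁)
    V₂₁ ν = L.Valid I₂ J₁ incI₂ incJ₁ 0 ν (src ∘ I₂)
    V₂₂ ν = L.Valid I₂ J₂ incI₂ incJ₂ 0 ν (src ∘ I₂)

    module _ (ν₀ : Monomial m) (ν₀≤μ : ν₀ ≤ᵐ μ) (v₁₂ : V₁₂ ν₀) (v₂₁ : V₂₁ (μ ⊖ ν₀)) where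

      private
        p₀ q₀ : Fin E → ℕ
        p₀ = augment ν₀ I₁ J₂
        q₀ = augment (μ ⊖ ν₀) I₂ J₁

      open Pair p₀ q₀ (valid⇒balanced ν₀ I₁ J₂ incI₁ incJ₂ v₁₂) (valid⇒balanced (μ ⊖ ν₀) I₂ J₁ incI₂ incJ₁ v₂₁) using (U; f; swapped; swapped-balanced; upper-outlet; lower-inlet)

      S : Fin m → Bool
      S e = U (arc e)

      outlets-upper : ∀ j → U (outlet j) ≡ true
      outlets-upper = upper-outlet (λ x → subst (ℤ._≤ 0ℤ)
        (sym (trans (prefix-cong (λ j → cong₂ (λ s t → + s ℤ.- + t) (augment-outlet ν₀ I₁ J₂ j) (augment-outlet (μ ⊖ ν₀) I₂ J₁ j)) x) (prefix-tallies J₂ J₁ x)))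
        (ℤP.i≤j⇒i-j≤0 (ℤ.+≤+ (counts-antitone J₁ J₂ J₁≤J₂ x))))

      -- Where the tallies agree an exchange at the inlet has no effect; the remaining inlets must
      -- stay out of `U` for the sources to be kept.
      inlets-lower : ∀ i → tally I₁ i ≢ tally I₂ i → U (inlet i) ≡ false
      inlets-lower i ne = lower-inlet (λ x → subst (0ℤ ℤ.≤_)
        (sym (trans (prefix-cong (λ i → cong₂ (λ s t → + s ℤ.- + t) (augment-inlet ν₀ I₁ J₂ i) (augment-inlet (μ ⊖ ν₀) I₂ J₁ i)) x) (prefix-tallies I₁ I₂ x)))
        (ℤP.i≤j⇒0≤j-i (ℤ.+≤+ (counts-antitone I₁ I₂ I₁≤I₂ x)))) i
        (λ eq → ne (trans (sym (augment-inlet ν₀ I₁ J₂ i)) (trans eq (augment-inlet (μ ⊖ ν₀) I₂ J₁ i))))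

      module _ (ν : Monomial m) (ν≤μ : ν ≤ᵐ μ) (w₁₂ : V₁₂ ν) (w₂₁ : V₂₁ (μ ⊖ ν)) where

        private
          p q : Fin E → ℕ
          p = augment ν I₁ J₂
          q = augment (μ ⊖ ν) I₂ J₁

          complement : ∀ ρ → ρ ≤ᵐ μ → ∀ e → Vec.lookup ρ e + Vec.lookup (μ ⊖ ρ) e ≡ Vec.lookup μ e
          complement ρ le e = trans (cong (_+_ (Vec.lookup ρ e)) (lookup-⊖ μ ρ e)) (ℕP.m+[n∸m]≡n (le e))

          same : ∀ e → p e + q e ≡ p₀ e + q₀ e
          same e with kind-view e
          ... | is-arc e′ = trans (cong₂ _+_ (augment-arc ν I₁ J₂ e′) (augment-arc (μ ⊖ ν) I₂ J₁ e′)) (trans (complement ν ν≤μ e′)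
                  (sym (trans (cong₂ _+_ (augment-arc ν₀ I₁ J₂ e′) (augment-arc (μ ⊖ ν₀) I₂ J₁ e′)) (complement ν₀ ν₀≤μ e′))))
          ... | is-inlet i = cong₂ _+_ (trans (augment-inlet ν I₁ J₂ i) (sym (augment-inlet ν₀ I₁ J₂ i))) (trans (augment-inlet (μ ⊖ ν) I₂ J₁ i) (sym (augment-inlet (μ ⊖ ν₀) I₂ J₁ i)))
          ... | is-outlet j = cong₂ _+_ (trans (augment-outlet ν I₁ J₂ j) (sym (augment-outlet ν₀ I₁ J₂ j))) (trans (augment-outlet (μ ⊖ ν) I₂ J₁ j) (sym (augment-outlet (μ ⊖ ν₀) I₂ J₁ j)))

          bp = valid⇒balanced ν I₁ J₂ incI₁ incJ₂ w₁₂
          bq = valid⇒balanced (μ ⊖ ν) I₂ J₁ incI₂ incJ₁ w₂₁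

          keep : ∀ i (a b : ℕ) → (a ≡ b ⊎ U (inlet i) ≡ false) → (if U (inlet i) then a else b) ≡ b
          keep i a b (inj₂ eq) rewrite eq = refl
          keep i a b (inj₁ refl) with U (inlet i)
          ... | true  = refl
          ... | false = refl

          tie : ∀ i → tally I₁ i ≡ tally I₂ i ⊎ U (inlet i) ≡ false
          tie i with tally I₁ i ℕ.≟ tally I₂ i
          ... | yes eq = inj₁ eq
          ... | no ne  = inj₂ (inlets-lower i ne)

          ρ : Monomial m
          ρ = reflect S μ ν

          swapped-first : ∀ e → swapped p q bp bq same e ≡ augment ρ I₁ J₁ e
          swapped-first e with kind-view e
          ... | is-arc e′ = trans (cong₂ (λ s t → if U (arc e′) then s else t) (trans (augment-arc (μ ⊖ ν) I₂ J₁ e′) (lookup-⊖ μ ν e′)) (augment-arc ν I₁ J₂ e′))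
                  (trans (sym (lookup-reflect S μ ν e′)) (sym (augment-arc ρ I₁ J₁ e′)))
          ... | is-inlet i = trans (cong₂ (λ s t → if U (inlet i) then s else t) (augment-inlet (μ ⊖ ν) I₂ J₁ i) (augment-inlet ν I₁ J₂ i))
                  (trans (keep i (tally I₂ i) (tally I₁ i) ([ (λ eq → inj₁ (sym eq)) , inj₂ ]′ (tie i))) (sym (augment-inlet ρ I₁ J₁ i)))
          ... | is-outlet j = trans (cong (λ b → if b then q (outlet j) else p (outlet j)) (outlets-upper j)) (trans (augment-outlet (μ ⊖ ν) I₂ J₁ j) (sym (augment-outlet ρ I₁ J₁ j)))

          same′ : ∀ e → q e + p e ≡ p₀ e + q₀ e
          same′ e = trans (ℕP.+-comm (q e) (p e)) (same e)

          pull : ∀ b x y → y ≤ x → (if b then y else x ∸ y) ≡ x ∸ (if b then x ∸ y else y)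
          pull true  x y le = sym (ℕP.m∸[m∸n]≡n le)
          pull false x y le = refl

          swapped-second : ∀ e → swapped q p bq bp same′ e ≡ augment (μ ⊖ ρ) I₂ J₂ e
          swapped-second e with kind-view e
          ... | is-arc e′ = trans (cong₂ (λ s t → if U (arc e′) then s else t) (augment-arc ν I₁ J₂ e′) (trans (augment-arc (μ ⊖ ν) I₂ J₁ e′) (lookup-⊖ μ ν e′)))
                  (trans (pull (S e′) (Vec.lookup μ e′) (Vec.lookup ν e′) (ν≤μ e′))
                    (trans (cong (Vec.lookup μ e′ ∸_) (sym (lookup-reflect S μ ν e′))) (trans (sym (lookup-⊖ μ ρ e′)) (sym (augment-arc (μ ⊖ ρ) I₂ J₂ e′)))))
          ... | is-inlet i = trans (cong₂ (λ s t → if U (inlet i) then s else t) (augment-inlet ν I₁ J₂ i) (augment-inlet (μ ⊖ ν) I₂ J₁ i))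
                  (trans (keep i (tally I₁ i) (tally I₂ i) (tie i)) (sym (augment-inlet (μ ⊖ ρ) I₂ J₂ i)))
          ... | is-outlet j = trans (cong (λ b → if b then p (outlet j) else q (outlet j)) (outlets-upper j)) (trans (augment-outlet ν I₁ J₂ j) (sym (augment-outlet (μ ⊖ ρ) I₂ J₂ j)))

        -- All outlets are exchanged and no inlet is, except with equal tallies: the targets are
        -- traded and the sources kept. On the arcs the exchange is the reflection in `S`, which
        -- comes from `ν₀`, whereas `ν` is arbitrary.
        exchanged : V₁₁ (reflect S μ ν) × V₂₂ (μ ⊖ reflect S μ ν)
        exchanged = balanced⇒valid ρ I₁ J₁ incI₁ incJ₁ (balanced-cong swapped-first (swapped-balanced p q bp bq same))
                  , balanced⇒valid (μ ⊖ ρ) I₂ J₂ incI₂ incJ₂ (balanced-cong swapped-second (swapped-balanced q p bq bp same′))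

    private
      d₁₁ : ∀ ν → Dec (V₁₁ ν)
      d₁₁ ν = L.valid? I₁ J₁ incI₁ incJ₁ 0 ν (src ∘ I₁)
      d₁₂ : ∀ ν → Dec (V₁₂ ν)
      d₁₂ ν = L.valid? I₁ J₂ incI₁ incJ₂ 0 ν (src ∘ I₁)
      d₂₁ : ∀ ν → Dec (V₂₁ ν)
      d₂₁ ν = L.valid? I₂ J₁ incI₂ incJ₁ 0 ν (src ∘ I₂)
      d₂₂ : ∀ ν → Dec (V₂₂ ν)
      d₂₂ ν = L.valid? I₂ J₂ incI₂ incJ₂ 0 ν (src ∘ I₂)

      F G : Monomial m → ℤ
      F ν = + ind (d₁₂ ν) ℤ.* + ind (d₂₁ (μ ⊖ ν))
      G ν = + ind (d₁₁ ν) ℤ.* + ind (d₂₂ (μ ⊖ ν))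

      product-≤ : ∀ {A B C D : Set} (a : Dec A) (b : Dec B) (c : Dec C) (d : Dec D) → (A → B → C × D) → + ind a ℤ.* + ind b ℤ.≤ + ind c ℤ.* + ind d
      product-≤ (no _)  b        c d f = subst (0ℤ ℤ.≤_) (ℤP.pos-* (ind c) (ind d)) (ℤ.+≤+ z≤n)
      product-≤ (yes _) (no _)   c d f = subst (0ℤ ℤ.≤_) (ℤP.pos-* (ind c) (ind d)) (ℤ.+≤+ z≤n)
      product-≤ (yes a) (yes b)  c d f = ℤP.≤-reflexive (sym (cong₂ (λ s t → + s ℤ.* + t) (ind-yes c (proj₁ (f a b))) (ind-yes d (proj₂ (f a b)))))

    -- One pair, if there is any, supplies the set `S′`. Then each `F ν` is at most
    -- `G (reflect S′ μ ν)`, and the reflection disappears under the sum. Without a pair all `F ν`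
    -- vanish.
    pairs-≤ : sumBox μ F ℤ.≤ sumBox μ G
    pairs-≤ with search μ (λ ν → d₁₂ ν ×-dec d₂₁ (μ ⊖ ν))
    ... | inj₂ none = sumBox-mono μ (λ ν le → product-≤ (d₁₂ ν) (d₂₁ (μ ⊖ ν)) (d₁₁ ν) (d₂₂ (μ ⊖ ν)) (λ a b → ⊥-elim (none ν le (a , b))))
    ... | inj₁ (ν₀ , le₀ , a₀ , b₀) = ℤP.≤-trans
          (sumBox-mono μ (λ ν le → product-≤ (d₁₂ ν) (d₂₁ (μ ⊖ ν)) (d₁₁ (reflect S′ μ ν)) (d₂₂ (μ ⊖ reflect S′ μ ν)) (λ a b → exchanged ν₀ le₀ a₀ b₀ ν le a b)))
          (ℤP.≤-reflexive (sumBox-reflect S′ μ G))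
      where
      S′ : Fin m → Bool
      S′ = S ν₀ le₀ a₀ b₀

    module _ (T₁₁ T₁₂ T₂₁ T₂₂ : Poly m)
             (c₁₁ : ∀ ν → coeff T₁₁ ν ≡ + ind (d₁₁ ν)) (c₁₂ : ∀ ν → coeff T₁₂ ν ≡ + ind (d₁₂ ν))
             (c₂₁ : ∀ ν → coeff T₂₁ ν ≡ + ind (d₂₁ ν)) (c₂₂ : ∀ ν → coeff T₂₂ ν ≡ + ind (d₂₂ ν)) where

      minor-coeff : 0ℤ ℤ.≤ coeff ((T₁₁ *P T₂₂) -P (T₁₂ *P T₂₁)) μ
      minor-coeff = subst (0ℤ ℤ.≤_) (sym (trans (coeff-+ (T₁₁ *P T₂₂) (-P (T₁₂ *P T₂₁)) μ) (cong₂ ℤ._+_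
          (trans (coeff-product T₁₁ T₂₂ μ) (sumBox-cong μ (λ ν → cong₂ ℤ._*_ (c₁₁ ν) (c₂₂ (μ ⊖ ν)))))
          (trans (coeff-neg (T₁₂ *P T₂₁) μ) (cong -_ (trans (coeff-product T₁₂ T₂₁ μ) (sumBox-cong μ (λ ν → cong₂ ℤ._*_ (c₁₂ ν) (c₂₁ (μ ⊖ ν))))))))))
        (ℤP.i≤j⇒0≤j-i pairs-≤)

  Wℕ-inside : ∀ enum {i j} (i<n : i < n) (j<n : j < n) → Wℕ Γ enum i j ≡ weightMatrix Γ enum (fromℕ< i<n) (fromℕ< j<n)
  Wℕ-inside enum {i} {j} i<n j<n with i <? n | j <? n
  ... | yes _ | yes _ = refl
  ... | yes _ | no ¬q = ⊥-elim (¬q j<n)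
  ... | no ¬p | _     = ⊥-elim (¬p i<n)

  minorMatrix-coeff : ∀ enum → IsPathEnumeration Γ enum → ∀ {k} (A B : Fin k → Fin n) i j (I J : Fin k → Fin n) →
    (∀ r → toℕ (I r) ≡ i + toℕ (A r)) → (∀ r → toℕ (J r) ≡ j + toℕ (B r)) → (incI : StrictlyIncreasing I) (incJ : StrictlyIncreasing J) →
    ∀ ν → coeff (minorMatrix Γ enum k A B i j) ν ≡ + ind (L.valid? I J incI incJ 0 ν (src ∘ I))
  minorMatrix-coeff enum en {k} A B i j I J eqI eqJ incI incJ ν =
    trans (coeff-cong (≋-trans (det-Det k _) (Det-cong k entry)) ν) (L.lgv I J incI incJ ν)
    where
    entry : ∀ r c → Wℕ Γ enum (i + toℕ (A r)) (j + toℕ (B c)) ≋ W (src (I r)) (J c)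
    entry r c = ≋-trans (≋-reflexive (trans (cong₂ (Wℕ Γ enum) (sym (eqI r)) (sym (eqJ c)))
        (trans (Wℕ-inside enum (FinP.toℕ<n (I r)) (FinP.toℕ<n (J c))) (cong₂ (weightMatrix Γ enum) (FinP.fromℕ<-toℕ (I r) (FinP.toℕ<n (I r))) (FinP.fromℕ<-toℕ (J c) (FinP.toℕ<n (J c)))))))
      (W-enumeration (en (I r) (J c)))

-- Shifted index sets and the theorem

shifted : ∀ {k n} (A : Fin (suc k) → Fin n) → StrictlyIncreasing A → ∀ i → i + toℕ (A (fromℕ k)) < n → ∀ r → i + toℕ (A r) < n
shifted {k} A inc i bound r = ℕP.≤-<-trans (ℕP.+-monoʳ-≤ i below) bound
  where
  below : toℕ (A r) ≤ toℕ (A (fromℕ k))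
  below with FinP.<-cmp r (fromℕ k)
  ... | tri< lt _ _   = ℕP.<⇒≤ (inc r (fromℕ k) lt)
  ... | tri≈ _ refl _ = ℕP.≤-refl
  ... | tri> _ _ gt   = ⊥-elim (ℕP.<⇒≱ gt (FinP.≤fromℕ r))

module _ {k n : ℕ} (A : Fin (suc k) → Fin n) (inc : StrictlyIncreasing A) (i : ℕ) (bound : i + toℕ (A (fromℕ k)) < n) where

  shift : Fin (suc k) → Fin n
  shift r = fromℕ< (shifted A inc i bound r)

  toℕ-shift : ∀ r → toℕ (shift r) ≡ i + toℕ (A r)
  toℕ-shift r = FinP.toℕ-fromℕ< (shifted A inc i bound r)

  shift-increasing : StrictlyIncreasing shift
  shift-increasing r s r<s = subst₂ _<_ (sym (toℕ-shift r)) (sym (toℕ-shift s)) (ℕP.+-monoʳ-< i (inc r s r<s))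

theorem1p6 : (n : ℕ) (Γ : Network n) → IsPlanarNetwork Γ →
    (enum : Fin n → Fin n → List (List (Fin (Network.m Γ)))) → IsPathEnumeration Γ enum →
    (k : ℕ) (A B : Fin (suc k) → Fin n) → StrictlyIncreasing A → StrictlyIncreasing B →
    (i₁ i₂ j₁ j₂ : ℕ) → i₁ < i₂ → i₂ + toℕ (A (fromℕ k)) < n →
    j₁ < j₂ → j₂ + toℕ (B (fromℕ k)) < n →
    NonNegCoeffs (minor2 (minorMatrix Γ enum (suc k) A B) i₁ i₂ j₁ j₂)
theorem1p6 n Γ (acyclic , ss , σ , σ⁻¹ , rot) enum en k A B incA incB i₁ i₂ j₁ j₂ i₁<i₂ i₂-bound j₁<j₂ j₂-bound μ =
  minor-coeff I₁ I₂ J₁ J₂ incI₁ incI₂ incJ₁ incJ₂ (le A incA i₁<i₂ i₁-bound i₂-bound) (le B incB j₁<j₂ j₁-bound j₂-bound) μ (t i₁ j₁) (t i₁ j₂) (t i₂ j₁) (t i₂ j₂)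
    (coeffs i₁ j₁ I₁ J₁ (toℕ-shift A incA i₁ i₁-bound) (toℕ-shift B incB j₁ j₁-bound) incI₁ incJ₁)
    (coeffs i₁ j₂ I₁ J₂ (toℕ-shift A incA i₁ i₁-bound) (toℕ-shift B incB j₂ j₂-bound) incI₁ incJ₂)
    (coeffs i₂ j₁ I₂ J₁ (toℕ-shift A incA i₂ i₂-bound) (toℕ-shift B incB j₁ j₁-bound) incI₂ incJ₁)
    (coeffs i₂ j₂ I₂ J₂ (toℕ-shift A incA i₂ i₂-bound) (toℕ-shift B incB j₂ j₂-bound) incI₂ incJ₂)
  where
  open MinorMatrix Γ acyclic ss σ σ⁻¹ rot
  t = minorMatrix Γ enum (suc k) A B
  coeffs = minorMatrix-coeff enum en A B
  i₁-bound : i₁ + toℕ (A (fromℕ k)) < n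
  i₁-bound = ℕP.<-trans (ℕP.+-monoˡ-< (toℕ (A (fromℕ k))) i₁<i₂) i₂-bound
  j₁-bound : j₁ + toℕ (B (fromℕ k)) < n
  j₁-bound = ℕP.<-trans (ℕP.+-monoˡ-< (toℕ (B (fromℕ k))) j₁<j₂) j₂-bound
  I₁ I₂ J₁ J₂ : Fin (suc k) → Fin n
  I₁ = shift A incA i₁ i₁-bound
  I₂ = shift A incA i₂ i₂-bound
  J₁ = shift B incB j₁ j₁-bound
  J₂ = shift B incB j₂ j₂-bound
  incI₁ = shift-increasing A incA i₁ i₁-bound
  incI₂ = shift-increasing A incA i₂ i₂-bound
  incJ₁ = shift-increasing B incB j₁ j₁-bound
  incJ₂ = shift-increasing B incB j₂ j₂-bound
  le : ∀ (A : Fin (suc k) → Fin n) (inc : StrictlyIncreasing A) {a b} → a < b → (pa : a + toℕ (A (fromℕ k)) < n) (pb : b + toℕ (A (fromℕ k)) < n) → ∀ r → shift A inc a pa r Fin.≤ shift A inc b pb r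
  le A inc {a} {b} a<b pa pb r = subst₂ _≤_ (sym (toℕ-shift A inc a pa r)) (sym (toℕ-shift A inc b pb r)) (ℕP.+-monoˡ-≤ (toℕ (A r)) (ℕP.<⇒≤ a<b))
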